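{- Let $p$ be an odd prime, $a\in\mathbb{Z}_p$ with $a\not\equiv0,-1\pmod p$, put $a'=(a-\langle a\rangle_p)/p$ and $Q_p(a)=\sum_{k=0}^{p-1}(a-2k)\binom ak^4$. If $\langle a\rangle_p<\frac p2$, then $$Q_p(a)\equiv a'p(-1)^{\langle a\rangle_p}\binom{2\langle a\rangle_p}{\langle a\rangle_p}\Big(1+2a'p(H_{2\langle a\rangle_p}-H_{\langle a\rangle_p})+a'^2p^2\big(2(H_{2\langle a\rangle_p}-H_{\langle a\rangle_p})^2-2H^{(2)}_{2\langle a\rangle_p}+H^{(2)}_{\langle a\rangle_p}\big)\Big)\pmod{p^4}.$$ If $\langle a\rangle_p>\frac p2$, then $$Q_p(a)\equiv\frac{a'(2a'+1)}{2a+1}p^2(-1)^{\frac{p-1}2}(-16)^{\langle a\rangle_p}\binom{2(\langle a\rangle_p-\frac{p-1}2)}{\langle a\rangle_p-\frac{p-1}2}^{ -1}\Big(1+p\Big(\frac{2a'+1}{2a+1}+(2a'-1)q_p(2)-\frac{2a'+1}2\big(H_{p-1-\langle a\rangle_p}-H_{\langle a\rangle_p-\frac{p+1}2}\big)\Big)\Big)\pmod{p^4}.$$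
   Context: $\mathbb{Z}_p$ denotes the set of rational numbers whose denominator is not divisible by $p$; congruences are taken in $\mathbb{Z}_p$. For $a\in\mathbb{Z}_p$, $\langle a\rangle_p$ is the unique integer in $\{0,1,\dots,p-1\}$ with $a\equiv\langle a\rangle_p\pmod p$. The general binomial coefficient is $\binom a0=1$, $\binom ak=a(a-1)\cdots(a-k+1)/k!$ for $k\ge1$. $q_p(2)=(2^{p-1}-1)/p$. $H_0=H^{(2)}_0=0$, $H_n=\sum_{j=1}^n\frac1j$, $H^{(2)}_n=\sum_{j=1}^n\frac1{j^2}$. -}

module Defs where

open import Data.Nat as ℕ using (ℕ; zero; suc)
open import Data.Nat.Divisibility as ℕD using ()
open import Data.Integer as ℤ using (ℤ; +_; -[1+_])
open import Data.Rational as ℚ using (ℚ; mkℚ; 0ℚ; 1ℚ; _+_; _*_; _-_; _/_; ↧ₙ_; 1/_)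
open import Data.Product using (∃; _×_)
open import Relation.Binary.PropositionalEquality using (_≡_)
open import Relation.Nullary using (¬_)

ℕ→ℚ : ℕ → ℚ
ℕ→ℚ n = + n / 1

InZp : ℕ → ℚ → Set
InZp p x = ¬ (p ℕD.∣ (↧ₙ x))

CongMod : ℕ → ℚ → ℚ → ℚ → Set
CongMod p x y m = ∃ λ z → InZp p z × (x - y ≡ m * z)

infixr 8 _^_
_^_ : ℚ → ℕ → ℚ
x ^ zero = 1ℚ
x ^ suc n = x * (x ^ n)

-- reciprocal (total; 0 ↦ 0, only ever applied to nonzero values)
recip : ℚ → ℚ
recip q@(mkℚ (+ zero) _ _) = 0ℚ
recip q@(mkℚ (+ suc n) _ _) = 1/ q
recip q@(mkℚ -[1+ n ] _ _) = 1/ q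

binom : ℚ → ℕ → ℚ
binom a zero = 1ℚ
binom a (suc k) = binom a k * (a - ℕ→ℚ k) * (+ 1 / suc k)

sumTo : ℕ → (ℕ → ℚ) → ℚ
sumTo zero f = 0ℚ
sumTo (suc n) f = sumTo n f + f n

H : ℕ → ℚ
H n = sumTo n (λ i → + 1 / suc i)

H2 : ℕ → ℚ
H2 n = sumTo n (λ i → + 1 / (suc i ℕ.* suc i))

qp2 : ℕ → ℚ
qp2 p = (ℕ→ℚ (2 ℕ.^ (p ℕ.∸ 1)) - 1ℚ) * recip (ℕ→ℚ p)

Qp : ℕ → ℚ → ℚ
Qp p a = sumTo p (λ k → (a - ℕ→ℚ (2 ℕ.* k)) * binom a k ^ 4)

-- Write a = r + u with u = p a′. The terms with k > r vanish mod p⁴, and with g(x) = x⁴ the rest is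
-- G · Σ_{k+l=r} (u + l - k) / (g(1) ⋯ g(k) g(u+1) ⋯ g(u+l)) with G = g(u+1) ⋯ g(u+r). Deform g to
-- g(x) = x (x³ - v) with v = u³ ∈ p³ℤₚ: the sum becomes a very-well-poised ₅F₄ whose parameters are
-- shifted by u, ζu, ζ²u for a primitive cube root of unity ζ, and Dougall's theorem evaluates it as
-- (-1)ʳ u Π_{j≤r} (r+j+2u)(j+u)/(j²+ju+u²). Mod p⁴ the deformation is invisible: the second difference in
-- (u, v) is divisible by p⁴, and at u = 0 the sum vanishes by the antisymmetry k ↔ l.
-- If r < p/2 the product is expanded mod p³. If r > p/2 it contains one more multiple of p, namely
-- p + 2u, and the remaining factors are compared with factorials and harmonic numbers mod p².
module Submission where

-- The truncated sum becomes summable once it ends for a reason of its own. Extended to negative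
-- indices, 1/(g(1)⋯g(k)) vanishes for k < 0 when 0 is a root of g, and 1/(g(u+1)⋯g(u+l)) vanishes
-- for l < 0 when u is a root. So g needs both roots, and x⁴ has only the first. Among xʲ(x⁴⁻ʲ -
-- u⁴⁻ʲ) with j = 1, 2, 3, the choice j = 1 is closest to x⁴: it moves a single coefficient, by u³ ∈
-- p³ℤₚ. This leaves one power of p missing, and it has to come from the sum itself, which is
-- divisible by p. To exploit that, u and v stay independent at first: the sum must vanish at u = 0
-- for every v, not only for v = 0, before v = u³ ties the two together. Cube roots of unity never
-- appear. The evaluation is an induction on r along a first-order recurrence with a polynomial
-- certificate, and the three shifted parameters enter only through s³ - v and s³ + v.

module Core where

  open import Defs using (ℕ→ℚ; InZp; recip)
  open import Algebra.Bundles using (CommutativeRing)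
  import Algebra.Solver.Ring as RingSolver
  open import Algebra.Solver.Ring.AlmostCommutativeRing using (AlmostCommutativeRing; fromCommutativeRing; _-Raw-AlmostCommutative⟶_)
  open import Algebra.Structures using (IsCommutativeRing)
  open import Data.Bool using () renaming (T to IsTrue)
  open import Data.Empty using (⊥-elim)
  open import Data.Integer as ℤ using (ℤ; -[1+_])
  import Data.Integer.Divisibility.Signed as ℤD
  import Data.Integer.Properties as ℤP
  open import Data.Maybe using (Maybe; just; nothing; is-just)
  open import Data.Nat as ℕ using (ℕ; zero; suc; _<_; _!)
  open import Data.Nat.Combinatorics using (nCk≡n!/k![n-k]!; k![n∸k]!∣n!) renaming (_C_ to _choose_)
  import Data.Nat.Coprimality as Coprimality
  open import Data.Nat.Divisibility using (_∣_; divides; ∣-trans; >⇒∤; _∣0)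
  import Data.Nat.DivMod as ℕD
  open import Data.Nat.Primality using (Prime; euclidsLemma; prime⇒nonTrivial; prime⇒nonZero)
  import Data.Nat.Properties as ℕP
  open import Data.Product using (_×_; _,_; proj₁; proj₂)
  open import Data.Rational as ℚ using (ℚ; mkℚ; 0ℚ; 1ℚ; ↥_; ↧_; ↧ₙ_; toℚᵘ)
  import Data.Rational.Properties as ℚP
  import Data.Rational.Unnormalised as ℚᵘ
  import Data.Rational.Unnormalised.Properties as ℚᵘP
  open import Data.Sum using ([_,_])
  open import Data.Vec using (Vec; []; _∷_)
  open import Data.Vec.N-ary using (N-ary; Eq; curryⁿ; curryⁿ-cong)
  open import Data.Vec.Relation.Binary.Pointwise.Inductive as Pointwise using (Pointwise; []; _∷_)
  open import Data.Vec.Relation.Unary.All using (All; []; _∷_)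
  open import Data.Vec.Relation.Unary.All.Properties using (lookup⁺)
  open import Relation.Binary.PropositionalEquality using (_≡_; _≢_; refl; sym; trans; cong; cong₂; subst; setoid; module ≡-Reasoning)
  open import Relation.Nullary using (¬_; yes; no)

  -- Integers inside ℚ, denominators and reciprocals

  private module Fractions where
    [_]ᶻ : ℤ → ℚ
    [ i ]ᶻ = i ℚ./ 1

    []-+ : ∀ i j → [ i ℤ.+ j ]ᶻ ≡ [ i ]ᶻ ℚ.+ [ j ]ᶻ
    []-+ i j = ℚP.toℚᵘ-injective (begin
      toℚᵘ [ i ℤ.+ j ]ᶻ               ≈⟨ ℚP.toℚᵘ-fromℚᵘ _ ⟩
      ℚᵘ.mkℚᵘ (i ℤ.+ j) 0              ≈⟨ ℚᵘ.*≡* (cong (ℤ._* ℤ.+ 1) (cong₂ ℤ._+_ (sym (ℤP.*-identityʳ i)) (sym (ℤP.*-identityʳ j)))) ⟩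
      ℚᵘ.mkℚᵘ i 0 ℚᵘ.+ ℚᵘ.mkℚᵘ j 0      ≈⟨ ℚᵘP.+-cong (ℚP.toℚᵘ-fromℚᵘ (ℚᵘ.mkℚᵘ i 0)) (ℚP.toℚᵘ-fromℚᵘ (ℚᵘ.mkℚᵘ j 0)) ⟨
      toℚᵘ [ i ]ᶻ ℚᵘ.+ toℚᵘ [ j ]ᶻ  ≈⟨ ℚP.toℚᵘ-homo-+ [ i ]ᶻ [ j ]ᶻ ⟨
      toℚᵘ ([ i ]ᶻ ℚ.+ [ j ]ᶻ) ∎)
      where open ℚᵘP.≃-Reasoning

    []-* : ∀ i j → [ i ℤ.* j ]ᶻ ≡ [ i ]ᶻ ℚ.* [ j ]ᶻ
    []-* i j = ℚP.toℚᵘ-injective (begin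
      toℚᵘ [ i ℤ.* j ]ᶻ               ≈⟨ ℚP.toℚᵘ-fromℚᵘ _ ⟩
      ℚᵘ.mkℚᵘ i 0 ℚᵘ.* ℚᵘ.mkℚᵘ j 0      ≈⟨ ℚᵘP.*-cong (ℚP.toℚᵘ-fromℚᵘ (ℚᵘ.mkℚᵘ i 0)) (ℚP.toℚᵘ-fromℚᵘ (ℚᵘ.mkℚᵘ j 0)) ⟨
      toℚᵘ [ i ]ᶻ ℚᵘ.* toℚᵘ [ j ]ᶻ  ≈⟨ ℚP.toℚᵘ-homo-* [ i ]ᶻ [ j ]ᶻ ⟨
      toℚᵘ ([ i ]ᶻ ℚ.* [ j ]ᶻ) ∎)
      where open ℚᵘP.≃-Reasoning

    []-neg : ∀ i → [ ℤ.- i ]ᶻ ≡ ℚ.- [ i ]ᶻ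
    []-neg i = ℚP.toℚᵘ-injective (begin
      toℚᵘ [ ℤ.- i ]ᶻ               ≈⟨ ℚP.toℚᵘ-fromℚᵘ _ ⟩
      ℚᵘ.- ℚᵘ.mkℚᵘ i 0       ≈⟨ ℚᵘP.-‿cong (ℚP.toℚᵘ-fromℚᵘ (ℚᵘ.mkℚᵘ i 0)) ⟨
      ℚᵘ.- toℚᵘ [ i ]ᶻ  ≈⟨ ℚP.toℚᵘ-homo‿- [ i ]ᶻ ⟨
      toℚᵘ (ℚ.- [ i ]ᶻ) ∎)
      where open ℚᵘP.≃-Reasoning

    []-injective : ∀ {i j} → [ i ]ᶻ ≡ [ j ]ᶻ → i ≡ j
    []-injective {i} {j} eq with ℚP.fromℚᵘ-injective {x = ℚᵘ.mkℚᵘ i 0} {y = ℚᵘ.mkℚᵘ j 0} eq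
    ... | ℚᵘ.*≡* e = trans (sym (ℤP.*-identityʳ i)) (trans e (ℤP.*-identityʳ j))

    *-denominator : ∀ x → x ℚ.* ℕ→ℚ (↧ₙ x) ≡ [ ↥ x ]ᶻ
    *-denominator x@(mkℚ n d-1 _) = ℚP.toℚᵘ-injective (begin
      toℚᵘ (x ℚ.* ℕ→ℚ (suc d-1))               ≈⟨ ℚP.toℚᵘ-homo-* x (ℕ→ℚ (suc d-1)) ⟩
      toℚᵘ x ℚᵘ.* toℚᵘ (ℕ→ℚ (suc d-1))       ≈⟨ ℚᵘP.*-congˡ {toℚᵘ x} (ℚP.toℚᵘ-fromℚᵘ (ℚᵘ.mkℚᵘ (ℤ.+ suc d-1) 0)) ⟩
      ℚᵘ.mkℚᵘ n d-1 ℚᵘ.* ℚᵘ.mkℚᵘ (ℤ.+ suc d-1) 0 ≈⟨ ℚᵘ.*≡* (ℤP.*-assoc n (ℤ.+ suc d-1) (ℤ.+ 1)) ⟩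
      ℚᵘ.mkℚᵘ n 0                             ≈⟨ ℚP.toℚᵘ-fromℚᵘ (ℚᵘ.mkℚᵘ n 0) ⟨
      toℚᵘ [ n ]ᶻ ∎)
      where open ℚᵘP.≃-Reasoning

    *-recip : ∀ x → x ≢ 0ℚ → x ℚ.* recip x ≡ 1ℚ
    *-recip x@(mkℚ (ℤ.+ zero) _ _) x≢0 = ⊥-elim (x≢0 (ℚP.↥p≡0⇒p≡0 x refl))
    *-recip x@(mkℚ (ℤ.+ suc _) _ _) _  = ℚP.*-inverseʳ x
    *-recip x@(mkℚ -[1+ _ ] _ _) _   = ℚP.*-inverseʳ x

    recip-unique : ∀ {x y} → x ℚ.* y ≡ 1ℚ → recip x ≡ y
    recip-unique {x} {y} xy≡1 = begin
      recip x                  ≡⟨ sym (ℚP.*-identityʳ (recip x)) ⟩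
      recip x ℚ.* 1ℚ           ≡⟨ cong (recip x ℚ.*_) (sym xy≡1) ⟩
      recip x ℚ.* (x ℚ.* y)    ≡⟨ sym (ℚP.*-assoc (recip x) x y) ⟩
      recip x ℚ.* x ℚ.* y      ≡⟨ cong (ℚ._* y) (trans (ℚP.*-comm (recip x) x) (*-recip x x≢0)) ⟩
      1ℚ ℚ.* y                 ≡⟨ ℚP.*-identityˡ y ⟩
      y                        ∎
      where
      open ≡-Reasoning
      x≢0 : x ≢ 0ℚ
      x≢0 refl = ℚP.1≢0 (trans (sym xy≡1) (ℚP.*-zeroˡ y))

    1/suc≡recip : ∀ k → ℤ.+ 1 ℚ./ suc k ≡ recip (ℕ→ℚ (suc k))
    1/suc≡recip k = sym (recip-unique {ℕ→ℚ (suc k)} (ℚP.toℚᵘ-injective (begin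
      toℚᵘ (ℕ→ℚ (suc k) ℚ.* (ℤ.+ 1 ℚ./ suc k))            ≈⟨ ℚP.toℚᵘ-homo-* (ℕ→ℚ (suc k)) (ℤ.+ 1 ℚ./ suc k) ⟩
      toℚᵘ (ℕ→ℚ (suc k)) ℚᵘ.* toℚᵘ (ℤ.+ 1 ℚ./ suc k)    ≈⟨ ℚᵘP.*-cong (ℚP.toℚᵘ-fromℚᵘ (ℚᵘ.mkℚᵘ (ℤ.+ suc k) 0)) (ℚP.toℚᵘ-fromℚᵘ (ℚᵘ.mkℚᵘ (ℤ.+ 1) k)) ⟩
      ℚᵘ.mkℚᵘ (ℤ.+ suc k) 0 ℚᵘ.* ℚᵘ.mkℚᵘ (ℤ.+ 1) k      ≈⟨ ℚᵘP.*-inverseʳ (ℚᵘ.mkℚᵘ (ℤ.+ suc k) 0) ⟩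
      toℚᵘ 1ℚ ∎)))
      where open ℚᵘP.≃-Reasoning

  -- The operations of ℚ compute on constructor forms, which stops the unifier from
  -- inverting them. Opaque copies make _+_, _*_, -_ injective for unification.
  infixl 6 _+_ _-_
  infixl 7 _*_
  infix  8 -_

  opaque
    _+_ _*_ : ℚ → ℚ → ℚ
    _+_ = ℚ._+_
    _*_ = ℚ._*_

    -_ inv : ℚ → ℚ
    -_  = ℚ.-_
    inv = recip

    ι : ℕ → ℚ
    ι = ℕ→ℚ

  _-_ : ℚ → ℚ → ℚ
  x - y = x + (- y)

  opaque
    unfolding _+_

    isCommutativeRing : IsCommutativeRing _≡_ _+_ _*_ -_ (ι 0) (ι 1)
    isCommutativeRing = ℚP.+-*-isCommutativeRing

    *-inv : ∀ {x} → x ≢ ι 0 → x * inv x ≡ ι 1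
    *-inv {x} = Fractions.*-recip x

    inv-unique : ∀ {x y} → x * y ≡ ι 1 → inv x ≡ y
    inv-unique {x} = Fractions.recip-unique {x}

    ι-injective : ∀ {m n} → ι m ≡ ι n → m ≡ n
    ι-injective eq = ℤP.+-injective (Fractions.[]-injective eq)

    ι-+ : ∀ m n → ι (m ℕ.+ n) ≡ ι m + ι n
    ι-+ m n = Fractions.[]-+ (ℤ.+ m) (ℤ.+ n)

    ι-* : ∀ m n → ι (m ℕ.* n) ≡ ι m * ι n
    ι-* m n = trans (cong Fractions.[_]ᶻ (ℤP.pos-* m n)) (Fractions.[]-* (ℤ.+ m) (ℤ.+ n))

    1/suc≡inv : ∀ k → ℤ.+ 1 ℚ./ suc k ≡ inv (ι (suc k))
    1/suc≡inv = Fractions.1/suc≡recip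

  -- A ring solver over ℚ with integer coefficients

  ⟪_⟫ : ℤ → ℚ
  ⟪ ℤ.+ n ⟫      = ι n
  ⟪ -[1+ n ] ⟫ = - ι (suc n)

  ℚ-ring : CommutativeRing _ _
  ℚ-ring = record { isCommutativeRing = isCommutativeRing }

  open CommutativeRing ℚ-ring using (*-comm; *-assoc; *-identityˡ; *-identityʳ; zeroˡ; zeroʳ; +-identityˡ; +-identityʳ; -‿inverseʳ) public

  opaque
    unfolding _+_

    ⟪⟫≡[] : ∀ i → ⟪ i ⟫ ≡ Fractions.[ i ]ᶻ
    ⟪⟫≡[] (ℤ.+ n)      = refl
    ⟪⟫≡[] -[1+ n ] = sym (Fractions.[]-neg (ℤ.+ suc n))

    ⟪⟫-+ : ∀ i j → ⟪ i ℤ.+ j ⟫ ≡ ⟪ i ⟫ + ⟪ j ⟫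
    ⟪⟫-+ i j = trans (⟪⟫≡[] (i ℤ.+ j)) (trans (Fractions.[]-+ i j) (sym (cong₂ _+_ (⟪⟫≡[] i) (⟪⟫≡[] j))))

    ⟪⟫-* : ∀ i j → ⟪ i ℤ.* j ⟫ ≡ ⟪ i ⟫ * ⟪ j ⟫
    ⟪⟫-* i j = trans (⟪⟫≡[] (i ℤ.* j)) (trans (Fractions.[]-* i j) (sym (cong₂ _*_ (⟪⟫≡[] i) (⟪⟫≡[] j))))

    ⟪⟫-neg : ∀ i → ⟪ ℤ.- i ⟫ ≡ - ⟪ i ⟫
    ⟪⟫-neg i = trans (⟪⟫≡[] (ℤ.- i)) (trans (Fractions.[]-neg i) (sym (cong -_ (⟪⟫≡[] i))))

    ⟪⟫-injective : ∀ {i j} → ⟪ i ⟫ ≡ ⟪ j ⟫ → i ≡ j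
    ⟪⟫-injective {i} {j} eq = Fractions.[]-injective (trans (sym (⟪⟫≡[] i)) (trans eq (⟪⟫≡[] j)))

    *-denominator : ∀ x → x * ι (↧ₙ x) ≡ ⟪ ↥ x ⟫
    *-denominator x = trans (Fractions.*-denominator x) (sym (⟪⟫≡[] (↥ x)))

  ι-suc : ∀ n → ι (suc n) ≡ ι 1 + ι n
  ι-suc = ι-+ 1

  ι-suc≢0 : ∀ n → ι (suc n) ≢ ι 0
  ι-suc≢0 n eq with ι-injective {suc n} {0} eq
  ... | ()

  ℚ-acr : AlmostCommutativeRing _ _
  ℚ-acr = fromCommutativeRing ℚ-ring

  ℤ⟶ℚ : ℤ.+-*-rawRing -Raw-AlmostCommutative⟶ ℚ-acr
  ℤ⟶ℚ = record { ⟦_⟧ = ⟪_⟫ ; +-homo = ⟪⟫-+ ; *-homo = ⟪⟫-* ; -‿homo = ⟪⟫-neg ; 0-homo = refl ; 1-homo = refl }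

  coeff≟ : ∀ i j → Maybe (⟪ i ⟫ ≡ ⟪ j ⟫)
  coeff≟ i j with i ℤ.≟ j
  ... | yes i≡j = just (cong ⟪_⟫ i≡j)
  ... | no  _   = nothing

  module RS = RingSolver ℤ.+-*-rawRing ℚ-acr ℤ⟶ℚ coeff≟
  open RS using (Polynomial; op; [+]; [*]; con; var; _:^_; :-_; _:+_; _:*_; _:-_; ⟦_⟧; ⟦_⟧↓; normalise; _≟N_; ⟦_⟧N-cong; correct; _:=_) public
  open import Relation.Binary.Reflection (setoid ℚ) var ⟦_⟧ ⟦_⟧↓ correct using (close) public

  -- Deciding equality of normal forms over ℤ avoids a conversion check between terms of ℚ.
  prove : ∀ {n} (ρ : Vec ℚ n) (e₁ e₂ : Polynomial n) → IsTrue (is-just (normalise e₁ ≟N normalise e₂)) → ⟦ e₁ ⟧ ρ ≡ ⟦ e₂ ⟧ ρ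
  prove ρ e₁ e₂ = equal (normalise e₁ ≟N normalise e₂)
    where
    equal : (m : Maybe (normalise e₁ RS.≈N normalise e₂)) → IsTrue (is-just m) → ⟦ e₁ ⟧ ρ ≡ ⟦ e₂ ⟧ ρ
    equal (just e) _ = trans (sym (correct e₁ ρ)) (trans (⟦ e ⟧N-cong ρ) (correct e₂ ρ))

  solve : ∀ n (f : N-ary n (Polynomial n) (Polynomial n × Polynomial n)) →
    {IsTrue (is-just (normalise (proj₁ (close n f)) ≟N normalise (proj₂ (close n f))))} →
    Eq n _≡_ (curryⁿ ⟦ proj₁ (close n f) ⟧) (curryⁿ ⟦ proj₂ (close n f) ⟧)
  solve n f {same} =
    curryⁿ-cong _≡_ ⟦ proj₁ (close n f) ⟧ ⟦ proj₂ (close n f) ⟧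
      (λ ρ → prove ρ (proj₁ (close n f)) (proj₂ (close n f)) same)

  κ : ∀ {n} → ℕ → Polynomial n
  κ k = con (ℤ.+ k)

  *-cancelˡ : ∀ {c i x y} → c * i ≡ ι 1 → c * x ≡ c * y → x ≡ y
  *-cancelˡ {c} {i} {x} {y} ci≡1 cx≡cy = begin
    x           ≡⟨ sym (*-identityˡ x) ⟩
    ι 1 * x     ≡⟨ cong (_* x) (sym ci≡1) ⟩
    c * i * x   ≡⟨ rearrange c i x ⟩
    i * (c * x) ≡⟨ cong (i *_) cx≡cy ⟩
    i * (c * y) ≡⟨ sym (rearrange c i y) ⟩
    c * i * y   ≡⟨ cong (_* y) ci≡1 ⟩
    ι 1 * y     ≡⟨ *-identityˡ y ⟩
    y           ∎
    where
    open ≡-Reasoning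
    rearrange : ∀ c i x → c * i * x ≡ i * (c * x)
    rearrange = solve 3 λ c i x → c :* i :* x := i :* (c :* x)

  inv-ι-square : ∀ i → inv (ι (suc i ℕ.* suc i)) ≡ inv (ι (suc i)) * inv (ι (suc i))
  inv-ι-square i = inv-unique (begin
    ι (suc i ℕ.* suc i) * (inv x * inv x)  ≡⟨ cong (_* (inv x * inv x)) (ι-* (suc i) (suc i)) ⟩
    x * x * (inv x * inv x)                ≡⟨ solve 2 (λ x y → x :* x :* (y :* y) := x :* y :* (x :* y)) x (inv x) ⟩
    x * inv x * (x * inv x)                ≡⟨ cong₂ _*_ (*-inv (ι-suc≢0 i)) (*-inv (ι-suc≢0 i)) ⟩
    ι 1 * ι 1                              ≡⟨ *-identityˡ (ι 1) ⟩
    ι 1                                    ∎)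
    where
    open ≡-Reasoning
    x = ι (suc i)

  x≡y⇒x-y≡0 : ∀ {x y} → x ≡ y → x - y ≡ ι 0
  x≡y⇒x-y≡0 {x} refl = -‿inverseʳ x

  -- Deduce x ≡ y from hypotheses eᵢ ≡ fᵢ by exhibiting x - y in the ideal of the eᵢ - fᵢ.
  modulo₁ : ∀ {x y e f} q → e ≡ f → x ≡ y + q * (e - f) → x ≡ y
  modulo₁ {x} {y} {e} {f} q e≡f x≡ = begin
    x                ≡⟨ x≡ ⟩
    y + q * (e - f)  ≡⟨ cong (λ d → y + q * d) (x≡y⇒x-y≡0 e≡f) ⟩
    y + q * ι 0      ≡⟨ cong (y +_) (zeroʳ q) ⟩
    y + ι 0          ≡⟨ +-identityʳ y ⟩
    y                ∎
    where open ≡-Reasoning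

  modulo₂ : ∀ {x y e f e′ f′} q q′ → e ≡ f → e′ ≡ f′ → x ≡ y + q * (e - f) + q′ * (e′ - f′) → x ≡ y
  modulo₂ q q′ e≡f e′≡f′ x≡ = modulo₁ q e≡f (modulo₁ q′ e′≡f′ x≡)

  -- Sums, products and convolutions

  sum prod : ℕ → (ℕ → ℚ) → ℚ
  sum zero    f = ι 0
  sum (suc n) f = sum n f + f n

  prod zero    f = ι 1
  prod (suc n) f = prod n f * f n

  prod-cong : ∀ n {f g} → (∀ i → i < n → f i ≡ g i) → prod n f ≡ prod n g
  prod-cong zero    f≡g = refl
  prod-cong (suc n) f≡g = cong₂ _*_ (prod-cong n (λ i i<n → f≡g i (ℕP.m<n⇒m<1+n i<n))) (f≡g n ℕP.≤-refl)

  prod-front : ∀ n f → prod (suc n) f ≡ f 0 * prod n (λ i → f (suc i))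
  prod-front zero    f = *-comm (ι 1) (f 0)
  prod-front (suc n) f = trans (cong (_* f (suc n)) (prod-front n f)) (*-assoc (f 0) _ (f (suc n)))

  infixr 8 _^_
  _^_ : ℚ → ℕ → ℚ
  x ^ zero  = ι 1
  x ^ suc n = x * x ^ n

  -- conv f n l is the sum of f j k over j < n and j + k + 1 ≡ n + l; in particular
  -- conv f (suc r) 0 runs over all j + k ≡ r, without truncated subtraction.
  conv : (ℕ → ℕ → ℚ) → ℕ → ℕ → ℚ
  conv f zero    l = ι 0
  conv f (suc n) l = conv f n (suc l) + f n l

  quartic : ℚ → ℚ → ℚ
  quartic v x = x * (x * x * x - v)

  -- `α i` and `β i` stand for the reciprocals of g(i+1) and g(i+1+u). They are parameters so that
  -- the recurrence needs the inverse laws only below a bound.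
  term : ℚ → (ℕ → ℚ) → (ℕ → ℚ) → ℕ → ℕ → ℚ
  term u α β k l = (u + ι l - ι k) * (prod k α * prod l β)

  -- Evaluation of the deformed sum

  module WZ where
    leading trailing : ℚ → ℚ → ℚ
    leading  v s = s * s * s * s * s * s - v * v
    trailing v s = ι 2 * s * (ι 2 * s - ι 1)

    -- Zeilberger recurrence in r for Σ_{k+l=r} (u + l - k) / Π g(j) Π g(i + u), g = quartic v,
    -- with s = r + 1 + u; certificate-step holds for every v, certificate-end needs v = u³.
    certificate : ℚ → ℚ → ℚ → ℚ
    certificate v s k = ι 2 * s * k * k - ι 6 * s * s * k + ι 5 * s * s * s + v

    module Syntax where
      :quartic :leading :trailing : ∀ {n} → Polynomial n → Polynomial n → Polynomial n
      :quartic v x = x :* (x :* x :* x :- v)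
      :leading v s = s :* s :* s :* s :* s :* s :- v :* v
      :trailing v s = κ 2 :* s :* (κ 2 :* s :- κ 1)
      :certificate : ∀ {n} → Polynomial n → Polynomial n → Polynomial n → Polynomial n
      :certificate v s k = κ 2 :* s :* k :* k :- κ 6 :* s :* s :* k :+ κ 5 :* s :* s :* s :+ v
    open Syntax

    certificate-step : ∀ v s k →
      leading v s * (s - ι 2 * k) + trailing v s * (s - ι 1 - ι 2 * k) * quartic v (s - k)
        ≡ quartic v (s - k) * certificate v s (ι 1 + k) - quartic v k * certificate v s k
    certificate-step = solve 3 λ v s k →
      :leading v s :* (s :- κ 2 :* k) :+ :trailing v s :* (s :- κ 1 :- κ 2 :* k) :* :quartic v (s :- k)
        := :quartic v (s :- k) :* :certificate v s (κ 1 :+ k) :- :quartic v k :* :certificate v s k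

    -- The telescoped range stops one short of the longer sum, whose last term has k = r + 1 and l =
    -- 0. That term cancels the boundary value of the antidifference exactly when u is a root of x³
    -- - v.
    certificate-end : ∀ u n → let s = n + u ; v = u * u * u in
      quartic v n * certificate v s n + leading v s * (u + ι 0 - n) ≡ ι 0
    certificate-end = solve 2 λ u n → let s = n :+ u ; v = u :* u :* u in
      :quartic v n :* :certificate v s n :+ :leading v s :* (u :+ κ 0 :- n) := κ 0

    quadratic : ℚ → ℚ → ℚ
    quadratic u n = n * n + n * u + u * u

    upper lower : ℚ → ℕ → ℚ
    upper u r = prod r (λ i → ι r + ι (suc i) + ι 2 * u)
    lower u r = prod r (λ i → (ι (suc i) + u) * inv (quadratic u (ι (suc i))))

    -- The factors of `upper u r` run over r+1, ..., 2r, shifted by 2u. Raising r drops the lowest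
    -- factor and appends two at the top. The dropped one is multiplied back so that nothing is
    -- divided.
    upper-suc : ∀ u r → let n = ι (suc r) in
      (n + ι 2 * u) * upper u (suc r) ≡ upper u r * (ι 2 * n - ι 1 + ι 2 * u) * (ι 2 * n + ι 2 * u)
    upper-suc u r = begin
      (n + ι 2 * u) * upper u (suc r)  ≡⟨ cong (_* upper u (suc r)) (solve 2 (λ n u → n :+ κ 2 :* u := n :+ κ 0 :+ κ 2 :* u) n u) ⟩
      f 0 * prod (suc r) (λ i → f (suc i))  ≡⟨ sym (prod-front (suc r) f) ⟩
      prod r f * f r * f (suc r)     ≡⟨ cong₂ (λ x y → x * y * f (suc r))
        (prod-cong r λ i _ → trans (cong (λ m → m + ι i + ι 2 * u) (ι-suc r))
           (trans (solve 3 (λ a b u → κ 1 :+ a :+ b :+ κ 2 :* u := a :+ (κ 1 :+ b) :+ κ 2 :* u) (ι r) (ι i) u)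
                  (cong (λ m → ι r + m + ι 2 * u) (sym (ι-suc i)))))
        (trans (solve 3 (λ a n u → n :+ a :+ κ 2 :* u := n :+ (κ 1 :+ a) :- κ 1 :+ κ 2 :* u) (ι r) n u)
           (trans (cong (λ m → n + m - ι 1 + ι 2 * u) (sym (ι-suc r)))
             (solve 2 (λ n u → n :+ n :- κ 1 :+ κ 2 :* u := κ 2 :* n :- κ 1 :+ κ 2 :* u) n u))) ⟩
      upper u r * (ι 2 * n - ι 1 + ι 2 * u) * f (suc r)
        ≡⟨ cong (upper u r * (ι 2 * n - ι 1 + ι 2 * u) *_) (solve 2 (λ n u → n :+ n :+ κ 2 :* u := κ 2 :* n :+ κ 2 :* u) n u) ⟩
      upper u r * (ι 2 * n - ι 1 + ι 2 * u) * (ι 2 * n + ι 2 * u) ∎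
      where
      open ≡-Reasoning
      n = ι (suc r)
      f : ℕ → ℚ
      f i = n + ι i + ι 2 * u

    module _ (u v : ℚ) (α β : ℕ → ℚ) (M : ℕ)
      (α-inverse : ∀ i → i < M → quartic v (ι (suc i)) * α i ≡ ι 1)
      (β-inverse : ∀ i → i < M → quartic v (ι (suc i) + u) * β i ≡ ι 1) where

      t : ℕ → ℕ → ℚ
      t = term u α β

      -- Partial sums over k < n: the first `conv` lies on the antidiagonal of r + 1, the second on
      -- that of r, and the invariant on n + l keeps them in step. The right side is the
      -- antidifference given by the certificate; it starts at zero because g(0) = 0.
      telescope : ∀ s r → r < M → s ≡ ι (suc r) + u → ∀ n l → n ℕ.+ l ≡ suc r →
        leading v s * conv t n (suc l) + trailing v s * conv t n l
          ≡ prod n α * prod l β * (quartic v (ι n) * certificate v s (ι n))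
      telescope s r r<M s≡ zero l _ =
        solve 7 (λ A B Y v s z c → A :* κ 0 :+ B :* κ 0 := κ 1 :* Y :* (κ 0 :* (κ 0 :* κ 0 :* κ 0 :- v) :* c))
          (leading v s) (trailing v s) (prod l β) v s s (certificate v s (ι 0))
      telescope s r r<M s≡ (suc n) l n+l≡r =
        modulo₁ (ι 1) (telescope s r r<M s≡ n (suc l) (trans (ℕP.+-suc n l) n+l≡r))
        (modulo₁ (X * Y * c₁ - B * (u + L - N) * X * Y) β-inv
        (modulo₁ (- (X * Y * c₁)) α-inv
        (modulo₁ (X * Y * b) step
        (modulo₁ (A * X * Y * b) L′≡
        (modulo₁ (B * X * Y * b * G′) L≡
        (solve 18 (λ A B X Y a b C₁ C₂ u L L′ N s G G′ G₁ c₀ c₁ →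
          A :* (C₁ :+ (u :+ L′ :- N) :* (X :* (Y :* b))) :+ B :* (C₂ :+ (u :+ L :- N) :* (X :* Y))
            := X :* a :* Y :* (G₁ :* c₁)
               :+ κ 1 :* (A :* C₁ :+ B :* C₂ :- X :* (Y :* b) :* (G :* c₀))
               :+ (X :* Y :* c₁ :- B :* (u :+ L :- N) :* X :* Y) :* (G′ :* b :- κ 1)
               :+ :- (X :* Y :* c₁) :* (G₁ :* a :- κ 1)
               :+ X :* Y :* b :* (A :* (s :- κ 2 :* N) :+ B :* (s :- κ 1 :- κ 2 :* N) :* G′ :- (G′ :* c₁ :- G :* c₀))
               :+ A :* X :* Y :* b :* (L′ :- (s :- N :- u))
               :+ B :* X :* Y :* b :* G′ :* (L :- (s :- N :- u :- κ 1)))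
          A B X Y a b (conv t n (suc (suc l))) (conv t n (suc l)) u L (ι (suc l)) N s
          (quartic v N) G′ (quartic v (ι (suc n))) (certificate v s N) c₁))))))
        where
        X = prod n α
        Y = prod l β
        N = ι n
        L = ι l
        a = α n
        b = β l
        A = leading v s
        B = trailing v s
        G′ = quartic v (s - N)
        c₁ = certificate v s (ι (suc n))
        s≡′ : s ≡ ι 1 + N + L + u
        s≡′ = trans s≡ (cong (_+ u) (trans (cong ι (sym n+l≡r)) (trans (ι-+ (suc n) l) (cong (_+ L) (ι-suc n)))))
        L≡ : L ≡ s - N - u - ι 1
        L≡ = trans (solve 3 (λ N L u → L := κ 1 :+ N :+ L :+ u :- N :- u :- κ 1) N L u)
                   (cong (λ s → s - N - u - ι 1) (sym s≡′))
        L′≡ : ι (suc l) ≡ s - N - u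
        L′≡ = trans (ι-suc l) (trans (solve 3 (λ N L u → κ 1 :+ L := κ 1 :+ N :+ L :+ u :- N :- u) N L u)
                   (cong (λ s → s - N - u) (sym s≡′)))
        step : A * (s - ι 2 * N) + B * (s - ι 1 - ι 2 * N) * G′ ≡ G′ * c₁ - quartic v N * certificate v s N
        step = trans (certificate-step v s N)
          (cong (λ k → G′ * certificate v s k - quartic v N * certificate v s N) (sym (ι-suc n)))
        α-inv : quartic v (ι (suc n)) * a ≡ ι 1
        α-inv = α-inverse n (ℕP.≤-<-trans (ℕP.≤-trans (ℕP.m≤m+n n l) (ℕP.≤-reflexive (ℕP.suc-injective n+l≡r))) r<M)
        β-inv : G′ * b ≡ ι 1
        β-inv = subst (λ x → quartic v x * b ≡ ι 1)
          (trans (cong (_+ u) L′≡) (solve 3 (λ s N u → s :- N :- u :+ u := s :- N) s N u))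
          (β-inverse l (ℕP.≤-<-trans (ℕP.≤-trans (ℕP.m≤n+m l n) (ℕP.≤-reflexive (ℕP.suc-injective n+l≡r))) r<M))

      recurrence : v ≡ u * u * u → ∀ r → r < M → let s = ι (suc r) + u in
        leading v s * conv t (suc (suc r)) 0 + trailing v s * conv t (suc r) 0 ≡ ι 0
      recurrence refl r r<M =
        modulo₁ (ι 1) (telescope s r r<M refl (suc r) 0 (ℕP.+-identityʳ (suc r)))
        (modulo₁ (prod (suc r) α) (certificate-end u (ι (suc r)))
        (solve 8 (λ A B C₁ C₂ X E u n →
          A :* (C₁ :+ (u :+ κ 0 :- n) :* (X :* κ 1)) :+ B :* C₂
            := κ 0 :+ κ 1 :* (A :* C₁ :+ B :* C₂ :- X :* κ 1 :* E) :+ X :* (E :+ A :* (u :+ κ 0 :- n) :- κ 0))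
          (leading v s) (trailing v s) (conv t (suc r) 1) (conv t (suc r) 0) (prod (suc r) α)
          (quartic v (ι (suc r)) * certificate v s (ι (suc r))) u (ι (suc r))))
        where s = ι (suc r) + u

      W : ℕ → ℚ
      W r = conv t (suc r) 0 * prod r (λ i → quartic v (ι (suc i) + u))

      module _ (v≡u³ : v ≡ u * u * u) (ε : ℕ → ℚ)
        (δ-inverse : ∀ i → i < M → quadratic u (ι (suc i)) * inv (quadratic u (ι (suc i))) ≡ ι 1)
        (ε-inverse : ∀ i → i < M → (ι (suc i) + ι 2 * u) * ε i ≡ ι 1) where

        closed-form : ∀ r → r ℕ.≤ M → W r ≡ (- ι 1) ^ r * u * (upper u r * lower u r)
        closed-form zero _ = solve 1 (λ u → (κ 0 :+ (u :+ κ 0 :- κ 0) :* (κ 1 :* κ 1)) :* κ 1 := κ 1 :* u :* (κ 1 :* κ 1)) u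
        -- With s = n + u and v = u³, `E * D` is s³ + v. Its product with g(s) = s (s³ - v) is
        -- `s * leading v s`, so the recurrence applies without inverting its leading coefficient.
        closed-form (suc r) r<M = *-cancelˡ {i = e * d}
          (modulo₁ (E * e) D-inv (modulo₁ (ι 1) E-inv
            (solve 4 (λ D E d e → E :* D :* (e :* d) := κ 1 :+ E :* e :* (D :* d :- κ 1) :+ κ 1 :* (E :* e :- κ 1)) D E d e)))
          (modulo₁ (s * Π) (recurrence v≡u³ r r<M)
          (modulo₁ (- (s * B)) (closed-form r (ℕP.<⇒≤ r<M))
          (modulo₁ (D * σ * u * s * L * d) (upper-suc u r)
          (modulo₁ (σ * u * s * L * U * (ι 2 * n - ι 1 + ι 2 * u) * (ι 2 * n + ι 2 * u)) D-inv
          (modulo₁ (- (s * Π * S′ * (s * s * s - v))) v≡u³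
          (solve 11 (λ n u v S S′ Π U U′ L σ d →
            let s = n :+ u
                D = n :* n :+ n :* u :+ u :* u
                E = n :+ κ 2 :* u
                A = :leading v s
                B = :trailing v s
                F = (κ 2 :* n :- κ 1 :+ κ 2 :* u) :* (κ 2 :* n :+ κ 2 :* u)
            in E :* D :* (S′ :* (Π :* :quartic v s))
              := E :* D :* (:- κ 1 :* σ :* u :* (U′ :* (L :* (s :* d))))
                 :+ s :* Π :* (A :* S′ :+ B :* S :- κ 0)
                 :+ :- (s :* B) :* (S :* Π :- σ :* u :* (U :* L))
                 :+ D :* σ :* u :* s :* L :* d :* (E :* U′ :- U :* (κ 2 :* n :- κ 1 :+ κ 2 :* u) :* (κ 2 :* n :+ κ 2 :* u))
                 :+ σ :* u :* s :* L :* U :* (κ 2 :* n :- κ 1 :+ κ 2 :* u) :* (κ 2 :* n :+ κ 2 :* u) :* (D :* d :- κ 1)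
                 :+ :- (s :* Π :* S′ :* (s :* s :* s :- v)) :* (v :- u :* u :* u))
            n u v S S′ Π U (upper u (suc r)) L σ d))))))
          where
          n = ι (suc r)
          s = n + u
          e = ε r
          D = n * n + n * u + u * u
          d = inv D
          E = n + ι 2 * u
          D-inv = δ-inverse r r<M
          E-inv = ε-inverse r r<M
          Π = prod r (λ i → quartic v (ι (suc i) + u))
          U = upper u r
          L = lower u r
          σ = (- ι 1) ^ r
          S = conv t (suc r) 0
          S′ = conv t (suc (suc r)) 0
          B = trailing v s

  -- Finite products, factorials and harmonic numbers

  prod-+ : ∀ m n f → prod (m ℕ.+ n) f ≡ prod m f * prod n (λ i → f (m ℕ.+ i))
  prod-+ m zero    f rewrite ℕP.+-identityʳ m = sym (*-identityʳ (prod m f))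
  prod-+ m (suc n) f rewrite ℕP.+-suc m n =
    trans (cong (_* f (m ℕ.+ n)) (prod-+ m n f)) (*-assoc (prod m f) _ (f (m ℕ.+ n)))

  sum-+ : ∀ m n f → sum (m ℕ.+ n) f ≡ sum m f + sum n (λ i → f (m ℕ.+ i))
  sum-+ m zero    f rewrite ℕP.+-identityʳ m = sym (+-identityʳ (sum m f))
  sum-+ m (suc n) f rewrite ℕP.+-suc m n =
    trans (cong (_+ f (m ℕ.+ n)) (sum-+ m n f)) (solve 3 (λ x y z → x :+ y :+ z := x :+ (y :+ z)) _ _ _)

  prod-* : ∀ n f g → prod n (λ i → f i * g i) ≡ prod n f * prod n g
  prod-* zero    f g = sym (*-identityˡ (ι 1))
  prod-* (suc n) f g = trans (cong (_* (f n * g n)) (prod-* n f g))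
    (solve 4 (λ X Y x y → X :* Y :* (x :* y) := X :* x :* (Y :* y)) (prod n f) (prod n g) (f n) (g n))

  sum-cong : ∀ n {f g} → (∀ i → i < n → f i ≡ g i) → sum n f ≡ sum n g
  sum-cong zero    f≡g = refl
  sum-cong (suc n) f≡g = cong₂ _+_ (sum-cong n (λ i i<n → f≡g i (ℕP.m<n⇒m<1+n i<n))) (f≡g n ℕP.≤-refl)

  fact harmonic harmonic₂ : ℕ → ℚ
  fact      n = prod n (λ i → ι (suc i))
  harmonic  n = sum n (λ i → inv (ι (suc i)))
  harmonic₂ n = sum n (λ i → inv (ι (suc i)) * inv (ι (suc i)))

  ι-! : ∀ n → ι (n !) ≡ fact n
  ι-! zero    = refl
  ι-! (suc n) = trans (ι-* (suc n) (n !)) (trans (cong (ι (suc n) *_) (ι-! n)) (*-comm (ι (suc n)) (fact n)))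

  firstExpansion : (P t σ K D E F : ℚ) → ℚ
  firstExpansion P t σ K D E F =
    t * P * σ * K * (ι 1 + ι 2 * t * P * D + t * t * (P * P) * (ι 2 * D * D - ι 2 * E + F))

  secondExpansion : (P q t a σ S K Hₙ Hₘ : ℚ) → ℚ
  secondExpansion P q t a σ S K Hₙ Hₘ = let c = (ι 2 * t + ι 1) * inv (ι 2 * a + ι 1) in
    t * c * (P * P) * σ * S * inv K * (ι 1 + P * (c + (ι 2 * t - ι 1) * q - (ι 2 * t + ι 1) * inv (ι 2) * (Hₙ - Hₘ)))

  central-binomial : ∀ n → ι ((2 ℕ.* n) choose n) * (fact n * fact n) ≡ fact (2 ℕ.* n)
  central-binomial n = begin
    ι ((2 ℕ.* n) choose n) * (fact n * fact n)        ≡⟨ cong (λ x → ι ((2 ℕ.* n) choose n) * (x * x)) (sym (ι-! n)) ⟩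
    ι ((2 ℕ.* n) choose n) * (ι (n !) * ι (n !))      ≡⟨ cong (ι ((2 ℕ.* n) choose n) *_) (sym (ι-* (n !) (n !))) ⟩
    ι ((2 ℕ.* n) choose n) * ι (n ! ℕ.* n !)          ≡⟨ sym (ι-* ((2 ℕ.* n) choose n) (n ! ℕ.* n !)) ⟩
    ι (((2 ℕ.* n) choose n) ℕ.* (n ! ℕ.* n !))          ≡⟨ cong ι factorials ⟩
    ι ((2 ℕ.* n) !)                              ≡⟨ ι-! (2 ℕ.* n) ⟩
    fact (2 ℕ.* n)                               ∎
    where
    open ≡-Reasoning
    n≤2n : n ℕ.≤ 2 ℕ.* n
    n≤2n = ℕP.m≤m+n n (n ℕ.+ 0)
    n-n : 2 ℕ.* n ℕ.∸ n ≡ n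
    n-n = trans (ℕP.m+n∸m≡n n (n ℕ.+ 0)) (ℕP.+-identityʳ n)
    factorials : ((2 ℕ.* n) choose n) ℕ.* (n ! ℕ.* n !) ≡ (2 ℕ.* n) !
    factorials = begin
      ((2 ℕ.* n) choose n) ℕ.* (n ! ℕ.* n !)                    ≡⟨ cong (λ m → ((2 ℕ.* n) choose n) ℕ.* (n ! ℕ.* m !)) (sym n-n) ⟩
      ((2 ℕ.* n) choose n) ℕ.* (n ! ℕ.* (2 ℕ.* n ℕ.∸ n) !)      ≡⟨ cong (ℕ._* (n ! ℕ.* (2 ℕ.* n ℕ.∸ n) !)) (nCk≡n!/k![n-k]! n≤2n) ⟩
      ((2 ℕ.* n) ! ℕ./ (n ! ℕ.* (2 ℕ.* n ℕ.∸ n) !)) ℕ.* (n ! ℕ.* (2 ℕ.* n ℕ.∸ n) !)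
        ≡⟨ ℕD.m/n*n≡m (k![n∸k]!∣n! n≤2n) ⟩
      (2 ℕ.* n) !                                        ∎
      where instance _ = ℕP._!*_!≢0 n (2 ℕ.* n ℕ.∸ n)

  prod-scale : ∀ n c f → prod n (λ i → c * f i) ≡ c ^ n * prod n f
  prod-scale zero    c f = sym (*-identityˡ (ι 1))
  prod-scale (suc n) c f = trans (cong (_* (c * f n)) (prod-scale n c f))
    (solve 4 (λ C X c x → C :* X :* (c :* x) := c :* C :* (X :* x)) (c ^ n) (prod n f) c (f n))

  sum-front : ∀ n f → sum (suc n) f ≡ f 0 + sum n (λ i → f (suc i))
  sum-front zero    f = solve 1 (λ x → κ 0 :+ x := x :+ κ 0) (f 0)
  sum-front (suc n) f = trans (cong (_+ f (suc n)) (sum-front n f))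
    (solve 3 (λ x y z → x :+ y :+ z := x :+ (y :+ z)) _ _ _)

  sum-scale : ∀ n c f → sum n (λ i → c * f i) ≡ c * sum n f
  sum-scale zero    c f = sym (zeroʳ c)
  sum-scale (suc n) c f = trans (cong (_+ c * f n) (sum-scale n c f)) (solve 3 (λ c x y → c :* x :+ c :* y := c :* (x :+ y)) c (sum n f) (f n))

  ι-shift : ∀ y n → y + ι 1 + ι n ≡ y + ι (suc n)
  ι-shift y n = trans (solve 2 (λ y x → y :+ κ 1 :+ x := y :+ (κ 1 :+ x)) y (ι n)) (cong (y +_) (sym (ι-suc n)))

  ι-unshift : ∀ y n → y + ι 1 ≡ y + ι (suc n) - ι n
  ι-unshift y n = trans (solve 2 (λ y x → y :+ κ 1 := y :+ κ 1 :+ x :- x) y (ι n)) (cong (_- ι n) (ι-shift y n))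

  -- Indices are reversed inside the rational argument, which avoids truncated subtraction. The free
  -- base point `y` makes the induction go through: removing the front factor moves `y` by one.
  prod-reverse : ∀ (G : ℚ → ℚ) n y → prod n (λ i → G (y + ι (suc i))) ≡ prod n (λ i → G (y + ι (suc n) - ι (suc i)))
  prod-reverse G zero    y = refl
  prod-reverse G (suc n) y = begin
    prod (suc n) (λ i → G (y + ι (suc i)))                            ≡⟨ prod-front n (λ i → G (y + ι (suc i))) ⟩
    G (y + ι 1) * prod n (λ i → G (y + ι (suc (suc i))))
      ≡⟨ cong (G (y + ι 1) *_) (prod-cong n (λ i _ → cong G (sym (ι-shift y (suc i))))) ⟩
    G (y + ι 1) * prod n (λ i → G (y + ι 1 + ι (suc i)))              ≡⟨ cong (G (y + ι 1) *_) (prod-reverse G n (y + ι 1)) ⟩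
    G (y + ι 1) * prod n (λ i → G (y + ι 1 + ι (suc n) - ι (suc i)))
      ≡⟨ cong₂ _*_ (cong G (ι-unshift y (suc n))) (prod-cong n (λ i _ → cong (λ x → G (x - ι (suc i))) (ι-shift y (suc n)))) ⟩
    G (y + ι (suc (suc n)) - ι (suc n)) * prod n (λ i → G (y + ι (suc (suc n)) - ι (suc i))) ≡⟨ *-comm _ _ ⟩
    prod (suc n) (λ i → G (y + ι (suc (suc n)) - ι (suc i)))          ∎
    where open ≡-Reasoning

  sum-reverse : ∀ (G : ℚ → ℚ) n y → sum n (λ i → G (y + ι (suc i))) ≡ sum n (λ i → G (y + ι (suc n) - ι (suc i)))
  sum-reverse G zero    y = refl
  sum-reverse G (suc n) y = begin
    sum (suc n) (λ i → G (y + ι (suc i)))                             ≡⟨ sum-front n (λ i → G (y + ι (suc i))) ⟩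
    G (y + ι 1) + sum n (λ i → G (y + ι (suc (suc i))))
      ≡⟨ cong (G (y + ι 1) +_) (sum-cong n (λ i _ → cong G (sym (ι-shift y (suc i))))) ⟩
    G (y + ι 1) + sum n (λ i → G (y + ι 1 + ι (suc i)))               ≡⟨ cong (G (y + ι 1) +_) (sum-reverse G n (y + ι 1)) ⟩
    G (y + ι 1) + sum n (λ i → G (y + ι 1 + ι (suc n) - ι (suc i)))
      ≡⟨ cong₂ _+_ (cong G (ι-unshift y (suc n))) (sum-cong n (λ i _ → cong (λ x → G (x - ι (suc i))) (ι-shift y (suc n)))) ⟩
    G (y + ι (suc (suc n)) - ι (suc n)) + sum n (λ i → G (y + ι (suc (suc n)) - ι (suc i))) ≡⟨ solve 2 (λ x y → x :+ y := y :+ x) _ _ ⟩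
    sum (suc n) (λ i → G (y + ι (suc (suc n)) - ι (suc i)))           ∎
    where open ≡-Reasoning

  odd : ℕ → ℚ
  odd n = ι (suc (n ℕ.+ n))

  -- Even and odd denominators are separated because odd numbers below an odd p can be reflected to
  -- p minus an even number.
  harmonic-double : ∀ n → harmonic (n ℕ.+ n) ≡ inv (ι 2) * harmonic n + sum n (λ i → inv (odd i))
  harmonic-double zero = solve 1 (λ x → κ 0 := x :* κ 0 :+ κ 0) (inv (ι 2))
  harmonic-double (suc n) = begin
    harmonic (suc n ℕ.+ suc n)      ≡⟨ cong harmonic (ℕP.+-suc (suc n) n) ⟩
    harmonic (n ℕ.+ n) + inv (odd n) + inv (ι (suc (suc (n ℕ.+ n))))
      ≡⟨ cong₂ (λ x y → x + inv (odd n) + y) (harmonic-double n) even ⟩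
    inv (ι 2) * harmonic n + sum n (λ i → inv (odd i)) + inv (odd n) + inv (ι 2) * inv (ι (suc n))
      ≡⟨ solve 5 (λ h H S o i → h :* H :+ S :+ o :+ h :* i := h :* (H :+ i) :+ (S :+ o)) (inv (ι 2)) (harmonic n) (sum n (λ i → inv (odd i))) (inv (odd n)) (inv (ι (suc n))) ⟩
    inv (ι 2) * harmonic (suc n) + sum (suc n) (λ i → inv (odd i)) ∎
    where
    open ≡-Reasoning
    even : inv (ι (suc (suc (n ℕ.+ n)))) ≡ inv (ι 2) * inv (ι (suc n))
    even = inv-unique (begin
      ι (suc (suc (n ℕ.+ n))) * (inv (ι 2) * inv (ι (suc n)))  ≡⟨ cong (λ k → ι (suc k) * (inv (ι 2) * inv (ι (suc n)))) (sym (ℕP.+-suc n n)) ⟩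
      ι (suc n ℕ.+ suc n) * (inv (ι 2) * inv (ι (suc n)))      ≡⟨ cong (_* (inv (ι 2) * inv (ι (suc n)))) (ι-+ (suc n) (suc n)) ⟩
      (ι (suc n) + ι (suc n)) * (inv (ι 2) * inv (ι (suc n)))
        ≡⟨ modulo₂ (ι (suc n) * inv (ι (suc n))) (ι 1) (*-inv (ι-suc≢0 1)) (*-inv (ι-suc≢0 n))
             (solve 3 (λ x h i → (x :+ x) :* (h :* i) := κ 1 :+ x :* i :* (κ 2 :* h :- κ 1) :+ κ 1 :* (x :* i :- κ 1)) (ι (suc n)) (inv (ι 2)) (inv (ι (suc n)))) ⟩
      ι 1 ∎)

  fact-double : ∀ n → fact (n ℕ.+ n) ≡ ι 2 ^ n * fact n * prod n odd
  fact-double zero = solve 0 (κ 1 := κ 1 :* κ 1 :* κ 1)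
  fact-double (suc n) = begin
    fact (suc n ℕ.+ suc n)  ≡⟨ cong fact (ℕP.+-suc (suc n) n) ⟩
    fact (n ℕ.+ n) * odd n * ι (suc (suc (n ℕ.+ n)))
      ≡⟨ cong₂ (λ x y → x * odd n * y) (fact-double n) (trans (cong (λ k → ι (suc k)) (sym (ℕP.+-suc n n))) (ι-+ (suc n) (suc n))) ⟩
    ι 2 ^ n * fact n * prod n odd * odd n * (ι (suc n) + ι (suc n))
      ≡⟨ solve 5 (λ T F O o s → T :* F :* O :* o :* (s :+ s) := κ 2 :* T :* (F :* s) :* (O :* o)) (ι 2 ^ n) (fact n) (prod n odd) (odd n) (ι (suc n)) ⟩
    ι 2 ^ suc n * fact (suc n) * prod (suc n) odd ∎
    where open ≡-Reasoning

  fact-+ : ∀ j l → fact (j ℕ.+ l) ≡ fact j * prod l (λ i → ι j + ι (suc i))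
  fact-+ j l = trans (prod-+ j l (λ i → ι (suc i)))
    (cong (fact j *_) (prod-cong l (λ i _ → trans (cong ι (sym (ℕP.+-suc j i))) (ι-+ j (suc i)))))

  ι-^ : ∀ x l → ι (x ℕ.^ l) ≡ ι x ^ l
  ι-^ x zero    = refl
  ι-^ x (suc l) = trans (ι-* x (x ℕ.^ l)) (cong (ι x *_) (ι-^ x l))

  ^-+ : ∀ x j l → x ^ (j ℕ.+ l) ≡ x ^ j * x ^ l
  ^-+ x zero    l = sym (*-identityˡ (x ^ l))
  ^-+ x (suc j) l = trans (cong (x *_) (^-+ x j l)) (sym (*-assoc x (x ^ j) (x ^ l)))

  -- Symmetries of convolutions

  conv-cong : ∀ n l {f g} → (∀ k m → suc (k ℕ.+ m) ≡ n ℕ.+ l → f k m ≡ g k m) → conv f n l ≡ conv g n l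
  conv-cong zero    l f≡g = refl
  conv-cong (suc n) l f≡g = cong₂ _+_
    (conv-cong n (suc l) (λ k m k+m≡ → f≡g k m (trans k+m≡ (ℕP.+-suc n l)))) (f≡g n l refl)

  conv-front : ∀ f n l → conv f (suc n) l ≡ f 0 (n ℕ.+ l) + conv (λ k → f (suc k)) n l
  conv-front f zero    l = solve 1 (λ x → κ 0 :+ x := x :+ κ 0) (f 0 l)
  conv-front f (suc n) l = begin
    conv f (suc n) (suc l) + f (suc n) l                                ≡⟨ cong (_+ f (suc n) l) (conv-front f n (suc l)) ⟩
    f 0 (n ℕ.+ suc l) + conv (λ k → f (suc k)) n (suc l) + f (suc n) l
      ≡⟨ cong (λ m → f 0 m + conv (λ k → f (suc k)) n (suc l) + f (suc n) l) (ℕP.+-suc n l) ⟩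
    f 0 (suc n ℕ.+ l) + conv (λ k → f (suc k)) n (suc l) + f (suc n) l  ≡⟨ solve 3 (λ x y z → x :+ y :+ z := x :+ (y :+ z)) _ _ _ ⟩
    f 0 (suc n ℕ.+ l) + conv (λ k → f (suc k)) (suc n) l                ∎
    where open ≡-Reasoning

  conv-shift : ∀ f n l → conv f n (suc l) ≡ conv (λ k m → f k (suc m)) n l
  conv-shift f zero    l = refl
  conv-shift f (suc n) l = cong (_+ f n (suc l)) (conv-shift f n (suc l))

  -- By definition `conv` sheds its term with largest k. For the flipped function this is the term
  -- at the front, which `conv-front` removes; `conv-shift` then absorbs the offset left in the
  -- other index.
  conv-flip : ∀ f n → conv (λ k m → f m k) (suc n) 0 ≡ conv f (suc n) 0
  conv-flip f zero    = refl
  conv-flip f (suc n) = begin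
    conv (λ k m → f m k) (suc (suc n)) 0                              ≡⟨ conv-front (λ k m → f m k) (suc n) 0 ⟩
    f (suc n ℕ.+ 0) 0 + conv (λ k m → f m (suc k)) (suc n) 0          ≡⟨ cong₂ (λ m x → f m 0 + x) (ℕP.+-identityʳ (suc n)) (conv-flip (λ k m → f k (suc m)) n) ⟩
    f (suc n) 0 + conv (λ k m → f k (suc m)) (suc n) 0                ≡⟨ cong (λ x → f (suc n) 0 + x) (sym (conv-shift f (suc n) 0)) ⟩
    f (suc n) 0 + conv f (suc n) 1                                    ≡⟨ solve 2 (λ x y → x :+ y := y :+ x) _ _ ⟩
    conv f (suc (suc n)) 0                                            ∎
    where open ≡-Reasoning

  conv-*ʳ : ∀ f c n l → conv (λ k m → f k m * c) n l ≡ conv f n l * c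
  conv-*ʳ f c zero    l = sym (zeroˡ c)
  conv-*ʳ f c (suc n) l = trans (cong (_+ f n l * c) (conv-*ʳ f c n (suc l)))
    (solve 3 (λ x y c → x :* c :+ y :* c := (x :+ y) :* c) _ _ c)

  conv-antisym : ∀ f → (∀ k m → f m k ≡ f k m * (- ι 1)) → ∀ n → conv f (suc n) 0 ≡ ι 0
  conv-antisym f antisym n = *-cancelˡ (*-inv (ι-suc≢0 1)) (modulo₁ (- ι 1) S≡-S
    (solve 1 (λ S → κ 2 :* S := κ 2 :* κ 0 :+ :- κ 1 :* (S :* (:- κ 1) :- S)) (conv f (suc n) 0)))
    where
    S≡-S : conv f (suc n) 0 * (- ι 1) ≡ conv f (suc n) 0
    S≡-S = trans (sym (conv-*ʳ f (- ι 1) (suc n) 0))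
      (trans (conv-cong (suc n) 0 (λ k m _ → sym (antisym k m))) (conv-flip f n))

  sum≡conv : ∀ {F f r} → (∀ k l → k ℕ.+ l ≡ r → F k ≡ f k l) → ∀ n l → n ℕ.+ l ≡ suc r → sum n F ≡ conv f n l
  sum≡conv F≡f zero    l _     = refl
  sum≡conv F≡f (suc n) l n+l≡ = cong₂ _+_
    (sum≡conv F≡f n (suc l) (trans (ℕP.+-suc n l) n+l≡)) (F≡f n l (ℕP.suc-injective n+l≡))

  -- The truncated binomial sum as a convolution

  binomial : ℚ → ℕ → ℚ
  binomial a zero    = ι 1
  binomial a (suc k) = binomial a k * (a - ι k) * inv (ι (suc k))

  recipQuartic : ℚ → ℚ → ℕ → ℚ
  recipQuartic v u i = inv (quartic v (ι (suc i) + u))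

  S : ℚ → ℚ → ℕ → ℚ
  S u v r = conv (term u (λ i → inv (quartic v (ι (suc i)))) (recipQuartic v u)) (suc r) 0

  S-vanishes : ∀ v r → S (ι 0) v r ≡ ι 0
  S-vanishes v = conv-antisym _ antisym
    where
    α = λ i → inv (quartic v (ι (suc i)))
    β≡α : ∀ l → prod l (recipQuartic v (ι 0)) ≡ prod l α
    β≡α l = prod-cong l (λ i _ → cong (λ x → inv (quartic v x)) (+-identityʳ (ι (suc i))))
    antisym : ∀ k m → term (ι 0) α (recipQuartic v (ι 0)) m k ≡ term (ι 0) α (recipQuartic v (ι 0)) k m * (- ι 1)
    antisym k m rewrite β≡α k | β≡α m =
      solve 4 (λ k m X Y → (κ 0 :+ k :- m) :* (Y :* X) := (κ 0 :+ m :- k) :* (X :* Y) :* (:- κ 1)) (ι k) (ι m) (prod k α) (prod m α)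

  prod-^4 : ∀ n f → prod n (λ i → f i ^ 4) ≡ prod n f ^ 4
  prod-^4 zero    f = solve 0 (κ 1 := pow4 (κ 1))
    where
    pow4 : Polynomial 0 → Polynomial 0
    pow4 x = x :* (x :* (x :* (x :* κ 1)))
  prod-^4 (suc n) f = trans (cong (_* f n ^ 4) (prod-^4 n f)) (solve 2 (λ x y → pow4 x :* pow4 y := pow4 (x :* y)) _ _)
    where
    pow4 : Polynomial 2 → Polynomial 2
    pow4 x = x :* (x :* (x :* (x :* κ 1)))

  prod-inverse : ∀ n (f : ℕ → ℚ) → (∀ i → i < n → f i * inv (f i) ≡ ι 1) → prod n f * prod n (λ i → inv (f i)) ≡ ι 1
  prod-inverse zero    f inverse = *-identityˡ (ι 1)
  prod-inverse (suc n) f inverse =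
    modulo₂ (ι 1) (f n * inv (f n)) (inverse n ℕP.≤-refl) (prod-inverse n f (λ i i<n → inverse i (ℕP.m<n⇒m<1+n i<n)))
      (solve 4 (λ X Y x y → X :* x :* (Y :* y) := κ 1 :+ κ 1 :* (x :* y :- κ 1) :+ x :* y :* (X :* Y :- κ 1))
        (prod n f) (prod n (λ i → inv (f i))) (f n) (inv (f n)))

  module _ (u : ℚ) (r : ℕ)
    (ι-inverse : ∀ i → i < r → ι (suc i) * inv (ι (suc i)) ≡ ι 1)
    (shift-inverse : ∀ i → i < r → (ι (suc i) + u) * inv (ι (suc i) + u) ≡ ι 1) where

    private
      a = ι r + u
      α β : ℕ → ℚ
      α i = inv (ι (suc i))
      β i = inv (ι (suc i) + u)
      G = prod r (λ i → ι (suc i) + u)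

    -- The numerator (r+u)(r+u-1)⋯(l+1+u) is `G` without its l lowest factors. In this form k and l
    -- play the same part up to the shift by u.
    binomial-factors : ∀ k l → k ℕ.+ l ≡ r → binomial a k ≡ G * (prod k α * prod l β)
    binomial-factors zero l refl =
      sym (trans (cong (G *_) (*-identityˡ (prod l β))) (prod-inverse l (λ i → ι (suc i) + u) shift-inverse))
    binomial-factors (suc k) l k+l≡r = modulo₁ ((a - ι k) * α k) (binomial-factors k (suc l) (trans (ℕP.+-suc k l) k+l≡r))
      (modulo₁ (G * prod k α * prod l β * α k) (shift-inverse l l<r)
      (modulo₁ (G * prod k α * prod l β * α k * β l) a-k
      (solve 9 (λ b a k A G X Y B x →
        b :* (a :- k) :* A := G :* (X :* A :* Y)
          :+ (a :- k) :* A :* (b :- G :* (X :* (Y :* B)))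
          :+ G :* X :* Y :* A :* (x :* B :- κ 1)
          :+ G :* X :* Y :* A :* B :* (a :- k :- x))
        (binomial a k) a (ι k) (α k) G (prod k α) (prod l β) (β l) (ι (suc l) + u))))
      where
      l<r : l < r
      l<r = subst (l <_) k+l≡r (ℕ.s≤s (ℕP.m≤n+m l k))
      a-k : a - ι k ≡ ι (suc l) + u
      a-k = begin
        ι r + u - ι k                 ≡⟨ cong (λ m → ι m + u - ι k) (trans (sym k+l≡r) (sym (ℕP.+-suc k l))) ⟩
        ι (k ℕ.+ suc l) + u - ι k     ≡⟨ cong (λ x → x + u - ι k) (ι-+ k (suc l)) ⟩
        ι k + ι (suc l) + u - ι k     ≡⟨ solve 3 (λ k l u → k :+ l :+ u :- k := l :+ u) (ι k) (ι (suc l)) u ⟩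
        ι (suc l) + u                 ∎
        where open ≡-Reasoning

    -- Fourth powers of the symmetric form share the factor G⁴, which is the product of all g(i+u)
    -- at v = 0; the weight a - 2k becomes u + l - k since a = k + l + u.
    truncated : sum (suc r) (λ k → (a - ι (2 ℕ.* k)) * binomial a k ^ 4)
      ≡ S u (ι 0) r * prod r (λ i → quartic (ι 0) (ι (suc i) + u))
    truncated = begin
      sum (suc r) (λ k → (a - ι (2 ℕ.* k)) * binomial a k ^ 4)  ≡⟨ sum≡conv summand (suc r) 0 (ℕP.+-identityʳ (suc r)) ⟩
      conv (λ k l → (u + ι l - ι k) * (prod k α * prod l β) ^ 4 * Γ) (suc r) 0
        ≡⟨ conv-*ʳ (λ k l → (u + ι l - ι k) * (prod k α * prod l β) ^ 4) Γ (suc r) 0 ⟩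
      conv (λ k l → (u + ι l - ι k) * (prod k α * prod l β) ^ 4) (suc r) 0 * Γ
        ≡⟨ cong (_* Γ) (conv-cong (suc r) 0 quartic-inverses) ⟩
      S u (ι 0) r * Γ ∎
      where
      open ≡-Reasoning
      Γ = prod r (λ i → quartic (ι 0) (ι (suc i) + u))
      Γ≡G^4 : Γ ≡ G ^ 4
      Γ≡G^4 = trans (prod-cong r (λ i _ → solve 1 (λ x → x :* (x :* x :* x :- κ 0) := x :* (x :* (x :* (x :* κ 1)))) (ι (suc i) + u)))
        (prod-^4 r (λ i → ι (suc i) + u))
      summand : ∀ k l → k ℕ.+ l ≡ r → (a - ι (2 ℕ.* k)) * binomial a k ^ 4 ≡ (u + ι l - ι k) * (prod k α * prod l β) ^ 4 * Γ
      summand k l k+l≡r = begin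
        (a - ι (2 ℕ.* k)) * binomial a k ^ 4
          ≡⟨ cong₂ (λ x y → (x + u - y) * binomial a k ^ 4) (trans (cong ι (sym k+l≡r)) (ι-+ k l)) (ι-* 2 k) ⟩
        (ι k + ι l + u - ι 2 * ι k) * binomial a k ^ 4
          ≡⟨ cong (λ x → (ι k + ι l + u - ι 2 * ι k) * x ^ 4) (binomial-factors k l k+l≡r) ⟩
        (ι k + ι l + u - ι 2 * ι k) * (G * (prod k α * prod l β)) ^ 4
          ≡⟨ solve 5 (λ k l u G X → let pow4 = λ x → x :* (x :* (x :* (x :* κ 1))) in
               (k :+ l :+ u :- κ 2 :* k) :* pow4 (G :* X) := (u :+ l :- k) :* pow4 X :* pow4 G)
               (ι k) (ι l) u G (prod k α * prod l β) ⟩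
        (u + ι l - ι k) * (prod k α * prod l β) ^ 4 * G ^ 4
          ≡⟨ cong ((u + ι l - ι k) * (prod k α * prod l β) ^ 4 *_) (sym Γ≡G^4) ⟩
        (u + ι l - ι k) * (prod k α * prod l β) ^ 4 * Γ ∎
      inv-quartic : ∀ {x} → x * inv x ≡ ι 1 → inv (quartic (ι 0) x) ≡ inv x ^ 4
      inv-quartic {x} xi≡1 = inv-unique (modulo₁ (x * x * x * i * i * i + x * x * i * i + x * i + ι 1) xi≡1
        (solve 2 (λ x i → x :* (x :* x :* x :- κ 0) :* (i :* (i :* (i :* (i :* κ 1))))
          := κ 1 :+ (x :* x :* x :* i :* i :* i :+ x :* x :* i :* i :+ x :* i :+ κ 1) :* (x :* i :- κ 1)) x i))
        where i = inv x
      quartic-inverses : ∀ k l → suc (k ℕ.+ l) ≡ suc r ℕ.+ 0 →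
        (u + ι l - ι k) * (prod k α * prod l β) ^ 4 ≡ term u (λ i → inv (quartic (ι 0) (ι (suc i)))) (recipQuartic (ι 0) u) k l
      quartic-inverses k l k+l≡ = cong ((u + ι l - ι k) *_) (begin
        (prod k α * prod l β) ^ 4
          ≡⟨ solve 2 (λ X Y → let pow4 = λ x → x :* (x :* (x :* (x :* κ 1))) in pow4 (X :* Y) := pow4 X :* pow4 Y) (prod k α) (prod l β) ⟩
        prod k α ^ 4 * prod l β ^ 4  ≡⟨ cong₂ _*_ (sym (prod-^4 k α)) (sym (prod-^4 l β)) ⟩
        prod k (λ i → α i ^ 4) * prod l (λ i → β i ^ 4)
          ≡⟨ cong₂ _*_ (prod-cong k (λ i i<k → sym (inv-quartic (ι-inverse i (ℕP.<-≤-trans i<k k≤r)))))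
                       (prod-cong l (λ i i<l → sym (inv-quartic (shift-inverse i (ℕP.<-≤-trans i<l l≤r))))) ⟩
        prod k (λ i → inv (quartic (ι 0) (ι (suc i)))) * prod l (recipQuartic (ι 0) u) ∎)
        where
        k+l≡r : k ℕ.+ l ≡ r
        k+l≡r = ℕP.suc-injective (trans k+l≡ (ℕP.+-identityʳ (suc r)))
        k≤r : k ℕ.≤ r
        k≤r = ℕP.m+n≤o⇒m≤o k (ℕP.≤-reflexive k+l≡r)
        l≤r : l ℕ.≤ r
        l≤r = ℕP.m+n≤o⇒n≤o k (ℕP.≤-reflexive k+l≡r)

  -- Arithmetic of p-integral rationals

  module AtPrime (p : ℕ) (p-prime : Prime p) where

    P : ℚ
    P = ι p

    -- Wrapped in a record so that `Z x` determines `x` for unification; the bare negation mentions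
    -- only the denominator of `x`.
    record Z (x : ℚ) : Set where
      constructor mkZ
      field p∤↧ : ¬ p ∣ ↧ₙ x

    open Z

    p∤1 : ¬ p ∣ 1
    p∤1 = >⇒∤ (ℕ.nonTrivial⇒n>1 p {{prime⇒nonTrivial p-prime}})

    p∤* : ∀ {m n} → ¬ p ∣ m → ¬ p ∣ n → ¬ p ∣ m ℕ.* n
    p∤* {m} {n} p∤m p∤n p∣mn = [ p∤m , p∤n ] (euclidsLemma m n p-prime p∣mn)

    -- Any denominator prime to p suffices: cross-multiplication and coprimality of the reduced
    -- fraction show that the reduced denominator divides `d`.
    Z-intro : ∀ {x} d n → ¬ p ∣ d → x * ι d ≡ ⟪ n ⟫ → Z x
    Z-intro {x@(mkℚ _ _ coprime)} d n p∤d xd≡n = mkZ λ p∣↧x → p∤d (∣-trans p∣↧x ↧x∣d)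
      where
      open ≡-Reasoning
      rearrange : ∀ x y z → x * y * z ≡ x * z * y
      rearrange = solve 3 λ x y z → x :* y :* z := x :* z :* y
      cross : n ℤ.* ↧ x ≡ ↥ x ℤ.* ℤ.+ d
      cross = ⟪⟫-injective (begin
        ⟪ n ℤ.* ↧ x ⟫             ≡⟨ ⟪⟫-* n (↧ x) ⟩
        ⟪ n ⟫ * ι (↧ₙ x)        ≡⟨ cong (_* ι (↧ₙ x)) (sym xd≡n) ⟩
        x * ι d * ι (↧ₙ x)     ≡⟨ rearrange x (ι d) (ι (↧ₙ x)) ⟩
        x * ι (↧ₙ x) * ι d     ≡⟨ cong (_* ι d) (*-denominator x) ⟩
        ⟪ ↥ x ⟫ * ι d           ≡⟨ sym (⟪⟫-* (↥ x) (ℤ.+ d)) ⟩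
        ⟪ ↥ x ℤ.* ℤ.+ d ⟫           ∎)
      ↧x∣d : ↧ₙ x ∣ d
      ↧x∣d = Coprimality.coprime-divisor (Coprimality.sym (Coprimality.recompute coprime))
        (divides ℤ.∣ n ∣ (begin
          ℤ.∣ ↥ x ∣ ℕ.* d      ≡⟨ sym (ℤP.abs-* (↥ x) (ℤ.+ d)) ⟩
          ℤ.∣ ↥ x ℤ.* ℤ.+ d ∣    ≡⟨ cong ℤ.∣_∣ (sym cross) ⟩
          ℤ.∣ n ℤ.* ↧ x ∣      ≡⟨ ℤP.abs-* n (↧ x) ⟩
          ℤ.∣ n ∣ ℕ.* ↧ₙ x     ∎))

    Z-⟪⟫ : ∀ i → Z ⟪ i ⟫
    Z-⟪⟫ i = Z-intro 1 i p∤1 (*-identityʳ ⟪ i ⟫)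

    Z-ℕ : ∀ n → Z (ι n)
    Z-ℕ n = Z-⟪⟫ (ℤ.+ n)

    Z-+ : ∀ {x y} → Z x → Z y → Z (x + y)
    Z-+ {x} {y} zx zy = Z-intro (↧ₙ x ℕ.* ↧ₙ y) (↥ x ℤ.* ↧ y ℤ.+ ↥ y ℤ.* ↧ x) (p∤* (p∤↧ zx) (p∤↧ zy)) (begin
      (x + y) * ι (↧ₙ x ℕ.* ↧ₙ y)         ≡⟨ cong ((x + y) *_) (ι-* (↧ₙ x) (↧ₙ y)) ⟩
      (x + y) * (ι (↧ₙ x) * ι (↧ₙ y))   ≡⟨ rearrange x y (ι (↧ₙ x)) (ι (↧ₙ y)) ⟩
      x * ι (↧ₙ x) * ι (↧ₙ y) + y * ι (↧ₙ y) * ι (↧ₙ x)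
        ≡⟨ cong₂ (λ a b → a * ι (↧ₙ y) + b * ι (↧ₙ x)) (*-denominator x) (*-denominator y) ⟩
      ⟪ ↥ x ⟫ * ⟪ ↧ y ⟫ + ⟪ ↥ y ⟫ * ⟪ ↧ x ⟫
        ≡⟨ cong₂ _+_ (sym (⟪⟫-* (↥ x) (↧ y))) (sym (⟪⟫-* (↥ y) (↧ x))) ⟩
      ⟪ ↥ x ℤ.* ↧ y ⟫ + ⟪ ↥ y ℤ.* ↧ x ⟫ ≡⟨ sym (⟪⟫-+ (↥ x ℤ.* ↧ y) (↥ y ℤ.* ↧ x)) ⟩
      ⟪ ↥ x ℤ.* ↧ y ℤ.+ ↥ y ℤ.* ↧ x ⟫    ∎)
      where
      open ≡-Reasoning
      rearrange : ∀ x y d e → (x + y) * (d * e) ≡ x * d * e + y * e * d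
      rearrange = solve 4 λ x y d e → (x :+ y) :* (d :* e) := x :* d :* e :+ y :* e :* d

    Z-* : ∀ {x y} → Z x → Z y → Z (x * y)
    Z-* {x} {y} zx zy = Z-intro (↧ₙ x ℕ.* ↧ₙ y) (↥ x ℤ.* ↥ y) (p∤* (p∤↧ zx) (p∤↧ zy)) (begin
      x * y * ι (↧ₙ x ℕ.* ↧ₙ y)           ≡⟨ cong (x * y *_) (ι-* (↧ₙ x) (↧ₙ y)) ⟩
      x * y * (ι (↧ₙ x) * ι (↧ₙ y))     ≡⟨ rearrange x y (ι (↧ₙ x)) (ι (↧ₙ y)) ⟩
      x * ι (↧ₙ x) * (y * ι (↧ₙ y))     ≡⟨ cong₂ _*_ (*-denominator x) (*-denominator y) ⟩
      ⟪ ↥ x ⟫ * ⟪ ↥ y ⟫                   ≡⟨ sym (⟪⟫-* (↥ x) (↥ y)) ⟩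
      ⟪ ↥ x ℤ.* ↥ y ⟫                      ∎)
      where
      open ≡-Reasoning
      rearrange : ∀ x y d e → x * y * (d * e) ≡ x * d * (y * e)
      rearrange = solve 4 λ x y d e → x :* y :* (d :* e) := x :* d :* (y :* e)

    Z-neg : ∀ {x} → Z x → Z (- x)
    Z-neg {x} zx = subst Z (negate x) (Z-* (Z-⟪⟫ (ℤ.- (ℤ.+ 1))) zx)
      where
      negate : ∀ x → ⟪ ℤ.- (ℤ.+ 1) ⟫ * x ≡ - x
      negate = solve 1 λ x → con (ℤ.- (ℤ.+ 1)) :* x := :- x

    Z-polynomial : ∀ {n} (e : Polynomial n) {ρ : Vec ℚ n} → All Z ρ → Z (⟦ e ⟧ ρ)
    Z-polynomial (op [+] e f) zs = Z-+ (Z-polynomial e zs) (Z-polynomial f zs)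
    Z-polynomial (op [*] e f) zs = Z-* (Z-polynomial e zs) (Z-polynomial f zs)
    Z-polynomial (con c)      zs = Z-⟪⟫ c
    Z-polynomial (var x)      zs = lookup⁺ zs x
    Z-polynomial (:- e)       zs = Z-neg (Z-polynomial e zs)
    Z-polynomial (e :^ zero)  zs = Z-⟪⟫ (ℤ.+ 1)
    Z-polynomial (e :^ suc n) zs = Z-* (Z-polynomial e zs) (Z-polynomial (e :^ n) zs)

    Z-solve : ∀ {n} {ρ : Vec ℚ n} → All Z ρ → (f : N-ary n (Polynomial n) (Polynomial n)) → Z (⟦ close n f ⟧ ρ)
    Z-solve zs f = Z-polynomial (close _ f) zs

    infix 4 _≈_[_]
    -- The modulus is an arbitrary rational, so one set of rules serves all powers of p, and a
    -- common factor can move between the two sides and the modulus.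
    record _≈_[_] (x y m : ℚ) : Set where
      constructor mk≈
      field
        {quotient} : ℚ
        Z-quotient : Z quotient
        difference : x - y ≡ m * quotient

    -- The caller supplies the quotient `q` as a polynomial: the identity is then checked by
    -- normalisation, and integrality of `q` follows from that of the variables.
    ≈-solve : ∀ {n} {ρ : Vec ℚ n} → All Z ρ →
      (f : N-ary n (Polynomial n) ((Polynomial n × Polynomial n) × (Polynomial n × Polynomial n))) →
      let ((e₁ , e₂) , (m , q)) = close n f in
      {IsTrue (is-just (normalise (e₁ :- e₂) ≟N normalise (m :* q)))} →
      ⟦ e₁ ⟧ ρ ≈ ⟦ e₂ ⟧ ρ [ ⟦ m ⟧ ρ ]
    ≈-solve {n} {ρ} zs f {same} = let ((e₁ , e₂) , (m , q)) = close n f in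
      mk≈ (Z-polynomial q zs) (prove ρ (e₁ :- e₂) (m :* q) same)

    -- Units and congruences in ℤₚ

    record Unit (x : ℚ) : Set where
      constructor mkUnit
      field
        {den}    : ℕ
        {num}    : ℤ
        p∤den    : ¬ p ∣ den
        p∤num    : ¬ p ∣ ℤ.∣ num ∣
        fraction : x * ι den ≡ ⟪ num ⟫

    Unit⇒Z : ∀ {x} → Unit x → Z x
    Unit⇒Z (mkUnit {d} {n} p∤d _ eq) = Z-intro d n p∤d eq

    Unit⇒≢0 : ∀ {x} → Unit x → x ≢ ι 0
    Unit⇒≢0 (mkUnit {d} {n} p∤d p∤n eq) refl
      with refl ← ⟪⟫-injective {ℤ.+ 0} {n} (trans (sym (zeroˡ (ι d))) eq) = p∤n (p ∣0)

    Unit-inverse : ∀ {x} → Unit x → x * inv x ≡ ι 1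
    Unit-inverse ux = *-inv (Unit⇒≢0 ux)

    Unit-ι : ∀ {n} → ¬ p ∣ n → Unit (ι n)
    Unit-ι {n} p∤n = mkUnit {den = 1} {num = ℤ.+ n} p∤1 p∤n (*-identityʳ (ι n))

    Unit-* : ∀ {x y} → Unit x → Unit y → Unit (x * y)
    Unit-* {x} {y} (mkUnit {d} {n} p∤d p∤n eq) (mkUnit {e} {m} p∤e p∤m eq′) =
      mkUnit {num = n ℤ.* m} (p∤* p∤d p∤e) (λ p∣ → p∤* p∤n p∤m (subst (p ∣_) (ℤP.abs-* n m) p∣)) (begin
        x * y * ι (d ℕ.* e)      ≡⟨ cong (x * y *_) (ι-* d e) ⟩
        x * y * (ι d * ι e)      ≡⟨ rearrange x y (ι d) (ι e) ⟩
        x * ι d * (y * ι e)      ≡⟨ cong₂ _*_ eq eq′ ⟩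
        ⟪ n ⟫ * ⟪ m ⟫            ≡⟨ sym (⟪⟫-* n m) ⟩
        ⟪ n ℤ.* m ⟫              ∎)
      where
      open ≡-Reasoning
      rearrange : ∀ x y d e → x * y * (d * e) ≡ x * d * (y * e)
      rearrange = solve 4 λ x y d e → x :* y :* (d :* e) := x :* d :* (y :* e)

    -- The inverse of n/d is written as nd/n², since the denominator must be a natural number while
    -- n may be negative.
    Unit-inv : ∀ {x} → Unit x → Unit (inv x)
    Unit-inv {x} ux@(mkUnit {d} {n} p∤d p∤n eq) =
      mkUnit {num = n ℤ.* ℤ.+ d} (p∤* p∤n p∤n) (λ p∣ → p∤* p∤n p∤d (subst (p ∣_) (ℤP.abs-* n (ℤ.+ d)) p∣)) (begin
        inv x * ι (ℤ.∣ n ∣ ℕ.* ℤ.∣ n ∣)  ≡⟨ cong (inv x *_) (trans (cong ⟪_⟫ (square n)) (⟪⟫-* n n)) ⟩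
        inv x * (⟪ n ⟫ * ⟪ n ⟫)          ≡⟨ cong (λ y → inv x * (y * ⟪ n ⟫)) (sym eq) ⟩
        inv x * (x * ι d * ⟪ n ⟫)        ≡⟨ rearrange x (inv x) (ι d) ⟪ n ⟫ ⟩
        x * inv x * (⟪ n ⟫ * ι d)        ≡⟨ cong (_* (⟪ n ⟫ * ι d)) (Unit-inverse ux) ⟩
        ι 1 * (⟪ n ⟫ * ι d)              ≡⟨ *-identityˡ _ ⟩
        ⟪ n ⟫ * ι d                      ≡⟨ sym (⟪⟫-* n (ℤ.+ d)) ⟩
        ⟪ n ℤ.* ℤ.+ d ⟫                    ∎)
      where
      open ≡-Reasoning
      square : ∀ n → ℤ.+ (ℤ.∣ n ∣ ℕ.* ℤ.∣ n ∣) ≡ n ℤ.* n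
      square (ℤ.+ n)    = ℤP.pos-* n n
      square -[1+ n ] = refl
      rearrange : ∀ x y d n → y * (x * d * n) ≡ x * y * (n * d)
      rearrange = solve 4 λ x y d n → y :* (x :* d :* n) := x :* y :* (n :* d)

    Z-inv : ∀ {x} → Unit x → Z (inv x)
    Z-inv ux = Unit⇒Z (Unit-inv ux)

    Unit-shift : ∀ {x z} → Unit x → Z z → Unit (x + P * z)
    Unit-shift {x} {z} (mkUnit {d} {n} p∤d p∤n eq) (mkZ p∤e) =
      mkUnit {num = n ℤ.* ↧ z ℤ.+ ℤ.+ p ℤ.* (↥ z ℤ.* ℤ.+ d)} (p∤* p∤d p∤e) p∤num (begin
        (x + P * z) * ι (d ℕ.* ↧ₙ z)                     ≡⟨ cong ((x + P * z) *_) (ι-* d (↧ₙ z)) ⟩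
        (x + P * z) * (ι d * ι (↧ₙ z))                   ≡⟨ rearrange x P z (ι d) (ι (↧ₙ z)) ⟩
        x * ι d * ι (↧ₙ z) + P * (z * ι (↧ₙ z) * ι d)
          ≡⟨ cong₂ (λ a b → a * ι (↧ₙ z) + P * (b * ι d)) eq (*-denominator z) ⟩
        ⟪ n ⟫ * ⟪ ↧ z ⟫ + P * (⟪ ↥ z ⟫ * ⟪ ℤ.+ d ⟫)
          ≡⟨ cong₂ (λ a b → a + P * b) (sym (⟪⟫-* n (↧ z))) (sym (⟪⟫-* (↥ z) (ℤ.+ d))) ⟩
        ⟪ n ℤ.* ↧ z ⟫ + P * ⟪ ↥ z ℤ.* ℤ.+ d ⟫
          ≡⟨ cong (λ b → ⟪ n ℤ.* ↧ z ⟫ + b) (sym (⟪⟫-* (ℤ.+ p) (↥ z ℤ.* ℤ.+ d))) ⟩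
        ⟪ n ℤ.* ↧ z ⟫ + ⟪ ℤ.+ p ℤ.* (↥ z ℤ.* ℤ.+ d) ⟫      ≡⟨ sym (⟪⟫-+ (n ℤ.* ↧ z) (ℤ.+ p ℤ.* (↥ z ℤ.* ℤ.+ d))) ⟩
        ⟪ n ℤ.* ↧ z ℤ.+ ℤ.+ p ℤ.* (↥ z ℤ.* ℤ.+ d) ⟫        ∎)
      where
      open ≡-Reasoning
      rearrange : ∀ x P z d e → (x + P * z) * (d * e) ≡ x * d * e + P * (z * e * d)
      rearrange = solve 5 λ x P z d e → (x :+ P :* z) :* (d :* e) := x :* d :* e :+ P :* (z :* e :* d)
      k = ↥ z ℤ.* ℤ.+ d
      p∤num : ¬ p ∣ ℤ.∣ n ℤ.* ↧ z ℤ.+ ℤ.+ p ℤ.* k ∣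
      p∤num p∣ = p∤* p∤n p∤e (subst (p ∣_) (ℤP.abs-* n (↧ z)) p∣n)
        where
        p∣n : p ∣ ℤ.∣ n ℤ.* ↧ z ∣
        p∣n = ℤD.∣⇒∣ᵤ (ℤD.∣m+n∣n⇒∣m {m = n ℤ.* ↧ z} (ℤD.∣ᵤ⇒∣ {ℤ.+ p} {n ℤ.* ↧ z ℤ.+ ℤ.+ p ℤ.* k} p∣) (ℤD.∣m⇒∣m*n k (ℤD.∣-refl {ℤ.+ p})))

    P≢0 : P ≢ ι 0
    P≢0 P≡0 = ℕ.≢-nonZero⁻¹ p {{prime⇒nonZero p-prime}} (ι-injective P≡0)

    recover : ∀ {x y z} → x - y ≡ P * z → y + P * z ≡ x
    recover {x} {y} eq = trans (cong (y +_) (sym eq)) (solve 2 (λ x y → y :+ (x :- y) := x) x y)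

    quotient-P : ∀ {x z} → x ≡ P * z → z ≡ x * inv P
    quotient-P {z = z} refl = sym (modulo₁ z (*-inv P≢0)
      (solve 3 (λ P z i → P :* z :* i := z :+ z :* (P :* i :- κ 1)) P z (inv P)))

    ≡⇒≈ : ∀ {x y m} → x ≡ y → x ≈ y [ m ]
    ≡⇒≈ {x} {m = m} refl = mk≈ (Z-ℕ 0) (trans (-‿inverseʳ x) (sym (zeroʳ m)))

    ≈-sym : ∀ {x y m} → x ≈ y [ m ] → y ≈ x [ m ]
    ≈-sym {x} {y} {m} (mk≈ {q} zq eq) = mk≈ (Z-neg zq) (begin
      y - x      ≡⟨ swap x y ⟩
      - (x - y)  ≡⟨ cong -_ eq ⟩
      - (m * q)  ≡⟨ solve 2 (λ m q → :- (m :* q) := m :* (:- q)) m q ⟩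
      m * (- q)  ∎)
      where
      open ≡-Reasoning
      swap : ∀ x y → y - x ≡ - (x - y)
      swap = solve 2 λ x y → y :- x := :- (x :- y)

    ≈-trans : ∀ {x y z m} → x ≈ y [ m ] → y ≈ z [ m ] → x ≈ z [ m ]
    ≈-trans {x} {y} {z} {m} (mk≈ {q} zq eq) (mk≈ {r} zr eq′) = mk≈ (Z-+ zq zr) (begin
      x - z               ≡⟨ solve 3 (λ x y z → x :- z := x :- y :+ (y :- z)) x y z ⟩
      (x - y) + (y - z)   ≡⟨ cong₂ _+_ eq eq′ ⟩
      m * q + m * r       ≡⟨ solve 3 (λ m q r → m :* q :+ m :* r := m :* (q :+ r)) m q r ⟩
      m * (q + r)         ∎)
      where open ≡-Reasoning

    ≈-+ : ∀ {x x′ y y′ m} → x ≈ x′ [ m ] → y ≈ y′ [ m ] → x + y ≈ x′ + y′ [ m ]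
    ≈-+ {x} {x′} {y} {y′} {m} (mk≈ {q} zq eq) (mk≈ {r} zr eq′) = mk≈ (Z-+ zq zr) (begin
      x + y - (x′ + y′)     ≡⟨ solve 4 (λ x x′ y y′ → x :+ y :- (x′ :+ y′) := x :- x′ :+ (y :- y′)) x x′ y y′ ⟩
      (x - x′) + (y - y′)   ≡⟨ cong₂ _+_ eq eq′ ⟩
      m * q + m * r         ≡⟨ solve 3 (λ m q r → m :* q :+ m :* r := m :* (q :+ r)) m q r ⟩
      m * (q + r)           ∎)
      where open ≡-Reasoning

    ≈-* : ∀ {x x′ y y′ m} → Z x′ → Z y → x ≈ x′ [ m ] → y ≈ y′ [ m ] → x * y ≈ x′ * y′ [ m ]
    ≈-* {x} {x′} {y} {y′} {m} zx′ zy (mk≈ {q} zq eq) (mk≈ {r} zr eq′) = mk≈ (Z-+ (Z-* zq zy) (Z-* zx′ zr)) (begin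
      x * y - x′ * y′               ≡⟨ solve 4 (λ x x′ y y′ → x :* y :- x′ :* y′ := (x :- x′) :* y :+ x′ :* (y :- y′)) x x′ y y′ ⟩
      (x - x′) * y + x′ * (y - y′)  ≡⟨ cong₂ (λ a b → a * y + x′ * b) eq eq′ ⟩
      m * q * y + x′ * (m * r)      ≡⟨ solve 5 (λ m q r x′ y → m :* q :* y :+ x′ :* (m :* r) := m :* (q :* y :+ x′ :* r)) m q r x′ y ⟩
      m * (q * y + x′ * r)          ∎)
      where open ≡-Reasoning

    ≈-scale : ∀ c {x y m} → x ≈ y [ m ] → c * x ≈ c * y [ c * m ]
    ≈-scale c {x} {y} {m} (mk≈ {q} zq eq) = mk≈ zq (begin
      c * x - c * y   ≡⟨ solve 3 (λ c x y → c :* x :- c :* y := c :* (x :- y)) c x y ⟩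
      c * (x - y)     ≡⟨ cong (c *_) eq ⟩
      c * (m * q)     ≡⟨ sym (*-assoc c m q) ⟩
      c * m * q       ∎)
      where open ≡-Reasoning

    ≈-weaken : ∀ {k x y m} → Z k → x ≈ y [ m * k ] → x ≈ y [ m ]
    ≈-weaken {k} {x} {y} {m} zk (mk≈ {q} zq eq) = mk≈ (Z-* zk zq) (trans eq (*-assoc m k q))

    ≈-mod : ∀ {x y m m′} → m ≡ m′ → x ≈ y [ m ] → x ≈ y [ m′ ]
    ≈-mod refl x≈y = x≈y

    ≈-*ˡ : ∀ {c x y m} → Z c → x ≈ y [ m ] → c * x ≈ c * y [ m ]
    ≈-*ˡ {c} {m = m} zc x≈y = ≈-weaken zc (≈-mod (*-comm c m) (≈-scale c x≈y))

    ≈-unscale : ∀ {c x y m} → c ≢ ι 0 → c * x ≈ c * y [ c * m ] → x ≈ y [ m ]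
    ≈-unscale {c} {x} {y} {m} c≢0 (mk≈ {q} zq eq) = mk≈ zq (*-cancelˡ (*-inv c≢0) (begin
      c * (x - y)     ≡⟨ solve 3 (λ c x y → c :* (x :- y) := c :* x :- c :* y) c x y ⟩
      c * x - c * y   ≡⟨ eq ⟩
      c * m * q       ≡⟨ *-assoc c m q ⟩
      c * (m * q)     ∎))
      where open ≡-Reasoning

    ≈-cancelˡ : ∀ {c x y m} → Unit c → c * x ≈ c * y [ m ] → x ≈ y [ m ]
    ≈-cancelˡ {c} {x} {y} {m} uc (mk≈ {q} zq eq) = mk≈ (Z-* (Z-inv uc) zq) (*-cancelˡ (Unit-inverse uc) (begin
      c * (x - y)         ≡⟨ solve 3 (λ c x y → c :* (x :- y) := c :* x :- c :* y) c x y ⟩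
      c * x - c * y       ≡⟨ eq ⟩
      m * q               ≡⟨ sym (*-identityˡ _) ⟩
      ι 1 * (m * q)       ≡⟨ cong (_* (m * q)) (sym (Unit-inverse uc)) ⟩
      c * inv c * (m * q) ≡⟨ solve 4 (λ c i m q → c :* i :* (m :* q) := c :* (m :* (i :* q))) c (inv c) m q ⟩
      c * (m * (inv c * q)) ∎))
      where open ≡-Reasoning

    Z-≈ : ∀ {x y m} → Z m → Z y → x ≈ y [ m ] → Z x
    Z-≈ {x} {y} {m} zm zy (mk≈ {q} zq eq) = subst Z (begin
      y + m * q    ≡⟨ cong (y +_) (sym eq) ⟩
      y + (x - y)  ≡⟨ solve 2 (λ x y → y :+ (x :- y) := x) x y ⟩
      x            ∎) (Z-+ zy (Z-* zm zq))
      where open ≡-Reasoning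

    Unit-≈ : ∀ {x y} → Unit y → x ≈ y [ P ] → Unit x
    Unit-≈ {x} {y} uy (mk≈ {q} zq eq) = subst Unit (begin
      y + P * q    ≡⟨ cong (y +_) (sym eq) ⟩
      y + (x - y)  ≡⟨ solve 2 (λ x y → y :+ (x :- y) := x) x y ⟩
      x            ∎) (Unit-shift uy zq)
      where open ≡-Reasoning

    ≈-inv : ∀ {x y m} → Unit x → Unit y → x ≈ y [ m ] → inv x ≈ inv y [ m ]
    ≈-inv {x} {y} ux uy x≈y = ≈-cancelˡ (Unit-* ux uy) (≈-trans (≡⇒≈ (begin
      x * y * inv x  ≡⟨ solve 3 (λ x y i → x :* y :* i := y :* (x :* i)) x y (inv x) ⟩
      y * (x * inv x) ≡⟨ cong (y *_) (Unit-inverse ux) ⟩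
      y * ι 1        ≡⟨ *-identityʳ y ⟩
      y              ∎)) (≈-trans (≈-sym x≈y) (≡⇒≈ (begin
      x              ≡⟨ sym (*-identityʳ x) ⟩
      x * ι 1        ≡⟨ cong (x *_) (sym (Unit-inverse uy)) ⟩
      x * (y * inv y) ≡⟨ sym (*-assoc x y (inv y)) ⟩
      x * y * inv y  ∎))))
      where open ≡-Reasoning

    -- The deformation modulo p⁴

    P² P³ P⁴ : ℚ
    P² = P * P
    P³ = P * P * P
    P⁴ = P * P * P * P

    P⁴≡P^4 : P⁴ ≡ P ^ 4
    P⁴≡P^4 = solve 1 (λ P → P :* P :* P :* P := P :* (P :* (P :* (P :* κ 1)))) P

    ZP : Z P
    ZP = Z-ℕ p

    Z-^ : ∀ {x} n → Z x → Z (x ^ n)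
    Z-^ zero    zx = Z-ℕ 1
    Z-^ (suc n) zx = Z-* zx (Z-^ n zx)

    Z-prod : ∀ n {f} → (∀ i → i < n → Z (f i)) → Z (prod n f)
    Z-prod zero    zf = Z-ℕ 1
    Z-prod (suc n) zf = Z-* (Z-prod n (λ i i<n → zf i (ℕP.m<n⇒m<1+n i<n))) (zf n ℕP.≤-refl)

    ≈-weaken-P² : ∀ {x y} → x ≈ y [ P² ] → x ≈ y [ P ]
    ≈-weaken-P² = ≈-weaken ZP

    ≈-weaken-P³ : ∀ {x y} → x ≈ y [ P³ ] → x ≈ y [ P ]
    ≈-weaken-P³ x≈y = ≈-weaken-P² (≈-weaken ZP x≈y)

    Unit-suc : ∀ {i} → suc i < p → Unit (ι (suc i))
    Unit-suc i<p = Unit-ι (>⇒∤ i<p)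

    Unit-quartic : ∀ {v x} → v ≈ ι 0 [ P ] → Unit x → Unit (quartic v x)
    Unit-quartic {v} {x} v≈0 ux = Unit-* ux (Unit-≈ (Unit-* (Unit-* ux ux) ux)
      (≈-trans (≈-+ (≡⇒≈ {x * x * x} refl) -v≈0) (≡⇒≈ (+-identityʳ (x * x * x)))))
      where
      -v≈0 : - v ≈ ι 0 [ P ]
      -v≈0 = ≈-trans (≡⇒≈ (solve 1 (λ v → :- v := :- κ 1 :* v) v))
        (≈-trans (≈-*ˡ (Z-neg (Z-ℕ 1)) v≈0) (≡⇒≈ (zeroʳ (- ι 1))))

    -- The four values x₁₁, x₁₀, x₀₁, x₀₀ of one expression in (u , v), at the given u ∈ pℤₚ or
    -- at u = 0, and at the given v ∈ p³ℤₚ or at v = 0: the second difference is divisible by p⁴.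
    record Square (x₁₁ x₁₀ x₀₁ x₀₀ : ℚ) : Set where
      constructor mkSquare
      field
        Z₁₁   : Z x₁₁
        Z₁₀   : Z x₁₀
        Z₀₁   : Z x₀₁
        Z₀₀   : Z x₀₀
        u₁    : x₁₁ ≈ x₀₁ [ P ]
        u₀    : x₁₀ ≈ x₀₀ [ P ]
        v₁    : x₁₁ ≈ x₁₀ [ P³ ]
        v₀    : x₀₁ ≈ x₀₀ [ P³ ]
        mixed : x₁₁ - x₁₀ ≈ x₀₁ - x₀₀ [ P⁴ ]

    Square-const : ∀ {x} → Z x → Square x x x x
    Square-const {x} zx = mkSquare zx zx zx zx (≡⇒≈ refl) (≡⇒≈ refl) (≡⇒≈ refl) (≡⇒≈ refl) (≡⇒≈ refl)

    Square-u : ∀ {u} → Z u → u ≈ ι 0 [ P ] → Square u u (ι 0) (ι 0)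
    Square-u {u} zu u≈0 = mkSquare zu zu (Z-ℕ 0) (Z-ℕ 0) u≈0 u≈0 (≡⇒≈ refl) (≡⇒≈ refl)
      (≡⇒≈ (solve 1 (λ u → u :- u := κ 0 :- κ 0) u))

    Square-v : ∀ {v} → Z v → v ≈ ι 0 [ P³ ] → Square v (ι 0) v (ι 0)
    Square-v zv v≈0 = mkSquare zv (Z-ℕ 0) zv (Z-ℕ 0) (≡⇒≈ refl) (≡⇒≈ refl) v≈0 v≈0 (≡⇒≈ refl)

    Square-+ : ∀ {a b c d a′ b′ c′ d′} → Square a b c d → Square a′ b′ c′ d′ → Square (a + a′) (b + b′) (c + c′) (d + d′)
    Square-+ {a} {b} {c} {d} {a′} {b′} {c′} {d′} X Y = mkSquare
      (Z-+ (Z₁₁ X) (Z₁₁ Y)) (Z-+ (Z₁₀ X) (Z₁₀ Y)) (Z-+ (Z₀₁ X) (Z₀₁ Y)) (Z-+ (Z₀₀ X) (Z₀₀ Y))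
      (≈-+ (u₁ X) (u₁ Y)) (≈-+ (u₀ X) (u₀ Y)) (≈-+ (v₁ X) (v₁ Y)) (≈-+ (v₀ X) (v₀ Y))
      (≈-trans (≡⇒≈ (regroup a b a′ b′)) (≈-trans (≈-+ (mixed X) (mixed Y)) (≡⇒≈ (sym (regroup c d c′ d′)))))
      where
      open Square
      regroup : ∀ a b a′ b′ → a + a′ - (b + b′) ≡ (a - b) + (a′ - b′)
      regroup = solve 4 λ a b a′ b′ → a :+ a′ :- (b :+ b′) := (a :- b) :+ (a′ :- b′)

    -- Leibniz rule for second differences. Besides the two second differences, each cross term
    -- pairs a u-difference, divisible by P, with a v-difference, divisible by P³.
    Square-* : ∀ {a b c d a′ b′ c′ d′} → Square a b c d → Square a′ b′ c′ d′ → Square (a * a′) (b * b′) (c * c′) (d * d′)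
    Square-* {a} {b} {c} {d} {a′} {b′} {c′} {d′}
      (mkSquare za zb zc zd u₁ u₀@(mk≈ {s₀} zs₀ bd) v₁ v₀@(mk≈ {r} zr cd) (mk≈ {q} zq abcd))
      (mkSquare za′ zb′ zc′ zd′ u₁′@(mk≈ {s} zs ac) u₀′ v₁′@(mk≈ {r′} zr′ ab) v₀′ (mk≈ {q′} zq′ abcd′)) = mkSquare
      (Z-* za za′) (Z-* zb zb′) (Z-* zc zc′) (Z-* zd zd′)
      (≈-* zc za′ u₁ u₁′) (≈-* zd zb′ u₀ u₀′) (≈-* zb za′ v₁ v₁′) (≈-* zd zc′ v₀ v₀′)
      (mk≈ (Z-+ (Z-+ (Z-* zq za′) (Z-* zr zs)) (Z-+ (Z-* zs₀ zr′) (Z-* zd zq′)))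
        (modulo₁ a′ abcd (modulo₁ (a′ - c′) cd (modulo₁ (a′ - b′) bd (modulo₁ d abcd′ (modulo₁ (P³ * r) ac (modulo₁ (P * s₀) ab
          (solve 15 (λ a b c d a′ b′ c′ d′ q q′ r r′ s s₀ P →
            let P³ = P :* P :* P
                P⁴ = P :* P :* P :* P
            in a :* a′ :- b :* b′ :- (c :* c′ :- d :* d′)
              := P⁴ :* (q :* a′ :+ r :* s :+ (s₀ :* r′ :+ d :* q′))
                 :+ a′ :* (a :- b :- (c :- d) :- P⁴ :* q)
                 :+ (a′ :- c′) :* (c :- d :- P³ :* r)
                 :+ (a′ :- b′) :* (b :- d :- P :* s₀)
                 :+ d :* (a′ :- b′ :- (c′ :- d′) :- P⁴ :* q′)
                 :+ P³ :* r :* (a′ :- c′ :- P :* s)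
                 :+ P :* s₀ :* (a′ :- b′ :- P³ :* r′))
            a b c d a′ b′ c′ d′ q q′ r r′ s s₀ P))))))))

    -- From 1/a - 1/b = -(a - b)/(ab), the second difference of inverses is -AB times that of the
    -- values, minus (AB - CD)(c - d), where AB - CD is divisible by P and c - d by P³.
    Square-inv : ∀ {a b c d} → Unit a → Unit b → Unit c → Unit d → Square a b c d → Square (inv a) (inv b) (inv c) (inv d)
    Square-inv {a} {b} {c} {d} ua ub uc ud (mkSquare za zb zc zd u₁ u₀ v₁ v₀@(mk≈ {r} zr cd) (mk≈ {q} zq abcd)) =
      invert (≈-inv ua uc u₁) (≈-inv ub ud u₀)
      where
      A = inv a
      B = inv b
      C = inv c
      D = inv d
      difference-inv : ∀ {x y} → Unit x → Unit y → inv x - inv y ≡ - (inv x * inv y * (x - y))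
      difference-inv {x} {y} ux uy = modulo₂ (- inv x) (inv y) (Unit-inverse uy) (Unit-inverse ux)
        (solve 4 (λ x y X Y → X :- Y := :- (X :* Y :* (x :- y)) :+ :- X :* (y :* Y :- κ 1) :+ Y :* (x :* X :- κ 1)) x y (inv x) (inv y))
      invert : A ≈ C [ P ] → B ≈ D [ P ] → Square A B C D
      invert A≈C@(mk≈ {s} zs AC) B≈D@(mk≈ {s₀} zs₀ BD) = mkSquare (Z-inv ua) (Z-inv ub) (Z-inv uc) (Z-inv ud)
        A≈C B≈D (≈-inv ua ub v₁) (≈-inv uc ud v₀)
        (mk≈ (Z-neg (Z-+ (Z-* (Z-* (Z-inv ua) (Z-inv ub)) zq) (Z-* (Z-+ (Z-* zs (Z-inv ub)) (Z-* (Z-inv uc) zs₀)) zr)))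
          (modulo₂ (ι 1) (- ι 1) (difference-inv ua ub) (difference-inv uc ud)
          (modulo₁ (- (A * B)) abcd (modulo₁ (- (A * B - C * D)) cd (modulo₁ (- (B * P³ * r)) AC (modulo₁ (- (C * P³ * r)) BD
            (solve 13 (λ a b c d A B C D q r s s₀ P →
              let P³ = P :* P :* P
                  P⁴ = P :* P :* P :* P
              in A :- B :- (C :- D)
                := P⁴ :* :- (A :* B :* q :+ (s :* B :+ C :* s₀) :* r)
                   :+ κ 1 :* (A :- B :- :- (A :* B :* (a :- b)))
                   :+ :- κ 1 :* (C :- D :- :- (C :* D :* (c :- d)))
                   :+ :- (A :* B) :* (a :- b :- (c :- d) :- P⁴ :* q)
                   :+ :- (A :* B :- C :* D) :* (c :- d :- P³ :* r)
                   :+ :- (B :* P³ :* r) :* (A :- C :- P :* s)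
                   :+ :- (C :* P³ :* r) :* (B :- D :- P :* s₀))
            a b c d A B C D q r s s₀ P)))))))

    Square-∸ : ∀ {a b c d a′ b′ c′ d′} → Square a b c d → Square a′ b′ c′ d′ → Square (a - a′) (b - b′) (c - c′) (d - d′)
    Square-∸ {a} {b} {c} {d} {a′} {b′} {c′} {d′} X Y = Square-+ X Y-neg
      where
      neg≡ : ∀ x → - ι 1 * x ≡ - x
      neg≡ = solve 1 λ x → :- κ 1 :* x := :- x
      Y-neg : Square (- a′) (- b′) (- c′) (- d′)
      Y-neg rewrite sym (neg≡ a′) | sym (neg≡ b′) | sym (neg≡ c′) | sym (neg≡ d′) = Square-* (Square-const (Z-neg (Z-ℕ 1))) Y

    Square-prod : ∀ n {f₁₁ f₁₀ f₀₁ f₀₀} → (∀ i → i < n → Square (f₁₁ i) (f₁₀ i) (f₀₁ i) (f₀₀ i)) →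
      Square (prod n f₁₁) (prod n f₁₀) (prod n f₀₁) (prod n f₀₀)
    Square-prod zero    sf = Square-const (Z-ℕ 1)
    Square-prod (suc n) sf = Square-* (Square-prod n (λ i i<n → sf i (ℕP.m<n⇒m<1+n i<n))) (sf n ℕP.≤-refl)

    Square-conv : ∀ n l {f₁₁ f₁₀ f₀₁ f₀₀} →
      (∀ k m → suc (k ℕ.+ m) ≡ n ℕ.+ l → Square (f₁₁ k m) (f₁₀ k m) (f₀₁ k m) (f₀₀ k m)) →
      Square (conv f₁₁ n l) (conv f₁₀ n l) (conv f₀₁ n l) (conv f₀₀ n l)
    Square-conv zero    l sf = Square-const (Z-ℕ 0)
    Square-conv (suc n) l sf = Square-+ (Square-conv n (suc l) (λ k m k+m≡ → sf k m (trans k+m≡ (ℕP.+-suc n l)))) (sf n l refl)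

    fourth-power≈0 : ∀ {c x} → Z c → x ≈ ι 0 [ P ] → c * x ^ 4 ≈ ι 0 [ P⁴ ]
    fourth-power≈0 {c} {x} zc (mk≈ {q} zq eq) = mk≈ (Z-* zc (Z-* (Z-* zq zq) (Z-* zq zq)))
      (modulo₁ (c * (x * x * x + x * x * (P * q) + x * (P * q) * (P * q) + P * q * (P * q) * (P * q))) eq
        (solve 4 (λ c x P q → let y = P :* q in
          c :* (x :* (x :* (x :* (x :* κ 1)))) :- κ 0
            := P :* P :* P :* P :* (c :* (q :* q :* (q :* q)))
               :+ c :* (x :* x :* x :+ x :* x :* y :+ x :* y :* y :+ y :* y :* y) :* (x :- κ 0 :- P :* q)) c x P q))

    ≈0-*ˡ : ∀ {c x m} → Z c → x ≈ ι 0 [ m ] → c * x ≈ ι 0 [ m ]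
    ≈0-*ˡ {c} zc x≈0 = ≈-trans (≈-*ˡ zc x≈0) (≡⇒≈ (zeroʳ c))

    ≈0-*ʳ : ∀ {c x m} → x ≈ ι 0 [ m ] → Z c → x * c ≈ ι 0 [ m ]
    ≈0-*ʳ {c} {x} x≈0 zc = ≈-trans (≡⇒≈ (*-comm x c)) (≈0-*ˡ zc x≈0)

    sum-tail : ∀ m d {f M} → (∀ k → m ℕ.≤ k → k < d ℕ.+ m → f k ≈ ι 0 [ M ]) → sum (d ℕ.+ m) f ≈ sum m f [ M ]
    sum-tail m zero    f≈0 = ≡⇒≈ refl
    sum-tail m (suc d) f≈0 = ≈-trans
      (≈-+ (sum-tail m d (λ k m≤k k<d → f≈0 k m≤k (ℕP.m<n⇒m<1+n k<d))) (f≈0 (d ℕ.+ m) (ℕP.m≤n+m m d) ℕP.≤-refl))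
      (≡⇒≈ (+-identityʳ _))

    module _ {t : ℚ} (Zt : Z t) {r : ℕ} (r<p : r < p) where

      private
        u v a : ℚ
        u = P * t
        v = u * u * u
        a = ι r + u
        summand : ℕ → ℚ
        summand k = (a - ι (2 ℕ.* k)) * binomial a k ^ 4

      Zu : Z u
      Zu = Z-* ZP Zt

      u≈0 : u ≈ ι 0 [ P ]
      u≈0 = mk≈ Zt (solve 1 (λ u → u :- κ 0 := u) u)

      v≈0 : v ≈ ι 0 [ P³ ]
      v≈0 = mk≈ (Z-* (Z-* Zt Zt) Zt) (solve 2 (λ P t → let u = P :* t in u :* u :* u :- κ 0 := P :* P :* P :* (t :* t :* t)) P t)

      index<p : ∀ {i} → i < r → suc i < p
      index<p i<r = ℕP.≤-<-trans i<r r<p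

      Unit-index : ∀ i → i < r → Unit (ι (suc i))
      Unit-index i i<r = Unit-suc (index<p i<r)

      Unit-shifted : ∀ i → i < r → Unit (ι (suc i) + u)
      Unit-shifted i i<r = Unit-shift (Unit-index i i<r) Zt

      Unit-unshifted : ∀ i → i < r → Unit (ι (suc i) + ι 0)
      Unit-unshifted i i<r = subst Unit (sym (+-identityʳ (ι (suc i)))) (Unit-index i i<r)

      Unit-shifted₂ : ∀ i → i < r → Unit (ι (suc i) + ι 2 * u)
      Unit-shifted₂ i i<r = subst Unit (solve 3 (λ n P t → n :+ P :* (κ 2 :* t) := n :+ κ 2 :* (P :* t)) (ι (suc i)) P t)
        (Unit-shift (Unit-index i i<r) (Z-* (Z-ℕ 2) Zt))

      Unit-quadratic : ∀ i → i < r → let n = ι (suc i) in Unit (n * n + n * u + u * u)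
      Unit-quadratic i i<r = subst Unit
        (solve 3 (λ n P t → n :* n :+ P :* (n :* t :+ t :* (P :* t)) := n :* n :+ n :* (P :* t) :+ P :* t :* (P :* t)) (ι (suc i)) P t)
        (Unit-shift (Unit-* (Unit-index i i<r) (Unit-index i i<r)) (Z-+ (Z-* (Z-ℕ (suc i)) Zt) (Z-* Zt Zu)))

      v≈0′ : v ≈ ι 0 [ P ]
      v≈0′ = ≈-weaken-P³ v≈0

      Z-a-ι : ∀ k → Z (a - ι k)
      Z-a-ι k = Z-+ (Z-+ (Z-ℕ r) Zu) (Z-neg (Z-ℕ k))

      binomial-Z : ∀ k → k < p → Z (binomial a k)
      binomial-Z zero    _   = Z-ℕ 1
      binomial-Z (suc k) k<p = Z-* (Z-* (binomial-Z k (ℕP.<-trans (ℕP.n<1+n k) k<p)) (Z-a-ι k)) (Z-inv (Unit-suc k<p))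

      -- At index r + 1 the numerator acquires `a - ι r`, which is u. Later coefficients keep this
      -- factor, their denominators being units below p.
      binomial≈0 : ∀ d → d ℕ.+ suc r < p → binomial a (d ℕ.+ suc r) ≈ ι 0 [ P ]
      binomial≈0 zero    <p = ≈0-*ʳ (≈0-*ˡ (binomial-Z r r<p) (≈-trans (≡⇒≈ (solve 2 (λ r u → r :+ u :- r := u) (ι r) u)) u≈0)) (Z-inv (Unit-suc <p))
      binomial≈0 (suc d) <p = ≈0-*ʳ (≈0-*ʳ (binomial≈0 d (ℕP.<-trans (ℕP.n<1+n _) <p)) (Z-a-ι (d ℕ.+ suc r))) (Z-inv (Unit-suc <p))

      tail : sum p summand ≈ sum (suc r) summand [ P⁴ ]
      tail = subst (λ n → sum n summand ≈ sum (suc r) summand [ P⁴ ]) (ℕP.m∸n+n≡m r<p)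
        (sum-tail (suc r) (p ℕ.∸ suc r) summand≈0)
        where
        summand≈0 : ∀ k → suc r ℕ.≤ k → k < p ℕ.∸ suc r ℕ.+ suc r → summand k ≈ ι 0 [ P⁴ ]
        summand≈0 k r<k k<p = fourth-power≈0 (Z-a-ι (2 ℕ.* k))
          (subst (λ k → binomial a k ≈ ι 0 [ P ]) (ℕP.m∸n+n≡m r<k)
            (binomial≈0 (k ℕ.∸ suc r) (subst (_< p) (sym (ℕP.m∸n+n≡m r<k)) (subst (k <_) (ℕP.m∸n+n≡m r<p) k<p))))

      Π : ℚ → ℚ
      Π v = prod r (λ i → quartic v (ι (suc i) + u))

      Square-quartic : ∀ {x₁ x₀} → Square x₁ x₁ x₀ x₀ → Square (quartic v x₁) (quartic (ι 0) x₁) (quartic v x₀) (quartic (ι 0) x₀)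
      Square-quartic X = Square-* X (Square-∸ (Square-* (Square-* X X) X) (Square-v (Z-* (Z-* Zu Zu) Zu) v≈0))

      Square-shifted : ∀ i → Square (ι (suc i) + u) (ι (suc i) + u) (ι (suc i) + ι 0) (ι (suc i) + ι 0)
      Square-shifted i = Square-+ (Square-const (Z-ℕ (suc i))) (Square-u Zu u≈0)

      Π≈Π₀ : Π v ≈ Π (ι 0) [ P³ ]
      Π≈Π₀ = Square.v₁ (Square-prod r (λ i _ → Square-quartic (Square-shifted i)))

      Square-S : Square (S u v r) (S u (ι 0) r) (S (ι 0) v r) (S (ι 0) (ι 0) r)
      Square-S = Square-conv (suc r) 0 λ k m k+m≡ →
        let k+m≡r = ℕP.suc-injective (trans k+m≡ (ℕP.+-identityʳ (suc r)))
            below : ∀ {i n} → n ℕ.≤ r → i < n → i < r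
            below n≤r i<n = ℕP.<-≤-trans i<n n≤r
        in Square-* (Square-∸ (Square-+ (Square-u Zu u≈0) (Square-const (Z-ℕ m))) (Square-const (Z-ℕ k)))
          (Square-*
            (Square-prod k λ i i<k → let w = Unit-index i (below (ℕP.m+n≤o⇒m≤o k (ℕP.≤-reflexive k+m≡r)) i<k) in
              Square-inv (Unit-quartic v≈0′ w) (Unit-quartic (≡⇒≈ refl) w) (Unit-quartic v≈0′ w) (Unit-quartic (≡⇒≈ refl) w)
                (Square-quartic (Square-const (Z-ℕ (suc i)))))
            (Square-prod m λ i i<m → let i<r = below (ℕP.m+n≤o⇒n≤o k (ℕP.≤-reflexive k+m≡r)) i<m
                                         w₁ = Unit-shifted i i<r
                                         w₀ = Unit-unshifted i i<r in
              Square-inv (Unit-quartic v≈0′ w₁) (Unit-quartic (≡⇒≈ refl) w₁) (Unit-quartic v≈0′ w₀) (Unit-quartic (≡⇒≈ refl) w₀)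
                (Square-quartic (Square-shifted i))))

      -- The prefactor `Π` also depends on v, and changes by a multiple of P³ only. The change is
      -- harmless because it multiplies `S u (ι 0) r`, which is congruent mod P to the vanishing
      -- value at u = 0.
      deformation : S u (ι 0) r * Π (ι 0) ≈ S u v r * Π v [ P⁴ ]
      deformation = combine Square-S Π≈Π₀ (S-vanishes v r) (S-vanishes (ι 0) r) (Z-prod r (λ i i<r → Z-quartic i))
        where
        Z-quartic : ∀ i → Z (quartic v (ι (suc i) + u))
        Z-quartic i = Z-solve (Z-ℕ (suc i) ∷ Zu ∷ []) (λ n u → let x = n :+ u in x :* (x :* x :* x :- u :* u :* u))
        combine : ∀ {S₁₁ S₁₀ S₀₁ S₀₀ X Y} → Square S₁₁ S₁₀ S₀₁ S₀₀ → X ≈ Y [ P³ ] → S₀₁ ≡ ι 0 → S₀₀ ≡ ι 0 → Z X → S₁₀ * Y ≈ S₁₁ * X [ P⁴ ]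
        combine {S₁₁} {S₁₀} {X = X} {Y} (mkSquare _ _ _ _ _ (mk≈ {s₀} zs₀ e₀) _ _ (mk≈ {q} zq e)) (mk≈ {s} zs e′) refl refl zX =
          mk≈ (Z-neg (Z-+ (Z-* zq zX) (Z-* zs₀ zs))) (modulo₁ (- X) e (modulo₁ (- S₁₀) e′ (modulo₁ (- (P³ * s)) e₀
            (solve 8 (λ S₁₁ S₁₀ X Y q s s₀ P → let P³ = P :* P :* P in
              S₁₀ :* Y :- S₁₁ :* X := P :* P :* P :* P :* :- (q :* X :+ s₀ :* s)
                :+ :- X :* (S₁₁ :- S₁₀ :- (κ 0 :- κ 0) :- P :* P :* P :* P :* q)
                :+ :- S₁₀ :* (X :- Y :- P³ :* s)
                :+ :- (P³ :* s) :* (S₁₀ :- κ 0 :- P :* s₀))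
              S₁₁ S₁₀ X Y q s s₀ P))))

      quartic-reduction : sum p summand ≈ (- ι 1) ^ r * u * (WZ.upper u r * WZ.lower u r) [ P⁴ ]
      quartic-reduction = ≈-trans tail (≈-trans (≡⇒≈ (truncated u r
          (λ i i<r → Unit-inverse (Unit-index i i<r)) (λ i i<r → Unit-inverse (Unit-shifted i i<r))))
        (≈-trans deformation (≡⇒≈ (WZ.closed-form u v _ _ r
          (λ i i<r → Unit-inverse (Unit-quartic v≈0′ (Unit-index i i<r)))
          (λ i i<r → Unit-inverse (Unit-quartic v≈0′ (Unit-shifted i i<r)))
          refl (λ i → inv (ι (suc i) + ι 2 * u))
          (λ i i<r → Unit-inverse (Unit-quadratic i i<r))
          (λ i i<r → Unit-inverse (Unit-shifted₂ i i<r)) r ℕP.≤-refl))))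

    -- Expansion modulo p³, and residues below p/2

    Z-sum : ∀ n {f} → (∀ i → i < n → Z (f i)) → Z (sum n f)
    Z-sum zero    zf = Z-ℕ 0
    Z-sum (suc n) zf = Z-+ (Z-sum n (λ i i<n → zf i (ℕP.m<n⇒m<1+n i<n))) (zf n ℕP.≤-refl)

    ≈-prod : ∀ n {f g m} → (∀ i → i < n → f i ≈ g i [ m ]) → (∀ i → i < n → Z (f i)) → (∀ i → i < n → Z (g i)) →
      prod n f ≈ prod n g [ m ]
    ≈-prod zero    f≈g zf zg = ≡⇒≈ refl
    ≈-prod (suc n) f≈g zf zg = ≈-* (Z-prod n (λ i i<n → zg i (ℕP.m<n⇒m<1+n i<n))) (zf n ℕP.≤-refl)
      (≈-prod n (λ i i<n → f≈g i (ℕP.m<n⇒m<1+n i<n)) (λ i i<n → zf i (ℕP.m<n⇒m<1+n i<n)) (λ i i<n → zg i (ℕP.m<n⇒m<1+n i<n)))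
      (f≈g n ℕP.≤-refl)

    module _ {t : ℚ} (Zt : Z t) where

      private
        u = P * t

      -- The quadratic coefficient is (2u)² e₂ in the elementary symmetric function e₂. Newton's
      -- identity 2e₂ = B₁² - B₂ rewrites it in power sums with no division.
      upper-expansion : ∀ n {b : ℕ → ℚ} → (∀ i → i < n → Z (b i)) → let B₁ = sum n b ; B₂ = sum n (λ i → b i * b i) in
        prod n (λ i → ι 1 + ι 2 * u * b i) ≈ ι 1 + ι 2 * u * B₁ + ι 2 * (u * u) * (B₁ * B₁ - B₂) [ P³ ]
      upper-expansion zero    zb = ≡⇒≈ (solve 1 (λ u → κ 1 := κ 1 :+ κ 2 :* u :* κ 0 :+ κ 2 :* (u :* u) :* (κ 0 :* κ 0 :- κ 0)) u)
      upper-expansion (suc n) {b} zb = ≈-trans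
        (≈-* (Z-solve zs λ P t b B₁ B₂ → :expansion (P :* t) B₁ B₂)
             (Z-solve zs λ P t b B₁ B₂ → κ 1 :+ κ 2 :* (P :* t) :* b)
             (upper-expansion n zb′) (≡⇒≈ refl))
        (≈-solve zs λ P t b B₁ B₂ → let u = P :* t in
          (:expansion u B₁ B₂ :* (κ 1 :+ κ 2 :* u :* b) , :expansion u (B₁ :+ b) (B₂ :+ b :* b))
          , (P :* P :* P , κ 4 :* (t :* t :* t) :* (B₁ :* B₁ :- B₂) :* b))
        where
        :expansion : ∀ {n} → Polynomial n → Polynomial n → Polynomial n → Polynomial n
        :expansion u B₁ B₂ = κ 1 :+ κ 2 :* u :* B₁ :+ κ 2 :* (u :* u) :* (B₁ :* B₁ :- B₂)
        zb′ = λ i i<n → zb i (ℕP.m<n⇒m<1+n i<n)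
        zs : All Z (P ∷ t ∷ b n ∷ sum n b ∷ sum n (λ i → b i * b i) ∷ [])
        zs = ZP ∷ Zt ∷ zb n ℕP.≤-refl ∷ Z-sum n zb′ ∷ Z-sum n (λ i i<n → Z-* (zb′ i i<n) (zb′ i i<n)) ∷ []

      lower-expansion : ∀ n {b : ℕ → ℚ} → (∀ i → i < n → Z (b i)) →
        prod n (λ i → ι 1 - u * u * (b i * b i)) ≈ ι 1 - u * u * sum n (λ i → b i * b i) [ P³ ]
      lower-expansion zero    zb = ≡⇒≈ (solve 1 (λ u → κ 1 := κ 1 :- u :* u :* κ 0) u)
      lower-expansion (suc n) {b} zb = ≈-trans
        (≈-* (Z-solve zs λ P t b B → κ 1 :- P :* t :* (P :* t) :* B)
             (Z-solve zs λ P t b B → κ 1 :- P :* t :* (P :* t) :* (b :* b))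
             (lower-expansion n zb′) (≡⇒≈ refl))
        (≈-solve zs λ P t b B → let u = P :* t in
          ((κ 1 :- u :* u :* B) :* (κ 1 :- u :* u :* (b :* b)) , κ 1 :- u :* u :* (B :+ b :* b))
          , (P :* P :* P , t :* u :* t :* t :* B :* b :* b))
        where
        zb′ = λ i i<n → zb i (ℕP.m<n⇒m<1+n i<n)
        zs : All Z (P ∷ t ∷ b n ∷ sum n (λ i → b i * b i) ∷ [])
        zs = ZP ∷ Zt ∷ zb n ℕP.≤-refl ∷ Z-sum n (λ i i<n → Z-* (zb′ i i<n) (zb′ i i<n)) ∷ []

      module _ {r : ℕ} (r<p : r < p) where

        -- The fraction equals (n² - u²)/(n³ - u³) formally, and u³ ≡ 0 (mod p³). This is why it has
        -- no term linear in u.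
        lower-factor : ∀ i → i < r → let n = ι (suc i) in
          (n + u) * inv (n * n + n * u + u * u) ≈ inv n * (ι 1 - u * u * (inv n * inv n)) [ P³ ]
        lower-factor i i<r = mk≈ (Z-* Zd (Z-solve (ZP ∷ Zt ∷ Z-inv un ∷ []) λ P t m → t :* t :* t :* (m :* m :+ m :* m :* m :* (P :* t))))
          (modulo₁ (m * (ι 1 - u * u * (m * m))) (Unit-inverse (Unit-quadratic Zt r<p i i<r))
          (modulo₁ (d * (u * u * m * (m * n + ι 1) + u * u * u * m * m - (n + u))) (Unit-inverse un)
            (solve 5 (λ n m P t d → let u = P :* t in
              (n :+ u) :* d :- m :* (κ 1 :- u :* u :* (m :* m))
                := P :* P :* P :* (d :* (t :* t :* t :* (m :* m :+ m :* m :* m :* u)))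
                   :+ m :* (κ 1 :- u :* u :* (m :* m)) :* ((n :* n :+ n :* u :+ u :* u) :* d :- κ 1)
                   :+ d :* (u :* u :* m :* (m :* n :+ κ 1) :+ u :* u :* u :* m :* m :- (n :+ u)) :* (n :* m :- κ 1)) n m P t d)))
          where
          n = ι (suc i)
          m = inv n
          d = inv (n * n + n * u + u * u)
          un = Unit-index Zt r<p i i<r
          Zd : Z d
          Zd = Z-inv (Unit-quadratic Zt r<p i i<r)

        lower-product : WZ.lower u r ≈ prod r (λ i → inv (ι (suc i))) * (ι 1 - u * u * harmonic₂ r) [ P³ ]
        lower-product = ≈-trans
          (≈-prod r lower-factor
            (λ i i<r → Z-* (Z-+ (Z-ℕ (suc i)) (Z-* ZP Zt)) (Z-inv (Unit-quadratic Zt r<p i i<r)))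
            (λ i i<r → Z-* (Zm i i<r) (Z-solve (ZP ∷ Zt ∷ Zm i i<r ∷ []) λ P t m → κ 1 :- P :* t :* (P :* t) :* (m :* m))))
          (≈-trans (≡⇒≈ (prod-* r (λ i → inv (ι (suc i))) (λ i → ι 1 - u * u * (inv (ι (suc i)) * inv (ι (suc i))))))
            (≈-*ˡ (Z-prod r Zm) (lower-expansion r Zm)))
          where
          Zm : ∀ i → i < r → Z (inv (ι (suc i)))
          Zm i i<r = Z-inv (Unit-index Zt r<p i i<r)

        module _ (2r<p : 2 ℕ.* r < p) where

          private
            x b : ℕ → ℚ
            x i = ι (r ℕ.+ suc i)
            b i = inv (x i)
            H₁ H₂ E F K D : ℚ
            H₁ = harmonic (2 ℕ.* r)
            H₂ = harmonic r
            E = harmonic₂ (2 ℕ.* r)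
            F = harmonic₂ r
            K = ι ((2 ℕ.* r) choose r)
            D = H₁ - H₂

          Unit-x : ∀ i → i < r → Unit (x i)
          Unit-x i i<r rewrite ℕP.+-suc r i = Unit-suc (ℕP.≤-<-trans (subst (ℕ._≤ 2 ℕ.* r) (ℕP.+-suc r i) (ℕP.+-monoʳ-≤ r (ℕP.≤-trans i<r (ℕP.m≤m+n r 0)))) 2r<p)

          upper-product : WZ.upper u r ≈ prod r x * (ι 1 + ι 2 * u * sum r b + ι 2 * (u * u) * (sum r b * sum r b - sum r (λ i → b i * b i))) [ P³ ]
          upper-product = ≈-trans (≡⇒≈ (trans (prod-cong r factor) (prod-* r x (λ i → ι 1 + ι 2 * u * b i))))
            (≈-*ˡ (Z-prod r (λ i i<r → Z-ℕ (r ℕ.+ suc i))) (upper-expansion r (λ i i<r → Z-inv (Unit-x i i<r))))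
            where
            factor : ∀ i → i < r → ι r + ι (suc i) + ι 2 * u ≡ x i * (ι 1 + ι 2 * u * b i)
            factor i i<r = trans (cong (_+ ι 2 * u) (sym (ι-+ r (suc i))))
              (modulo₁ (- (ι 2 * u)) (Unit-inverse (Unit-x i i<r))
                (solve 3 (λ x b u → x :+ κ 2 :* u := x :* (κ 1 :+ κ 2 :* u :* b) :+ :- (κ 2 :* u) :* (x :* b :- κ 1)) (x i) (b i) u))

          2r≡r+r : 2 ℕ.* r ≡ r ℕ.+ r
          2r≡r+r = cong (r ℕ.+_) (ℕP.+-identityʳ r)

          second-half : ∀ (f : ℕ → ℚ) → sum r (λ i → f (r ℕ.+ suc i)) ≡ sum (2 ℕ.* r) (λ i → f (suc i)) - sum r (λ i → f (suc i))
          second-half f = begin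
            sum r (λ i → f (r ℕ.+ suc i))          ≡⟨ sum-cong r (λ i _ → cong f (ℕP.+-suc r i)) ⟩
            sum r (λ i → f (suc (r ℕ.+ i)))        ≡⟨ solve 2 (λ x y → y := x :+ y :- x) (sum r (λ i → f (suc i))) _ ⟩
            sum r (λ i → f (suc i)) + sum r (λ i → f (suc (r ℕ.+ i))) - sum r (λ i → f (suc i))
              ≡⟨ cong (_- sum r (λ i → f (suc i))) (sym (sum-+ r r (λ i → f (suc i)))) ⟩
            sum (r ℕ.+ r) (λ i → f (suc i)) - sum r (λ i → f (suc i))
              ≡⟨ cong (λ n → sum n (λ i → f (suc i)) - sum r (λ i → f (suc i))) (sym 2r≡r+r) ⟩
            sum (2 ℕ.* r) (λ i → f (suc i)) - sum r (λ i → f (suc i)) ∎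
            where open ≡-Reasoning

          leading-product : prod r x * prod r (λ i → inv (ι (suc i))) ≡ K
          leading-product = *-cancelˡ {c = f * f} {i = g * g}
            (modulo₁ (f * g + ι 1) f-inverse (solve 2 (λ f g → f :* f :* (g :* g) := κ 1 :+ (f :* g :+ κ 1) :* (f :* g :- κ 1)) f g))
            (begin
              f * f * (X * g)      ≡⟨ solve 3 (λ f X g → f :* f :* (X :* g) := f :* X :* (f :* g)) f X g ⟩
              f * X * (f * g)      ≡⟨ cong₂ _*_ (sym split) f-inverse ⟩
              fact (2 ℕ.* r) * ι 1 ≡⟨ *-identityʳ _ ⟩
              fact (2 ℕ.* r)       ≡⟨ sym (central-binomial r) ⟩
              K * (f * f)          ≡⟨ *-comm K (f * f) ⟩
              f * f * K            ∎)
            where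
            open ≡-Reasoning
            f = fact r
            g = prod r (λ i → inv (ι (suc i)))
            X = prod r x
            f-inverse : f * g ≡ ι 1
            f-inverse = prod-inverse r (λ i → ι (suc i)) (λ i i<r → Unit-inverse (Unit-index Zt r<p i i<r))
            split : fact (2 ℕ.* r) ≡ f * X
            split = trans (cong fact 2r≡r+r) (trans (prod-+ r r (λ i → ι (suc i)))
              (cong (f *_) (prod-cong r (λ i _ → cong ι (sym (ℕP.+-suc r i))))))

          -- The prefactor u = P t supplies one power of p, so both products are needed only modulo
          -- p³. Their leading terms combine to Π (r+j)/j, the central binomial coefficient.
          first-case : sum p (λ k → (ι r + u - ι (2 ℕ.* k)) * binomial (ι r + u) k ^ 4)
            ≈ firstExpansion P t ((- ι 1) ^ r) K D E F [ P⁴ ]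
          first-case = ≈-trans (quartic-reduction Zt r<p) (≈-trans
            (≈-mod (solve 1 (λ P → P :* (P :* P :* P) := P :* P :* P :* P) P)
              (≈-trans (≡⇒≈ (solve 5 (λ σ P t U L → σ :* (P :* t) :* (U :* L) := P :* (σ :* t :* (U :* L))) σ P t (WZ.upper u r) (WZ.lower u r)))
              (≈-scale P (≈-*ˡ (Z-* (Z-^ r (Z-neg (Z-ℕ 1))) Zt) (≈-trans products expanded)))))
            (≡⇒≈ (solve 7 (λ P σ t K D E F → P :* (σ :* t :* (K :* :target P t D E F)) := t :* P :* σ :* K :* :target P t D E F) P σ t K D E F)))
            where
            σ = (- ι 1) ^ r
            target : ℚ
            target = ι 1 + ι 2 * t * P * D + t * t * (P * P) * (ι 2 * D * D - ι 2 * E + F)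
            :target : ∀ {n} → Polynomial n → Polynomial n → Polynomial n → Polynomial n → Polynomial n → Polynomial n
            :target P t D E F = κ 1 :+ κ 2 :* t :* P :* D :+ t :* t :* (P :* P) :* (κ 2 :* D :* D :- κ 2 :* E :+ F)
            X g A B : ℚ
            X = prod r x
            g = prod r (λ i → inv (ι (suc i)))
            A = ι 1 + ι 2 * u * D + ι 2 * (u * u) * (D * D - (E - F))
            B = ι 1 - u * u * F
            Zm : ∀ i → i < r → Z (inv (ι (suc i)))
            Zm i i<r = Z-inv (Unit-index Zt r<p i i<r)
            Zm₂ : ∀ i → i < 2 ℕ.* r → Z (inv (ι (suc i)))
            Zm₂ i i<r = Z-inv (Unit-suc (ℕP.≤-<-trans i<r 2r<p))
            ZX : Z X
            ZX = Z-prod r (λ i i<r → Z-ℕ (r ℕ.+ suc i))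
            zs : All Z (P ∷ t ∷ D ∷ E ∷ F ∷ [])
            zs = ZP ∷ Zt ∷ Z-+ (Z-sum (2 ℕ.* r) Zm₂) (Z-neg (Z-sum r Zm))
              ∷ Z-sum (2 ℕ.* r) (λ i i<r → Z-* (Zm₂ i i<r) (Zm₂ i i<r)) ∷ Z-sum r (λ i i<r → Z-* (Zm i i<r) (Zm i i<r)) ∷ []
            ZA : Z A
            ZA = Z-solve zs (λ P t D E F → let u = P :* t in κ 1 :+ κ 2 :* u :* D :+ κ 2 :* (u :* u) :* (D :* D :- (E :- F)))
            upper≈ : WZ.upper u r ≈ X * A [ P³ ]
            upper≈ = ≈-trans upper-product (≡⇒≈ (cong₂ (λ B₁ B₂ → X * (ι 1 + ι 2 * u * B₁ + ι 2 * (u * u) * (B₁ * B₁ - B₂)))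
              (second-half (λ n → inv (ι n))) (second-half (λ n → inv (ι n) * inv (ι n)))))
            Zlower : Z (WZ.lower u r)
            Zlower = Z-prod r (λ i i<r → Z-* (Z-+ (Z-ℕ (suc i)) (Z-* ZP Zt)) (Z-inv (Unit-quadratic Zt r<p i i<r)))
            products : WZ.upper u r * WZ.lower u r ≈ K * (A * B) [ P³ ]
            products = ≈-trans (≈-* (Z-* ZX ZA) Zlower upper≈ lower-product)
              (≡⇒≈ (trans (solve 4 (λ X A g B → X :* A :* (g :* B) := X :* g :* (A :* B)) X A g B) (cong (_* (A * B)) leading-product)))
            -- In order u² the upper product contributes 2(D² - (E - F)) and the lower one -F,
            -- together 2D² - 2E + F.
            expanded : K * (A * B) ≈ K * target [ P³ ]
            expanded = ≈-*ˡ (Z-ℕ ((2 ℕ.* r) choose r)) (≈-solve zs λ P t D E F → let u = P :* t in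
              ((κ 1 :+ κ 2 :* u :* D :+ κ 2 :* (u :* u) :* (D :* D :- (E :- F))) :* (κ 1 :- u :* u :* F) , :target P t D E F)
              , (P :* P :* P , :- (t :* t :* t :* F :* (κ 2 :* D :+ κ 2 :* u :* (D :* D :- (E :- F))))))

    -- First-order calculus modulo p²

    ≈-sum : ∀ n {f g m} → (∀ i → i < n → f i ≈ g i [ m ]) → sum n f ≈ sum n g [ m ]
    ≈-sum zero    f≈g = ≡⇒≈ refl
    ≈-sum (suc n) f≈g = ≈-+ (≈-sum n (λ i i<n → f≈g i (ℕP.m<n⇒m<1+n i<n))) (f≈g n ℕP.≤-refl)

    -- Integrality of both sides is carried along because the product rule for congruences uses a
    -- p-integral factor from each side.
    record Congruent (m x y : ℚ) : Set where
      constructor congruent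
      field
        Zˡ     : Z x
        Zʳ     : Z y
        relate : x ≈ y [ m ]

    open Congruent

    fixed : ∀ {m x} → Z x → Congruent m x x
    fixed zx = congruent zx zx (≡⇒≈ refl)

    ≈-polynomial : ∀ {n m} (e : Polynomial n) {ρ ρ′ : Vec ℚ n} → Pointwise (Congruent m) ρ ρ′ → Congruent m (⟦ e ⟧ ρ) (⟦ e ⟧ ρ′)
    ≈-polynomial (op [+] e f) cs = let c = ≈-polynomial e cs ; d = ≈-polynomial f cs in
      congruent (Z-+ (Zˡ c) (Zˡ d)) (Z-+ (Zʳ c) (Zʳ d)) (≈-+ (relate c) (relate d))
    ≈-polynomial (op [*] e f) cs = let c = ≈-polynomial e cs ; d = ≈-polynomial f cs in
      congruent (Z-* (Zˡ c) (Zˡ d)) (Z-* (Zʳ c) (Zʳ d)) (≈-* (Zʳ c) (Zˡ d) (relate c) (relate d))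
    ≈-polynomial (con c)      cs = fixed (Z-⟪⟫ c)
    ≈-polynomial (var x)      cs = Pointwise.lookup cs x
    ≈-polynomial (:- e) {ρ} {ρ′} cs = let c = ≈-polynomial e cs in
      congruent (Z-neg (Zˡ c)) (Z-neg (Zʳ c))
        (≈-trans (≡⇒≈ (negate (⟦ e ⟧ ρ))) (≈-trans (≈-*ˡ (Z-neg (Z-ℕ 1)) (relate c)) (≡⇒≈ (sym (negate (⟦ e ⟧ ρ′))))))
      where
      negate : ∀ x → - x ≡ - ι 1 * x
      negate = solve 1 λ x → :- x := :- κ 1 :* x
    ≈-polynomial (e :^ zero)  cs = fixed (Z-ℕ 1)
    ≈-polynomial (e :^ suc n) cs = let c = ≈-polynomial e cs ; d = ≈-polynomial (e :^ n) cs in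
      congruent (Z-* (Zˡ c) (Zˡ d)) (Z-* (Zʳ c) (Zʳ d)) (≈-* (Zʳ c) (Zˡ d) (relate c) (relate d))

    ≈-substitute : ∀ {n m} {ρ ρ′ : Vec ℚ n} → Pointwise (Congruent m) ρ ρ′ →
      (f : N-ary n (Polynomial n) (Polynomial n)) → ⟦ close n f ⟧ ρ ≈ ⟦ close n f ⟧ ρ′ [ m ]
    ≈-substitute cs f = relate (≈-polynomial (close _ f) cs)

    -- The exponential of P x to first order: modulo P² it turns sums into products, so corrections
    -- are compared by adding their exponents modulo P.
    lin : ℚ → ℚ
    lin x = ι 1 + P * x

    Z-lin : ∀ {x} → Z x → Z (lin x)
    Z-lin zx = Z-+ (Z-ℕ 1) (Z-* ZP zx)

    Unit-lin : ∀ {x} → Z x → Unit (lin x)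
    Unit-lin zx = Unit-shift (Unit-ι p∤1) zx

    lin-cong : ∀ {x y} → x ≈ y [ P ] → lin x ≈ lin y [ P² ]
    lin-cong x≈y = ≈-+ (≡⇒≈ refl) (≈-scale P x≈y)

    lin-* : ∀ {x y} → Z x → Z y → lin x * lin y ≈ lin (x + y) [ P² ]
    lin-* zx zy = ≈-solve (ZP ∷ zx ∷ zy ∷ []) λ P x y →
      ((κ 1 :+ P :* x) :* (κ 1 :+ P :* y) , κ 1 :+ P :* (x :+ y)) , (P :* P , x :* y)

    Z-harmonic : ∀ {n} → n < p → Z (harmonic n)
    Z-harmonic {n} n<p = Z-sum n (λ i i<n → Z-inv (Unit-suc (ℕP.≤-<-trans i<n n<p)))

    Z-fact : ∀ n → Z (fact n)
    Z-fact n = Z-prod n (λ i _ → Z-ℕ (suc i))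

    Unit-prod : ∀ n {f} → (∀ i → i < n → Unit (f i)) → Unit (prod n f)
    Unit-prod zero    uf = Unit-ι p∤1
    Unit-prod (suc n) uf = Unit-* (Unit-prod n (λ i i<n → uf i (ℕP.m<n⇒m<1+n i<n))) (uf n ℕP.≤-refl)

    Unit-fact : ∀ {n} → n < p → Unit (fact n)
    Unit-fact {n} n<p = Unit-prod n (λ i i<n → Unit-suc (ℕP.≤-<-trans i<n n<p))

    -- Each factor s + P ω is s times `lin (ω / s)`; the exponents add up to a harmonic number.
    rising : ∀ {ω} → Z ω → ∀ n → n < p → prod n (λ i → P * ω + ι (suc i)) ≈ fact n * lin (ω * harmonic n) [ P² ]
    rising {ω} zω zero    _   = ≡⇒≈ (solve 2 (λ P ω → κ 1 := κ 1 :* (κ 1 :+ P :* (ω :* κ 0))) P ω)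
    rising {ω} zω (suc n) n<p = ≈-trans
      (≈-* (Z-* (Z-fact n) (Z-lin (Z-* zω zH))) (Z-+ (Z-* ZP zω) (Z-ℕ (suc n))) (rising zω n n<p′) (≡⇒≈ factor))
      (≈-trans (≡⇒≈ (solve 4 (λ F L s l → F :* L :* (s :* l) := F :* s :* (L :* l)) (fact n) (lin (ω * harmonic n)) s (lin (ω * i))))
      (≈-*ˡ (Z-fact (suc n)) (≈-trans (lin-* (Z-* zω zH) (Z-* zω zi))
        (≡⇒≈ (cong lin (solve 3 (λ ω H i → ω :* H :+ ω :* i := ω :* (H :+ i)) ω (harmonic n) i))))))
      where
      s = ι (suc n)
      i = inv s
      n<p′ = ℕP.<-trans (ℕP.n<1+n n) n<p
      zH = Z-harmonic n<p′
      zi = Z-inv (Unit-suc n<p)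
      factor : P * ω + s ≡ s * lin (ω * i)
      factor = modulo₁ (- (P * ω)) (Unit-inverse (Unit-suc n<p))
        (solve 4 (λ P ω s i → P :* ω :+ s := s :* (κ 1 :+ P :* (ω :* i)) :+ :- (P :* ω) :* (s :* i :- κ 1)) P ω s i)

    -- For a product that ends just below P ω. Read from the top, its factors are P ω - 1, P ω - 2,
    -- ..., hence the sign and the change of ω to -ω.
    reversed-rising : ∀ {ω y} → Z ω → ∀ n → n < p → y + ι (suc n) ≡ P * ω →
      prod n (λ i → y + ι (suc i)) ≈ (- ι 1) ^ n * (fact n * lin (- ω * harmonic n)) [ P² ]
    reversed-rising {ω} {y} zω n n<p y+n≡ = ≈-trans (≡⇒≈ (begin
      prod n (λ i → y + ι (suc i))                       ≡⟨ prod-reverse (λ x → x) n y ⟩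
      prod n (λ i → y + ι (suc n) - ι (suc i))           ≡⟨ prod-cong n (λ i _ → trans (cong (_- ι (suc i)) y+n≡)
        (solve 3 (λ P ω s → P :* ω :- s := :- κ 1 :* (P :* :- ω :+ s)) P ω (ι (suc i)))) ⟩
      prod n (λ i → - ι 1 * (P * - ω + ι (suc i)))       ≡⟨ prod-scale n (- ι 1) (λ i → P * - ω + ι (suc i)) ⟩
      (- ι 1) ^ n * prod n (λ i → P * - ω + ι (suc i))   ∎))
      (≈-*ˡ (Z-^ n (Z-neg (Z-ℕ 1))) (rising (Z-neg zω) n n<p))
      where open ≡-Reasoning

    Unit-neg1 : Unit (- ι 1)
    Unit-neg1 = mkUnit {den = 1} {num = ℤ.- (ℤ.+ 1)} p∤1 p∤1 (*-identityʳ (- ι 1))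

    Unit-^ : ∀ {x} l → Unit x → Unit (x ^ l)
    Unit-^ zero    ux = Unit-ι p∤1
    Unit-^ (suc l) ux = Unit-* ux (Unit-^ l ux)

    -- Residues above p/2: here p = 2h + 1, r = h + m with m = m′ + 1, and n = p - 1 - r.
    module Second {t : ℚ} (Zt : Z t) {h n m′ r : ℕ} (p≡ : p ≡ suc (h ℕ.+ h)) (r≡ : r ≡ h ℕ.+ suc m′) (h≡ : n ℕ.+ suc m′ ≡ h) where

      private
        m k : ℕ
        m = suc m′
        -- This is 2m - 1 without truncated subtraction; `suc k` computes to `m ℕ.+ m`.
        k = m′ ℕ.+ m
        u ω a half : ℚ
        u = P * t
        ω = ι 2 * t + ι 1
        a = ι r + u
        half = inv (ι 2)

      P≡ : P ≡ ι 1 + ι 2 * ι h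
      P≡ = trans (cong ι p≡) (trans (ι-suc (h ℕ.+ h)) (trans (cong (λ x → ι 1 + x) (ι-+ h h)) (solve 1 (λ h → κ 1 :+ (h :+ h) := κ 1 :+ κ 2 :* h) (ι h))))

      ιn≡ : ι (suc n) ≡ ι 1 + (ι h - ι m)
      ιn≡ = trans (ι-suc n) (cong (λ x → ι 1 + x)
        (trans (solve 2 (λ n m → n := n :+ m :- m) (ι n) (ι m)) (cong (_- ι m) (trans (sym (ι-+ n m)) (cong ι h≡)))))

      ιr≡ : ι r ≡ ι h + ι m
      ιr≡ = trans (cong ι r≡) (ι-+ h m)

      2h<p : h ℕ.+ h < p
      2h<p = ℕP.≤-reflexive (sym p≡)

      h<p : h < p
      h<p = ℕP.≤-<-trans (ℕP.m≤m+n h h) 2h<p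

      m≤h : m ℕ.≤ h
      m≤h = ℕP.m+n≤o⇒n≤o n (ℕP.≤-reflexive h≡)

      n≤h : n ℕ.≤ h
      n≤h = ℕP.m+n≤o⇒m≤o n (ℕP.≤-reflexive h≡)

      r<p : r < p
      r<p = subst (_< p) (sym r≡) (ℕP.≤-<-trans (ℕP.+-monoʳ-≤ h m≤h) 2h<p)

      2m<p : m ℕ.+ m < p
      2m<p = ℕP.≤-<-trans (ℕP.+-mono-≤ m≤h m≤h) 2h<p

      n<p : n < p
      n<p = ℕP.≤-<-trans n≤h h<p

      m<p : m < p
      m<p = ℕP.≤-<-trans m≤h h<p

      2<p : 2 < p
      2<p = subst (2 <_) (sym p≡) (ℕ.s≤s (ℕP.+-mono-≤ 1≤h 1≤h))
        where
        1≤h : 1 ℕ.≤ h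
        1≤h = ℕP.≤-trans (ℕ.s≤s ℕ.z≤n) m≤h

      half-inverse : ι 2 * half ≡ ι 1
      half-inverse = *-inv (ι-suc≢0 1)

      Zhalf : Z half
      Zhalf = Z-inv (Unit-suc 2<p)

      Zω : Z ω
      Zω = Z-+ (Z-* (Z-ℕ 2) Zt) (Z-ℕ 1)

      oddₙ : ℕ → ℕ → ℚ
      oddₙ j n = prod n (λ i → odd (j ℕ.+ i))

      odd-linear : ∀ j i → odd (j ℕ.+ i) ≡ ι 2 * (ι j + ι (suc i)) - ι 1
      odd-linear j i = begin
        ι (suc (j ℕ.+ i ℕ.+ (j ℕ.+ i)))        ≡⟨ ι-suc (j ℕ.+ i ℕ.+ (j ℕ.+ i)) ⟩
        ι 1 + ι (j ℕ.+ i ℕ.+ (j ℕ.+ i))        ≡⟨ cong (λ x → ι 1 + x) (trans (ι-+ (j ℕ.+ i) (j ℕ.+ i)) (cong (λ x → x + x) (ι-+ j i))) ⟩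
        ι 1 + (ι j + ι i + (ι j + ι i))        ≡⟨ solve 2 (λ j i → κ 1 :+ (j :+ i :+ (j :+ i)) := κ 2 :* (j :+ (κ 1 :+ i)) :- κ 1) (ι j) (ι i) ⟩
        ι 2 * (ι j + (ι 1 + ι i)) - ι 1        ≡⟨ cong (λ x → ι 2 * (ι j + x) - ι 1) (sym (ι-suc i)) ⟩
        ι 2 * (ι j + ι (suc i)) - ι 1          ∎
        where open ≡-Reasoning

      odd-reflection : ∀ j l → j ℕ.+ l ≡ h → ∀ i → ι 2 * (ι j + ι (suc l) - ι (suc i)) - ι 1 ≡ P - ι 2 * ι (suc i)
      odd-reflection j l j+l≡h i = trans (cong (λ x → ι 2 * (x - ι (suc i)) - ι 1)
          (trans (sym (ι-+ j (suc l))) (trans (cong ι (trans (ℕP.+-suc j l) (cong suc j+l≡h))) (ι-suc h))))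
        (trans (solve 2 (λ h s → κ 2 :* (κ 1 :+ h :- s) :- κ 1 := κ 1 :+ κ 2 :* h :- κ 2 :* s) (ι h) (ι (suc i)))
          (cong (_- ι 2 * ι (suc i)) (sym P≡)))

      -- With j + l = h these are the l largest odd numbers below p, namely p - 2s for s = 1, ...,
      -- l. Taking -2 out of each leaves s - p/2.
      odd-product : ∀ j l → j ℕ.+ l ≡ h → oddₙ j l ≈ ι 2 ^ l * ((- ι 1) ^ l * (fact l * lin (- half * harmonic l))) [ P² ]
      odd-product j l j+l≡h = ≈-trans (≡⇒≈ (begin
        oddₙ j l                                                      ≡⟨ prod-cong l (λ i _ → odd-linear j i) ⟩
        prod l (λ i → ι 2 * (ι j + ι (suc i)) - ι 1)                  ≡⟨ prod-reverse (λ x → ι 2 * x - ι 1) l (ι j) ⟩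
        prod l (λ i → ι 2 * (ι j + ι (suc l) - ι (suc i)) - ι 1)      ≡⟨ prod-cong l (λ i _ → trans (odd-reflection j l j+l≡h i) (factor (ι (suc i)))) ⟩
        prod l (λ i → ι 2 * (- ι 1 * (P * - half + ι (suc i))))       ≡⟨ prod-scale l (ι 2) (λ i → - ι 1 * (P * - half + ι (suc i))) ⟩
        ι 2 ^ l * prod l (λ i → - ι 1 * (P * - half + ι (suc i)))     ≡⟨ cong (ι 2 ^ l *_) (prod-scale l (- ι 1) (λ i → P * - half + ι (suc i))) ⟩
        ι 2 ^ l * ((- ι 1) ^ l * prod l (λ i → P * - half + ι (suc i))) ∎))
        (≈-*ˡ (Z-^ l (Z-ℕ 2)) (≈-*ˡ (Z-^ l (Z-neg (Z-ℕ 1))) (rising (Z-neg Zhalf) l l<p)))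
        where
        open ≡-Reasoning
        l<p = ℕP.≤-<-trans (ℕP.m+n≤o⇒n≤o j (ℕP.≤-reflexive j+l≡h)) h<p
        factor : ∀ s → P - ι 2 * s ≡ ι 2 * (- ι 1 * (P * - half + s))
        factor s = modulo₁ (- P) half-inverse
          (solve 3 (λ P h s → P :- κ 2 :* s := κ 2 :* (:- κ 1 :* (P :* :- h :+ s)) :+ :- P :* (κ 2 :* h :- κ 1)) P half s)

      odd-harmonic : ∀ j l → j ℕ.+ l ≡ h → sum l (λ i → inv (odd (j ℕ.+ i))) ≈ - half * harmonic l [ P ]
      odd-harmonic j l j+l≡h = ≈-trans (≡⇒≈ (begin
        sum l (λ i → inv (odd (j ℕ.+ i)))                                   ≡⟨ sum-cong l (λ i _ → cong inv (odd-linear j i)) ⟩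
        sum l (λ i → inv (ι 2 * (ι j + ι (suc i)) - ι 1))                   ≡⟨ sum-reverse (λ x → inv (ι 2 * x - ι 1)) l (ι j) ⟩
        sum l (λ i → inv (ι 2 * (ι j + ι (suc l) - ι (suc i)) - ι 1))       ≡⟨ sum-cong l (λ i _ → cong inv (odd-reflection j l j+l≡h i)) ⟩
        sum l (λ i → inv (P - ι 2 * ι (suc i)))                             ∎))
        (≈-trans (≈-sum l inverses) (≡⇒≈ (sum-scale l (- half) (λ i → inv (ι (suc i))))))
        where
        open ≡-Reasoning
        l<p = ℕP.≤-<-trans (ℕP.m+n≤o⇒n≤o j (ℕP.≤-reflexive j+l≡h)) h<p
        inverses : ∀ i → i < l → inv (P - ι 2 * ι (suc i)) ≈ - half * inv (ι (suc i)) [ P ]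
        inverses i i<l = ≈-trans (≈-inv (Unit-≈ u2s near) u2s near) (≡⇒≈ (inv-unique
            (modulo₂ (s * j′) (ι 1) half-inverse (Unit-inverse us)
              (solve 3 (λ s h j → :- κ 2 :* s :* (:- h :* j) := κ 1 :+ s :* j :* (κ 2 :* h :- κ 1) :+ κ 1 :* (s :* j :- κ 1)) s half j′))))
          where
          s = ι (suc i)
          j′ = inv s
          us = Unit-suc (ℕP.≤-<-trans i<l l<p)
          u2s : Unit (- ι 2 * s)
          u2s = Unit-* (subst Unit (solve 0 (:- κ 1 :* κ 2 := :- κ 2)) (Unit-* Unit-neg1 (Unit-suc 2<p))) us
          near : P - ι 2 * s ≈ - ι 2 * s [ P ]
          near = mk≈ (Z-ℕ 1) (solve 2 (λ P s → P :- κ 2 :* s :- :- κ 2 :* s := P :* κ 1) P s)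

      private
        A hₙ hₘ hₕ : ℚ
        A = ι 2 * a + ι 1
        hₙ = harmonic n
        hₘ = harmonic m′
        hₕ = harmonic h

      -- Thus 2a + 1 is the factor that follows those of `Y`: multiplying by `A` completes `Y` to
      -- `Y₂`. This is the origin of the denominator 2a + 1 in the theorem.
      A≡ : A ≡ P * ω + ι (m ℕ.+ m)
      A≡ = trans (cong (λ x → ι 2 * (x + u) + ι 1) ιr≡)
        (trans (modulo₁ (- ι 1) P≡ (solve 4 (λ h m P t → κ 2 :* (h :+ m :+ P :* t) :+ κ 1 := P :* (κ 2 :* t :+ κ 1) :+ (m :+ m) :+ :- κ 1 :* (P :- (κ 1 :+ κ 2 :* h))) (ι h) (ι m) P t))
          (cong (λ x → P * ω + x) (sym (ι-+ m m))))

      Unit-2m : Unit (ι (m ℕ.+ m))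
      Unit-2m = Unit-suc 2m<p

      A≈2m : A ≈ ι (m ℕ.+ m) [ P ]
      A≈2m = mk≈ Zω (trans (cong (_- ι (m ℕ.+ m)) A≡) (solve 2 (λ x y → x :+ y :- y := x) (P * ω) (ι (m ℕ.+ m))))

      Unit-A : Unit A
      Unit-A = Unit-≈ Unit-2m A≈2m

      -- The odd part of the sum is the full odd sum up to p - 2 minus its n topmost terms, and both
      -- are reflected by `odd-harmonic`. In the even part, the last term 1/(2m) is congruent to
      -- 1/A.
      harmonic-congruence : harmonic (m ℕ.+ m) ≈ half * hₙ + inv A - half * hₕ + half * hₘ [ P ]
      harmonic-congruence = ≈-trans (≡⇒≈ (begin
          harmonic (m ℕ.+ m)                               ≡⟨ harmonic-double m ⟩
          half * (hₘ + inv (ι m)) + B                      ≡⟨ solve 5 (λ h H i B b → h :* (H :+ i) :+ B := h :* H :+ h :* i :+ (B :+ b) :- b) half hₘ (inv (ι m)) B b ⟩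
          half * hₘ + half * inv (ι m) + (B + b) - b       ≡⟨ cong₂ (λ x y → half * hₘ + x + y - b) half-m (trans (sym (sum-+ m n (λ i → inv (odd i)))) (cong (λ l → sum l (λ i → inv (odd i))) (trans (ℕP.+-comm m n) h≡))) ⟩
          half * hₘ + inv (ι (m ℕ.+ m)) + sum h (λ i → inv (odd i)) - b ∎))
        (≈-trans (≈-+ (≈-+ (≈-+ (≡⇒≈ refl) (≈-sym (≈-inv Unit-A Unit-2m A≈2m))) (odd-harmonic 0 h refl))
            (≈-trans (≡⇒≈ (negate b)) (≈-*ˡ (Z-neg (Z-ℕ 1)) (odd-harmonic m n (trans (ℕP.+-comm m n) h≡)))))
          (≡⇒≈ (solve 5 (λ h Hm Hh Hn i → h :* Hm :+ i :+ :- h :* Hh :+ :- κ 1 :* (:- h :* Hn) := h :* Hn :+ i :- h :* Hh :+ h :* Hm) half hₘ hₕ hₙ (inv A))))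
        where
        open ≡-Reasoning
        B = sum m (λ i → inv (odd i))
        b = sum n (λ i → inv (odd (m ℕ.+ i)))
        negate : ∀ x → - x ≡ - ι 1 * x
        negate = solve 1 λ x → :- x := :- κ 1 :* x
        half-m : half * inv (ι m) ≡ inv (ι (m ℕ.+ m))
        half-m = sym (inv-unique (trans (cong (_* (half * inv (ι m))) (ι-+ m m))
          (modulo₂ (ι m * inv (ι m)) (ι 1) half-inverse (*-inv (ι-suc≢0 m′))
            (solve 3 (λ x h i → (x :+ x) :* (h :* i) := κ 1 :+ x :* i :* (κ 2 :* h :- κ 1) :+ κ 1 :* (x :* i :- κ 1)) (ι m) half (inv (ι m))))))

      -- Evaluation modulo p² of the factors of the product

      private
        T N M σ τ s X X′ Xₕ Y Y₂ Lₙ Lₕ K : ℚ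
        T  = ι 2 ^ h
        N  = ι 2 ^ n
        M  = ι 2 ^ m
        σ  = (- ι 1) ^ n
        τ  = (- ι 1) ^ h
        s  = (- ι 1) ^ r
        X  = prod n (λ i → ι r + ι (suc i) + ι 2 * u)
        X′ = prod n (λ i → ι r + ι (suc i))
        Xₕ = prod h (λ i → ι h + ι (suc i))
        Y  = prod k (λ i → P * ω + ι (suc i))
        Y₂ = prod (m ℕ.+ m) (λ i → P * ω + ι (suc i))
        Lₙ = lin (- half * hₙ)
        Lₕ = lin (- half * hₕ)
        K  = ι ((2 ℕ.* m) choose m)

      Zhₙ : Z hₙ
      Zhₙ = Z-harmonic n<p

      Zhₕ : Z hₕ
      Zhₕ = Z-harmonic h<p

      Zhₘ : Z hₘ
      Zhₘ = Z-harmonic (ℕP.<-trans (ℕP.n<1+n m′) m<p)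

      Zh₂ₘ : Z (harmonic (m ℕ.+ m))
      Zh₂ₘ = Z-harmonic 2m<p

      n+2m : ∀ i → ι r + ι (suc (n ℕ.+ i)) + ι 2 * u ≡ P * ω + ι i
      n+2m i = begin
        ι r + ι (suc (n ℕ.+ i)) + ι 2 * u          ≡⟨ cong₂ (λ x y → x + y + ι 2 * u) ιr≡ (ι-+ (suc n) i) ⟩
        ι h + ι m + (ι (suc n) + ι i) + ι 2 * u    ≡⟨ cong (λ x → ι h + ι m + (x + ι i) + ι 2 * u) ιn≡ ⟩
        ι h + ι m + (ι 1 + (ι h - ι m) + ι i) + ι 2 * u
          ≡⟨ modulo₁ (- ι 1) P≡ (solve 5 (λ h m i P t → h :+ m :+ (κ 1 :+ (h :- m) :+ i) :+ κ 2 :* (P :* t)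
               := P :* (κ 2 :* t :+ κ 1) :+ i :+ :- κ 1 :* (P :- (κ 1 :+ κ 2 :* h))) (ι h) (ι m) (ι i) P t) ⟩
        P * ω + ι i                                ∎
        where open ≡-Reasoning

      -- Since r + n + 1 = p, the factor with j = n + 1 is p + 2u = P ω. There are n factors before
      -- it and k = 2m - 1 after it.
      upper-split : WZ.upper u r ≡ X * (P * ω * Y)
      upper-split = begin
        prod r f                                            ≡⟨ cong (λ l → prod l f) r≡n+2m ⟩
        prod (n ℕ.+ suc k) f                                ≡⟨ prod-+ n (suc k) f ⟩
        X * prod (suc k) (λ i → f (n ℕ.+ i))                ≡⟨ cong (X *_) (prod-cong (suc k) (λ i _ → n+2m i)) ⟩
        X * prod (suc k) (λ i → P * ω + ι i)                ≡⟨ cong (X *_) (prod-front k (λ i → P * ω + ι i)) ⟩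
        X * ((P * ω + ι 0) * Y)                             ≡⟨ cong (λ x → X * (x * Y)) (+-identityʳ (P * ω)) ⟩
        X * (P * ω * Y)                                     ∎
        where
        open ≡-Reasoning
        f : ℕ → ℚ
        f i = ι r + ι (suc i) + ι 2 * u
        r≡n+2m : r ≡ n ℕ.+ suc k
        r≡n+2m = trans r≡ (trans (cong (ℕ._+ m) (sym h≡)) (ℕP.+-assoc n m m))

      X≈ : X ≈ σ * (fact n * lin (- ω * hₙ)) [ P² ]
      X≈ = ≈-trans (≡⇒≈ (prod-cong n (λ i _ → solve 3 (λ r s u → r :+ s :+ u := r :+ u :+ s) (ι r) (ι (suc i)) (ι 2 * u))))
        (reversed-rising {y = ι r + ι 2 * u} Zω n n<p
          (trans (solve 3 (λ r u s → r :+ u :+ s := r :+ s :+ u) (ι r) (ι 2 * u) (ι (suc n)))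
            (trans (cong (λ l → ι r + ι (suc l) + ι 2 * u) (sym (ℕP.+-identityʳ n))) (trans (n+2m 0) (+-identityʳ (P * ω))))))

      X′≈ : X′ ≈ σ * (fact n * lin (- ι 1 * hₙ)) [ P² ]
      X′≈ = reversed-rising (Z-ℕ 1) n n<p (trans (cong₂ _+_ ιr≡ ιn≡)
        (modulo₁ (- ι 1) P≡ (solve 3 (λ h m P → h :+ m :+ (κ 1 :+ (h :- m)) := P :* κ 1 :+ :- κ 1 :* (P :- (κ 1 :+ κ 2 :* h))) (ι h) (ι m) P)))

      Xₕ≈ : Xₕ ≈ τ * (fact h * lin (- ι 1 * hₕ)) [ P² ]
      Xₕ≈ = reversed-rising (Z-ℕ 1) h h<p (trans (cong (λ x → ι h + x) (ι-suc h))
        (modulo₁ (- ι 1) P≡ (solve 2 (λ h P → h :+ (κ 1 :+ h) := P :* κ 1 :+ :- κ 1 :* (P :- (κ 1 :+ κ 2 :* h))) (ι h) P)))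

      Y₂≈ : Y₂ ≈ fact (m ℕ.+ m) * lin (ω * harmonic (m ℕ.+ m)) [ P² ]
      Y₂≈ = rising Zω (m ℕ.+ m) 2m<p

      -- Both sides are (p - 1)!, cut after r and after h. This trades r! for quantities depending
      -- on p alone.
      fact-r : fact r * X′ ≡ fact h * Xₕ
      fact-r = trans (sym (fact-+ r n)) (trans (cong fact r+n≡) (fact-+ h h))
        where
        r+n≡ : r ℕ.+ n ≡ h ℕ.+ h
        r+n≡ = trans (cong (ℕ._+ n) r≡) (trans (ℕP.+-assoc h m n) (cong (h ℕ.+_) (trans (ℕP.+-comm m n) h≡)))

      Xₕ≡ : Xₕ ≡ T * prod h odd
      Xₕ≡ = *-cancelˡ (Unit-inverse (Unit-fact h<p)) (trans (sym (fact-+ h h)) (trans (fact-double h)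
        (solve 3 (λ T F O → T :* F :* O := F :* (T :* O)) T (fact h) (prod h odd))))

      ZT : Z T
      ZT = Z-^ h (Z-ℕ 2)

      ZLₕ : Z Lₕ
      ZLₕ = Z-lin (Z-* (Z-neg Zhalf) Zhₕ)

      -- Evaluating (2h)! / h! both as Π (p - s) and as 2ʰ Π (p - 2s) gives 4ʰ ≡ 1 - p Hₕ / 2,
      -- that is, q_p(2) ≡ - Hₕ / 2 (mod p).
      T²≈ : T * T ≈ Lₕ [ P² ]
      T²≈ = ≈-sym (≈-trans (≡⇒≈ (cong lin (modulo₁ (- hₕ) half-inverse
          (solve 2 (λ h H → :- h :* H := h :* H :+ :- κ 1 :* H :+ :- H :* (κ 2 :* h :- κ 1)) half hₕ))))
        (≈-trans (≈-sym (lin-* (Z-* Zhalf Zhₕ) (Z-* (Z-neg (Z-ℕ 1)) Zhₕ)))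
        (≈-trans (≈-*ˡ (Z-lin (Z-* Zhalf Zhₕ)) cancelled)
        (≈-trans (≡⇒≈ (solve 3 (λ L T l → l :* (T :* (T :* L)) := T :* T :* (l :* L)) Lₕ T (lin (half * hₕ))))
        (≈-trans (≈-*ˡ (Z-* ZT ZT) (lin-* (Z-* Zhalf Zhₕ) (Z-* (Z-neg Zhalf) Zhₕ)))
          (≡⇒≈ (solve 4 (λ T P h H → T :* T :* (κ 1 :+ P :* (h :* H :+ :- h :* H)) := T :* T) T P half hₕ)))))))
        where
        cancelled : lin (- ι 1 * hₕ) ≈ T * (T * Lₕ) [ P² ]
        cancelled = ≈-cancelˡ (Unit-* (Unit-^ h Unit-neg1) (Unit-fact h<p))
          (≈-trans (≡⇒≈ (*-assoc τ (fact h) _))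
          (≈-trans (≈-sym Xₕ≈) (≈-trans (≡⇒≈ Xₕ≡) (≈-trans (≈-*ˡ ZT (odd-product 0 h refl))
            (≡⇒≈ (solve 4 (λ T τ F L → T :* (T :* (τ :* (F :* L))) := τ :* F :* (T :* (T :* L))) T τ (fact h) Lₕ))))))

      q ε c : ℚ
      q = (ι (2 ℕ.^ (p ℕ.∸ 1)) - ι 1) * inv P
      c = (ι 2 * t + ι 1) * inv (ι 2 * a + ι 1)
      ε = c + (ι 2 * t - ι 1) * q - (ι 2 * t + ι 1) * inv (ι 2) * (hₙ - hₘ)

      Pq≡ : P * q ≡ T * T - ι 1
      Pq≡ = trans (modulo₁ (ι (2 ℕ.^ (p ℕ.∸ 1)) - ι 1) (*-inv P≢0)
          (solve 3 (λ P i x → P :* (x :* i) := x :+ x :* (P :* i :- κ 1)) P (inv P) (ι (2 ℕ.^ (p ℕ.∸ 1)) - ι 1)))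
        (cong (_- ι 1) (trans (cong (λ l → ι (2 ℕ.^ (l ℕ.∸ 1))) p≡) (trans (ι-^ 2 (h ℕ.+ h)) (^-+ (ι 2) h h))))

      -- Dividing P q = T² - 1 by P costs one power of p. Knowing q modulo P is enough, as it occurs
      -- only inside `lin`.
      q≈ : q ≈ - half * hₕ [ P ]
      q≈ = ≈-unscale P≢0 (≈-trans (≡⇒≈ Pq≡) (≈-trans (≈-+ T²≈ (≡⇒≈ refl))
        (≡⇒≈ (solve 2 (λ P x → κ 1 :+ P :* x :- κ 1 := P :* x) P (- half * hₕ)))))

      Zq : Z q
      Zq = Z-≈ ZP (Z-* (Z-neg Zhalf) Zhₕ) q≈

      Zε : Z ε
      Zε = Z-solve (Zt ∷ Zq ∷ Zhalf ∷ Zhₙ ∷ Zhₘ ∷ Z-inv Unit-A ∷ []) λ t q h Hn Hm i →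
        (κ 2 :* t :+ κ 1) :* i :+ (κ 2 :* t :- κ 1) :* q :- (κ 2 :* t :+ κ 1) :* h :* (Hn :- Hm)

      first-order : lin (- ω * hₙ) * lin (- ι 1 * hₙ) * lin (ω * harmonic (m ℕ.+ m)) ≈ Lₙ * Lₙ * lin (- ι 1 * hₕ) * lin ε [ P² ]
      first-order = ≈-trans (≈-trans (≈-* (Z-lin (Z-+ z₁ z₂)) (Z-lin z₃) (lin-* z₁ z₂) (≡⇒≈ refl)) (lin-* (Z-+ z₁ z₂) z₃))
        (≈-trans (lin-cong exponents) (≈-sym
          (≈-trans (≈-* (Z-lin (Z-+ (Z-+ z₄ z₄) z₅)) (Z-lin Zε)
              (≈-trans (≈-* (Z-lin (Z-+ z₄ z₄)) (Z-lin z₅) (lin-* z₄ z₄) (≡⇒≈ refl)) (lin-* (Z-+ z₄ z₄) z₅)) (≡⇒≈ refl))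
            (lin-* (Z-+ (Z-+ z₄ z₄) z₅) Zε))))
        where
        z₁ = Z-* (Z-neg Zω) Zhₙ
        z₂ = Z-* (Z-neg (Z-ℕ 1)) Zhₙ
        z₃ = Z-* Zω Zh₂ₘ
        z₄ = Z-* (Z-neg Zhalf) Zhₙ
        z₅ = Z-* (Z-neg (Z-ℕ 1)) Zhₕ
        -- Inserting `harmonic-congruence` gives `hₕ` the coefficient -ω/2 = -1 - (2t - 1)/2. The
        -- first part matches the correction of `Xₕ`; by `q≈` the second becomes (2t - 1) q.
        exponents : - ω * hₙ + - ι 1 * hₙ + ω * harmonic (m ℕ.+ m) ≈ - half * hₙ + - half * hₙ + - ι 1 * hₕ + ε [ P ]
        exponents = ≈-trans
          (≈-substitute (congruent Zh₂ₘ (Z-≈ ZP Zh₂ₘ (≈-sym harmonic-congruence)) harmonic-congruence ∷ fixed Zω ∷ fixed Zhₙ ∷ [])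
            (λ H ω Hn → :- ω :* Hn :+ :- κ 1 :* Hn :+ ω :* H))
          (≈-trans (≡⇒≈ (modulo₁ (ω * hₙ + hₙ - hₕ) half-inverse
            (solve 7 (λ t h Hn Hh Hm i q → let ω = κ 2 :* t :+ κ 1 in
              :- ω :* Hn :+ :- κ 1 :* Hn :+ ω :* (h :* Hn :+ i :- h :* Hh :+ h :* Hm)
                := :- h :* Hn :+ :- h :* Hn :+ :- κ 1 :* Hh :+ (ω :* i :+ (κ 2 :* t :- κ 1) :* (:- h :* Hh) :- ω :* h :* (Hn :- Hm))
                   :+ (ω :* Hn :+ Hn :- Hh) :* (κ 2 :* h :- κ 1))
              t half hₙ hₕ hₘ (inv A) q)))
          (≈-substitute (congruent (Z-* (Z-neg Zhalf) Zhₕ) Zq (≈-sym q≈) ∷ fixed Zt ∷ fixed Zhalf ∷ fixed Zhₙ ∷ fixed Zhₕ ∷ fixed Zhₘ ∷ fixed (Z-inv Unit-A) ∷ [])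
            (λ q t h Hn Hh Hm i → let ω = κ 2 :* t :+ κ 1 in
              :- h :* Hn :+ :- h :* Hn :+ :- κ 1 :* Hh :+ (ω :* i :+ (κ 2 :* t :- κ 1) :* q :- ω :* h :* (Hn :- Hm)))))

      -- Clearing denominators and comparing the two sides

      private
        lower I S₁₆ F₂ : ℚ
        lower = WZ.lower u r
        I   = prod r (λ i → inv (ι (suc i)))
        S₁₆ = (- ι 16) ^ r
        F₂  = fact (m ℕ.+ m)

      Unit-index-r : ∀ i → i < r → Unit (ι (suc i))
      Unit-index-r i i<r = Unit-suc (ℕP.≤-<-trans i<r r<p)

      ZI : Z I
      ZI = Z-prod r (λ i i<r → Z-inv (Unit-index-r i i<r))

      Z-lower : Z lower
      Z-lower = Z-prod r (λ i i<r → Z-* (Z-+ (Z-ℕ (suc i)) (Z-* ZP Zt)) (Z-inv (Unit-quadratic Zt r<p i i<r)))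

      -- The expansion of `lower` has no term linear in u, so modulo p² only 1/r! survives.
      lower≈ : lower ≈ I [ P² ]
      lower≈ = ≈-trans (≈-weaken ZP (lower-product Zt r<p))
        (≈-solve (ZP ∷ Zt ∷ ZI ∷ Z-sum r (λ i i<r → Z-* (Z-inv (Unit-index-r i i<r)) (Z-inv (Unit-index-r i i<r))) ∷ [])
          λ P t I H → (I :* (κ 1 :- P :* t :* (P :* t) :* H) , I) , (P :* P , :- (t :* t :* I :* H)))

      I-inverse : fact r * I ≡ ι 1
      I-inverse = prod-inverse r (λ i → ι (suc i)) (λ i i<r → Unit-inverse (Unit-index-r i i<r))

      K-factorials : K * (fact m * fact m) ≡ F₂
      K-factorials = trans (central-binomial m) (cong (λ l → fact (m ℕ.+ l)) (ℕP.+-identityʳ m))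

      Unit-K : Unit K
      Unit-K = subst Unit (trans (cong (_* (inv g * inv g)) (sym K-factorials))
          (modulo₁ (K * (g * inv g + ι 1)) (Unit-inverse (Unit-fact m<p))
            (solve 3 (λ K g i → K :* (g :* g) :* (i :* i) := K :+ K :* (g :* i :+ κ 1) :* (g :* i :- κ 1)) K g (inv g))))
        (Unit-* (Unit-fact 2m<p) (Unit-* (Unit-inv (Unit-fact m<p)) (Unit-inv (Unit-fact m<p))))
        where g = fact m

      T≡ : T ≡ N * M
      T≡ = trans (cong (ι 2 ^_) (sym h≡)) (^-+ (ι 2) n m)

      S₁₆≡ : S₁₆ ≡ s * (T * M * (T * M) * (T * M) * (T * M))
      S₁₆≡ = trans (powers r) (cong (λ x → s * (x * x * x * x)) (trans (cong (ι 2 ^_) r≡) (^-+ (ι 2) h m)))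
        where
        powers : ∀ l → (- ι 16) ^ l ≡ (- ι 1) ^ l * (ι 2 ^ l * ι 2 ^ l * ι 2 ^ l * ι 2 ^ l)
        powers zero    = solve 0 (κ 1 := κ 1 :* (κ 1 :* κ 1 :* κ 1 :* κ 1))
        powers (suc l) = trans (cong (- ι 16 *_) (powers l))
          (solve 2 (λ s T → :- κ 16 :* (s :* (T :* T :* T :* T)) := :- κ 1 :* s :* (κ 2 :* T :* (κ 2 :* T) :* (κ 2 :* T) :* (κ 2 :* T))) ((- ι 1) ^ l) (ι 2 ^ l))

      -- Clears the denominators on both sides and turns X, X′ and Y into products with known expansions.
      multiplier : ℚ
      multiplier = N * N * A * (fact r * X′) * (K * (fact m * fact m)) * (Lₙ * Lₙ)

      Unit-Lₙ : Unit Lₙ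
      Unit-Lₙ = Unit-lin (Z-* (Z-neg Zhalf) Zhₙ)

      Unit-multiplier : Unit multiplier
      Unit-multiplier = Unit-* (Unit-* (Unit-* (Unit-* (Unit-* uN uN) Unit-A)
          (subst Unit (trans (fact-+ h h) (sym fact-r)) (Unit-fact 2h<p)))
          (subst Unit (sym K-factorials) (Unit-fact 2m<p))) (Unit-* Unit-Lₙ Unit-Lₙ)
        where
        uN : Unit N
        uN = Unit-^ n (Unit-suc 2<p)

      Zσ : ∀ l → Z ((- ι 1) ^ l)
      Zσ l = Z-^ l (Z-neg (Z-ℕ 1))

      private
        common : ℚ
        common = s * (M * fact m) * (M * fact m) * (T * (τ * (fact h * (T * T))) * (T * (τ * (fact h * (T * T)))))
                 * (Lₙ * Lₙ * lin (- ι 1 * hₕ) * lin ε)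

      Zε₄ : Z (lin (- ι 1 * hₕ))
      Zε₄ = Z-lin (Z-* (Z-neg (Z-ℕ 1)) Zhₕ)

      ZLₙ : Z Lₙ
      ZLₙ = Unit⇒Z Unit-Lₙ

      Z2^ : ∀ l → Z (ι 2 ^ l)
      Z2^ l = Z-^ l (Z-ℕ 2)

      -- `A` turns `Y` into `Y₂`, `fact r` cancels the 1/r! of `lower`, and `X′` joins `X` as a
      -- second product with n factors. What remains is built from signs, powers of two, factorials
      -- and values of `lin`.
      left-side : multiplier * (s * X * Y * lower) ≈ common [ P² ]
      left-side = ≈-trans (≡⇒≈ collect) (≈-trans substituted (≈-trans (≡⇒≈ regroup) (≈-trans odd-part final)))
        where
        l₁ l₂ l₃ V O₁ : ℚ
        l₁ = lin (- ω * hₙ)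
        l₂ = lin (- ι 1 * hₙ)
        l₃ = lin (ω * harmonic (m ℕ.+ m))
        O₁ = prod m odd
        V  = O₁ * (N * (σ * (fact n * Lₙ)))
        zl₁ = Z-lin (Z-* (Z-neg Zω) Zhₙ)
        zl₂ = Z-lin (Z-* (Z-neg (Z-ℕ 1)) Zhₙ)
        zl₃ = Z-lin (Z-* Zω Zh₂ₘ)
        ZO₁ : Z O₁
        ZO₁ = Z-prod m (λ i _ → Z-ℕ _)
        collect : multiplier * (s * X * Y * lower) ≡ s * X * X′ * Y₂ * (fact r * lower) * F₂ * (N * N) * (Lₙ * Lₙ)
        collect = trans
          (solve 11 (λ N A f X′ K g L s X Y lo → N :* N :* A :* (f :* X′) :* (K :* (g :* g)) :* (L :* L) :* (s :* X :* Y :* lo)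
            := s :* X :* X′ :* (Y :* A) :* (f :* lo) :* (K :* (g :* g)) :* (N :* N) :* (L :* L)) N A (fact r) X′ K (fact m) Lₙ s X Y lower)
          (cong₂ (λ y f → s * X * X′ * y * (fact r * lower) * f * (N * N) * (Lₙ * Lₙ)) (cong (Y *_) A≡) K-factorials)
        substituted : s * X * X′ * Y₂ * (fact r * lower) * F₂ * (N * N) * (Lₙ * Lₙ)
          ≈ s * (σ * (fact n * l₁)) * (σ * (fact n * l₂)) * (F₂ * l₃) * (fact r * I) * F₂ * (N * N) * (Lₙ * Lₙ) [ P² ]
        substituted = ≈-substitute
          (congruent (Z-prod n λ i _ → Z-+ (Z-+ (Z-ℕ r) (Z-ℕ (suc i))) (Z-* (Z-ℕ 2) (Z-* ZP Zt))) (Z-* (Zσ n) (Z-* (Z-fact n) zl₁)) X≈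
           ∷ congruent (Z-prod n λ i _ → Z-+ (Z-ℕ r) (Z-ℕ (suc i))) (Z-* (Zσ n) (Z-* (Z-fact n) zl₂)) X′≈
           ∷ congruent (Z-prod (m ℕ.+ m) λ i _ → Z-+ (Z-* ZP Zω) (Z-ℕ (suc i))) (Z-* (Z-fact (m ℕ.+ m)) zl₃) Y₂≈
           ∷ congruent Z-lower ZI lower≈
           ∷ fixed (Zσ r) ∷ fixed (Z-fact r) ∷ fixed (Z-fact (m ℕ.+ m)) ∷ fixed (Z2^ n) ∷ fixed ZLₙ ∷ [])
          (λ X X′ Y lo s f F N L → s :* X :* X′ :* Y :* (f :* lo) :* F :* (N :* N) :* (L :* L))
        -- Each of the two (2m)! is 2ᵐ m! times the odd product `O₁`. The squares of `N` and `Lₙ` in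
        -- `multiplier` give every `O₁` a partner N σ n! Lₙ, which forms `V`.
        regroup : s * (σ * (fact n * l₁)) * (σ * (fact n * l₂)) * (F₂ * l₃) * (fact r * I) * F₂ * (N * N) * (Lₙ * Lₙ)
          ≡ s * (M * fact m) * (M * fact m) * (V * V) * (l₁ * l₂ * l₃)
        regroup = trans (cong₂ (λ x F → s * (σ * (fact n * l₁)) * (σ * (fact n * l₂)) * (F * l₃) * x * F * (N * N) * (Lₙ * Lₙ)) I-inverse (fact-double m))
          (solve 11 (λ s σ f l₁ l₂ l₃ N L M g O →
            s :* (σ :* (f :* l₁)) :* (σ :* (f :* l₂)) :* (M :* g :* O :* l₃) :* κ 1 :* (M :* g :* O) :* (N :* N) :* (L :* L)
              := s :* (M :* g) :* (M :* g) :* (O :* (N :* (σ :* (f :* L))) :* (O :* (N :* (σ :* (f :* L))))) :* (l₁ :* l₂ :* l₃))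
            s σ (fact n) l₁ l₂ l₃ N Lₙ M (fact m) O₁)
        -- N σ n! Lₙ is the value of the odd product from index m up to h, so `V` is congruent to
        -- the product of all odd numbers below p, evaluated once more in one piece.
        V≈ : V ≈ T * (τ * (fact h * Lₕ)) [ P² ]
        V≈ = ≈-trans (≈-*ˡ ZO₁ (≈-sym (odd-product m n m+n≡h)))
          (≈-trans (≡⇒≈ (trans (sym (prod-+ m n odd)) (cong (λ l → prod l odd) m+n≡h))) (odd-product 0 h refl))
          where
          m+n≡h : m ℕ.+ n ≡ h
          m+n≡h = trans (ℕP.+-comm m n) h≡
        ZV : Z V
        ZV = Z-* ZO₁ (Z-* (Z2^ n) (Z-* (Zσ n) (Z-* (Z-fact n) ZLₙ)))
        W Wₕ R : ℚ
        W  = T * (τ * (fact h * (T * T)))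
        Wₕ = T * (τ * (fact h * Lₕ))
        R  = Lₙ * Lₙ * lin (- ι 1 * hₕ) * lin ε
        ZWₕ : Z Wₕ
        ZWₕ = Z-* ZT (Z-* (Zσ h) (Z-* (Z-fact h) ZLₕ))
        odd-part : s * (M * fact m) * (M * fact m) * (V * V) * (l₁ * l₂ * l₃) ≈ s * (M * fact m) * (M * fact m) * (Wₕ * Wₕ) * R [ P² ]
        odd-part = ≈-substitute
          (congruent ZV ZWₕ V≈ ∷ congruent (Z-* (Z-* zl₁ zl₂) zl₃) (Z-* (Z-* (Z-* ZLₙ ZLₙ) Zε₄) (Z-lin Zε)) first-order
           ∷ fixed (Zσ r) ∷ fixed (Z2^ m) ∷ fixed (Z-fact m) ∷ [])
          (λ V l s M g → s :* (M :* g) :* (M :* g) :* (V :* V) :* l)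
        final : s * (M * fact m) * (M * fact m) * (Wₕ * Wₕ) * R ≈ common [ P² ]
        final = ≈-substitute
          (congruent ZLₕ (Z-* ZT ZT) (≈-sym T²≈)
           ∷ fixed (Z-* (Z-* (Z-* ZLₙ ZLₙ) Zε₄) (Z-lin Zε)) ∷ fixed (Zσ r) ∷ fixed (Z2^ m) ∷ fixed (Z-fact m) ∷ fixed ZT ∷ fixed (Zσ h) ∷ fixed (Z-fact h) ∷ [])
          (λ L R s M g T τ f → s :* (M :* g) :* (M :* g) :* (T :* (τ :* (f :* L)) :* (T :* (τ :* (f :* L)))) :* R)

      right-side : multiplier * (inv A * τ * S₁₆ * inv K * lin ε) ≈ common [ P² ]
      right-side = ≈-trans (≡⇒≈ collect) (≈-trans substituted (≡⇒≈ regroup))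
        where
        g l₄ : ℚ
        g  = fact m
        l₄ = lin (- ι 1 * hₕ)
        collect : multiplier * (inv A * τ * S₁₆ * inv K * lin ε) ≡ N * N * (fact h * Xₕ) * (g * g) * (Lₙ * Lₙ) * τ * S₁₆ * lin ε
        collect = trans (modulo₂ (Q * K * inv K) Q (Unit-inverse Unit-A) (Unit-inverse Unit-K)
          (solve 12 (λ N A f X′ K g L i τ S j ε →
             let Q = N :* N :* (f :* X′) :* (g :* g) :* (L :* L) :* τ :* S :* ε in
             N :* N :* A :* (f :* X′) :* (K :* (g :* g)) :* (L :* L) :* (i :* τ :* S :* j :* ε)
               := Q :+ Q :* K :* j :* (A :* i :- κ 1) :+ Q :* (K :* j :- κ 1))
             N A (fact r) X′ K g Lₙ (inv A) τ S₁₆ (inv K) (lin ε)))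
          (cong (λ x → N * N * x * (g * g) * (Lₙ * Lₙ) * τ * S₁₆ * lin ε) fact-r)
          where Q = N * N * (fact r * X′) * (g * g) * (Lₙ * Lₙ) * τ * S₁₆ * lin ε
        ZS₁₆ : Z S₁₆
        ZS₁₆ = Z-^ r (Z-neg (Z-ℕ 16))
        substituted : N * N * (fact h * Xₕ) * (g * g) * (Lₙ * Lₙ) * τ * S₁₆ * lin ε
          ≈ N * N * (fact h * (τ * (fact h * l₄))) * (g * g) * (Lₙ * Lₙ) * τ * S₁₆ * lin ε [ P² ]
        substituted = ≈-substitute
          (congruent (Z-prod h λ i _ → Z-+ (Z-ℕ h) (Z-ℕ (suc i))) (Z-* (Zσ h) (Z-* (Z-fact h) Zε₄)) Xₕ≈
           ∷ fixed (Z2^ n) ∷ fixed (Z-fact h) ∷ fixed (Z-fact m) ∷ fixed ZLₙ ∷ fixed (Zσ h) ∷ fixed ZS₁₆ ∷ fixed (Z-lin Zε) ∷ [])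
          (λ X N f g L τ S ε → N :* N :* (f :* X) :* (g :* g) :* (L :* L) :* τ :* S :* ε)
        -- The powers of two agree because T = N M gives N² (T M)⁴ = M² T⁶.
        regroup : N * N * (fact h * (τ * (fact h * l₄))) * (g * g) * (Lₙ * Lₙ) * τ * S₁₆ * lin ε ≡ common
        regroup = trans (cong (λ S → N * N * (fact h * (τ * (fact h * l₄))) * (g * g) * (Lₙ * Lₙ) * τ * S * lin ε) S₁₆≡)
          (modulo₁ (- (s * M * g * M * g * τ * fact h * τ * fact h * Lₙ * Lₙ * l₄ * lin ε * T * T * T * T * (T + N * M))) T≡
          (solve 10 (λ N M T s τ f g L l ε →
            N :* N :* (f :* (τ :* (f :* l))) :* (g :* g) :* (L :* L) :* τ :* (s :* (T :* M :* (T :* M) :* (T :* M) :* (T :* M))) :* ε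
              := s :* (M :* g) :* (M :* g) :* (T :* (τ :* (f :* (T :* T))) :* (T :* (τ :* (f :* (T :* T))))) :* (L :* L :* l :* ε)
                 :+ :- (s :* M :* g :* M :* g :* τ :* f :* τ :* f :* L :* L :* l :* ε :* T :* T :* T :* T :* (T :+ N :* M)) :* (T :- N :* M))
            N M T s τ (fact h) g Lₙ l₄ (lin ε)))

      -- The factors u = P t and p + 2u = P ω supply p², so the comparison of the remaining product
      -- is needed only modulo p².
      second-case : sum p (λ k → (ι r + u - ι (2 ℕ.* k)) * binomial (ι r + u) k ^ 4)
        ≈ secondExpansion P q t a ((- ι 1) ^ h) ((- ι 16) ^ r) (ι ((2 ℕ.* m) choose m)) hₙ hₘ [ P⁴ ]
      second-case = ≈-trans (quartic-reduction Zt r<p)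
        (≈-trans (≡⇒≈ (trans (cong (λ x → s * u * (x * lower)) upper-split)
            (solve 7 (λ s P t X ω Y lo → s :* (P :* t) :* (X :* (P :* ω :* Y) :* lo) := P :* P :* (t :* ω :* (s :* X :* Y :* lo))) s P t X ω Y lower)))
        (≈-trans (≈-mod (solve 1 (λ P → P :* P :* (P :* P) := P :* P :* P :* P) P)
            (≈-scale (P * P) (≈-*ˡ (Z-* Zt Zω) (≈-cancelˡ Unit-multiplier (≈-trans left-side (≈-sym right-side))))))
          (≡⇒≈ (solve 8 (λ P t ω i τ S j ε → P :* P :* (t :* ω :* (i :* τ :* S :* j :* ε)) := t :* (ω :* i) :* (P :* P) :* τ :* S :* j :* ε)
            P t ω (inv A) τ S₁₆ (inv K) (lin ε)))))

open import Defs
open import Data.Nat as ℕ using (ℕ; zero; suc; _<_)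
import Data.Nat.DivMod as ℕD
import Data.Nat.Properties as ℕP
open import Data.Nat.Primality using (Prime)
open import Data.Nat.Divisibility using (_∣_; divides)
open import Data.Nat.Combinatorics using (_C_)
open import Data.Rational using (ℚ; 0ℚ; 1ℚ; _+_; _*_; _-_; -_)
open import Data.Product using (_×_; _,_)
open import Relation.Nullary using (¬_; contradiction)
open import Relation.Binary.PropositionalEquality using (_≡_; refl; sym; trans; cong; cong₂; subst)

-- Halving p and locating the residue

odd-half : ∀ n → ¬ (2 ∣ n) → n ≡ suc ((n ℕ.∸ 1) ℕ./ 2 ℕ.+ (n ℕ.∸ 1) ℕ./ 2)
odd-half n 2∤n = trans n≡ (cong suc (trans (ℕP.*-comm k 2)
    (trans (cong (k ℕ.+_) (ℕP.+-identityʳ k)) (cong₂ ℕ._+_ k≡ k≡))))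
  where
  k = n ℕ./ 2
  remainder : ∀ m → m ≡ n ℕ.% 2 → m < 2 → n ≡ suc (k ℕ.* 2)
  remainder zero          m≡ _   = contradiction (divides k (trans (ℕD.m≡m%n+[m/n]*n n 2) (cong (ℕ._+ k ℕ.* 2) (sym m≡)))) 2∤n
  remainder (suc zero)    m≡ _   = trans (ℕD.m≡m%n+[m/n]*n n 2) (cong (ℕ._+ k ℕ.* 2) (sym m≡))
  remainder (suc (suc _)) _  m<2 = contradiction m<2 (ℕP.≤⇒≯ (ℕ.s≤s (ℕ.s≤s ℕ.z≤n)))
  n≡ : n ≡ suc (k ℕ.* 2)
  n≡ = remainder (n ℕ.% 2) refl (ℕD.m%n<n n 2)
  k≡ : k ≡ (n ℕ.∸ 1) ℕ./ 2
  k≡ = trans (sym (ℕD.m*n/n≡m k 2)) (cong (λ m → (m ℕ.∸ 1) ℕ./ 2) (sym n≡))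

-- Here h < r ≤ p - 1, so none of the truncated subtractions is cut off at zero. They become the
-- additive relations that `Second` takes as input.
above-half : ∀ {p h r} → p ≡ suc (h ℕ.+ h) → r < p → p < 2 ℕ.* r → r ≡ h ℕ.+ suc (r ℕ.∸ suc h) × p ℕ.∸ 1 ℕ.∸ r ℕ.+ suc (r ℕ.∸ suc h) ≡ h
above-half {p} {h} {r} refl r<p p<2r = r≡ , ℕP.+-cancelˡ-≡ h (n ℕ.+ m) h (trans (sym (ℕP.+-assoc h n m))
  (trans (cong (ℕ._+ m) (ℕP.+-comm h n)) (trans (ℕP.+-assoc n h m) (trans (cong (n ℕ.+_) (sym r≡)) (ℕP.m∸n+n≡m (ℕ.s≤s⁻¹ r<p))))))
  where
  n m : ℕ
  n = h ℕ.+ h ℕ.∸ r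
  m = suc (r ℕ.∸ suc h)
  h<r : h < r
  h<r = ℕP.≰⇒> λ r≤h → ℕP.<⇒≱ p<2r (ℕP.≤-trans (ℕP.+-mono-≤ r≤h (ℕP.≤-trans (ℕP.≤-reflexive (ℕP.+-identityʳ r)) r≤h)) (ℕP.n≤1+n (h ℕ.+ h)))
  r≡ : r ≡ h ℕ.+ m
  r≡ = trans (sym (ℕP.m+[n∸m]≡n h<r)) (sym (ℕP.+-suc h (r ℕ.∸ suc h)))

-- Translation to the operations and definitions of Defs

opaque
  unfolding Core._+_

  ι≡ : ∀ n → Core.ι n ≡ ℕ→ℚ n
  ι≡ n = refl

  ^≡ : ∀ x n → x Core.^ n ≡ x ^ n
  ^≡ x zero    = refl
  ^≡ x (suc n) = cong (x *_) (^≡ x n)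

  -ι^≡ : ∀ k n → (Core.- Core.ι k) Core.^ n ≡ (- ℕ→ℚ k) ^ n
  -ι^≡ k n = ^≡ (- ℕ→ℚ k) n

  sum≡ : ∀ n {f g} → (∀ k → f k ≡ g k) → Core.sum n f ≡ sumTo n g
  sum≡ zero    f≡g = refl
  sum≡ (suc n) f≡g = cong₂ _+_ (sum≡ n f≡g) (f≡g n)

  harmonic≡ : ∀ n → Core.harmonic n ≡ H n
  harmonic≡ n = sum≡ n λ i → sym (Core.1/suc≡inv i)

  harmonic₂≡ : ∀ n → Core.harmonic₂ n ≡ H2 n
  -- `suc i ℕ.* suc i` computes to `suc (i ℕ.+ i ℕ.* suc i)`, the successor form that `1/suc≡inv`
  -- requires.
  harmonic₂≡ n = sum≡ n λ i → sym (trans (Core.1/suc≡inv (i ℕ.+ i ℕ.* suc i)) (Core.inv-ι-square i))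

  harmonic-difference≡ : ∀ m n → Core.harmonic m Core.- Core.harmonic n ≡ H m - H n
  harmonic-difference≡ m n = cong₂ _-_ (harmonic≡ m) (harmonic≡ n)

  binomial≡ : ∀ a k → Core.binomial a k ≡ binom a k
  binomial≡ a zero    = refl
  binomial≡ a (suc k) = cong₂ (λ x y → x * (a - ℕ→ℚ k) * y) (binomial≡ a k) (sym (Core.1/suc≡inv k))

  Qp≡ : ∀ p {a a′} → a ≡ a′ → Core.sum p (λ k → (a Core.- Core.ι (2 ℕ.* k)) Core.* Core.binomial a k Core.^ 4) ≡ Qp p a′
  Qp≡ p {a} refl = sum≡ p λ k → cong ((a - ℕ→ℚ (2 ℕ.* k)) *_) (trans (^≡ (Core.binomial a k) 4) (cong (_^ 4) (binomial≡ a k)))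

  qp2≡ : ∀ p → (Core.ι (2 ℕ.^ (p ℕ.∸ 1)) Core.- Core.ι 1) Core.* Core.inv (Core.ι p) ≡ qp2 p
  qp2≡ p = refl

  toCongMod : ∀ p (p-prime : Prime p) → let open Core.AtPrime p p-prime in
    ∀ {x y x′ y′} → x ≈ y [ P⁴ ] → x ≡ x′ → y ≡ y′ → CongMod p x′ y′ (ℕ→ℚ p ^ 4)
  toCongMod p p-prime x≈y refl refl = quotient , p∤↧ Z-quotient , trans difference (cong (_* quotient) (trans P⁴≡P^4 (^≡ (ℕ→ℚ p) 4)))
    where
    open Core.AtPrime p p-prime
    open _≈_[_] x≈y
    open Z

  residue≡ : ∀ p (p-prime : Prime p) {a z} r → a - ℕ→ℚ r ≡ ℕ→ℚ p * z → Core.ι r Core.+ Core.ι p Core.* z ≡ a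
  residue≡ p p-prime r eq = Core.AtPrime.recover p p-prime eq

  quotient≡ : ∀ p (p-prime : Prime p) {x z} → x ≡ ℕ→ℚ p * z → z ≡ x * recip (ℕ→ℚ p)
  quotient≡ p p-prime eq = Core.AtPrime.quotient-P p p-prime eq

  -- Generalised over every ingredient: once the equations are matched with `refl`, the two
  -- expressions agree by unfolding.
  firstExpansion≡ : ∀ {P P′ t t′ σ σ′ K K′ D D′ E E′ F F′} →
    P ≡ P′ → t ≡ t′ → σ ≡ σ′ → K ≡ K′ → D ≡ D′ → E ≡ E′ → F ≡ F′ → let two = ℕ→ℚ 2 in
    Core.firstExpansion P t σ K D E F
      ≡ t′ * P′ * σ′ * K′ * (1ℚ + two * t′ * P′ * D′ + t′ * t′ * (P′ * P′) * (two * D′ * D′ - two * E′ + F′))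
  firstExpansion≡ refl refl refl refl refl refl refl = refl

  secondExpansion≡ : ∀ {P P′ q q′ t t′ a a′ σ σ′ S S′ K K′ Hₙ Hₙ′ Hₘ Hₘ′} →
    P ≡ P′ → q ≡ q′ → t ≡ t′ → a ≡ a′ → σ ≡ σ′ → S ≡ S′ → K ≡ K′ → Hₙ ≡ Hₙ′ → Hₘ ≡ Hₘ′ →
    let two = ℕ→ℚ 2
        c = (two * t′ + 1ℚ) * recip (two * a′ + 1ℚ)
    in Core.secondExpansion P q t a σ S K Hₙ Hₘ
      ≡ t′ * c * (P′ * P′) * σ′ * S′ * recip K′
        * (1ℚ + P′ * (c + (two * t′ - 1ℚ) * q′ - (two * t′ + 1ℚ) * recip two * (Hₙ′ - Hₘ′)))
  secondExpansion≡ refl refl refl refl refl refl refl refl refl = refl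

theorem5p1 : (p : ℕ) → Prime p → ¬ (2 ∣ p) →
    (a : ℚ) → InZp p a →
    ¬ CongMod p a 0ℚ (ℕ→ℚ p) → ¬ CongMod p a (- 1ℚ) (ℕ→ℚ p) →
    (r : ℕ) → r < p → CongMod p a (ℕ→ℚ r) (ℕ→ℚ p) →
    let P = ℕ→ℚ p
        a′ = (a - ℕ→ℚ r) * recip P
        h = (p ℕ.∸ 1) ℕ./ 2
        two = ℕ→ℚ 2
        D = H (2 ℕ.* r) - H r
    in (2 ℕ.* r < p →
         CongMod p (Qp p a)
           (a′ * P * ((- 1ℚ) ^ r) * ℕ→ℚ ((2 ℕ.* r) C r)
             * (1ℚ + two * a′ * P * D
                 + a′ * a′ * (P * P)
                   * (two * D * D - two * H2 (2 ℕ.* r) + H2 r)))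
           (P ^ 4))
     × (p < 2 ℕ.* r →
         let m = r ℕ.∸ h
             c = (two * a′ + 1ℚ) * recip (two * a + 1ℚ)
         in CongMod p (Qp p a)
           (a′ * c * (P * P) * ((- 1ℚ) ^ h) * ((- ℕ→ℚ 16) ^ r)
             * recip (ℕ→ℚ ((2 ℕ.* m) C m))
             * (1ℚ + P * (c + (two * a′ - 1ℚ) * qp2 p
                  - (two * a′ + 1ℚ) * recip two
                    * (H (p ℕ.∸ 1 ℕ.∸ r) - H (r ℕ.∸ suc h)))))
           (P ^ 4))
theorem5p1 p p-prime 2∤p a _ _ _ r r<p (z , p∤z , a-r≡) = first , second
  where
  open Core.AtPrime p p-prime using (mkZ; first-case; module Second)
  h = (p ℕ.∸ 1) ℕ./ 2
  p≡ : p ≡ suc (h ℕ.+ h)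
  p≡ = odd-half p 2∤p
  a≡ = residue≡ p p-prime {a} r a-r≡
  -- The witness `z` of a ≡ r (mod p) is a′ itself, and comes with its proof of p-integrality.
  a′≡ = quotient≡ p p-prime {a - ℕ→ℚ r} a-r≡
  first = λ 2r<p → toCongMod p p-prime (first-case (mkZ p∤z) r<p 2r<p) (Qp≡ p a≡)
    (firstExpansion≡ (ι≡ p) a′≡ (-ι^≡ 1 r) (ι≡ ((2 ℕ.* r) C r))
      (harmonic-difference≡ (2 ℕ.* r) r) (harmonic₂≡ (2 ℕ.* r)) (harmonic₂≡ r))
  second = λ p<2r → let r≡ , h≡ = above-half p≡ r<p p<2r in
    toCongMod p p-prime (Second.second-case (mkZ p∤z) p≡ r≡ h≡) (Qp≡ p a≡)
      (secondExpansion≡ (ι≡ p) (qp2≡ p) a′≡ a≡ (-ι^≡ 1 h) (-ι^≡ 16 r)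
        -- The binomial index r - h of the statement is identified with `suc (r ℕ.∸ suc h)`, the m
        -- of `Second`.
        (trans (cong (λ m → Core.ι ((2 ℕ.* m) C m)) (sym (trans (cong (ℕ._∸ h) r≡) (ℕP.m+n∸m≡n h _)))) (ι≡ _))
        (harmonic≡ (p ℕ.∸ 1 ℕ.∸ r)) (harmonic≡ (r ℕ.∸ suc h)))
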